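{- Let $p>3$ be a prime. Then $$\left(\frac{ -1}p\right)\sum_{k=0}^{p-1}\frac{\binom{2k}k^2}{16^k}H_k\equiv-4q_p(2)+2p\,q_p(2)^2\pmod{p^2},$$ $$\left(\frac p3\right)\sum_{k=0}^{p-1}\frac{\binom{2k}k\binom{3k}k}{27^k}H_k\equiv-3q_p(3)+\frac32p\,q_p(3)^2\pmod{p^2},$$ $$\left(\frac{ -2}p\right)\sum_{k=0}^{p-1}\frac{\binom{4k}{2k}\binom{2k}k}{64^k}H_k\equiv-6q_p(2)+3p\,q_p(2)^2\pmod{p^2},$$ and $$\left(\frac{ -1}p\right)\sum_{k=0}^{p-1}\frac{\binom{6k}{3k}\binom{3k}k}{432^k}H_k\equiv-3q_p(3)-4q_p(2)+p\left(\frac32q_p(3)^2+2q_p(2)^2\right)\pmod{p^2}.$$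
   Context: For $n\in\mathbb N=\{0,1,2,\ldots\}$, $H_n=\sum_{0<k\le n}\frac1k$ is the harmonic number. $\left(\frac{\cdot}{p}\right)$ and $\left(\frac{\cdot}{3}\right)$ denote Legendre symbols. For a prime $p$ and an integer $a\not\equiv0\pmod p$, $q_p(a)=(a^{p-1}-1)/p$ is the Fermat quotient. Congruences modulo $p^2$ are in the ring $\mathbb Z_p$ of $p$-adic integers (equivalently, among rationals with denominator prime to $p$). -}

module Defs where

open import Data.Bool.Base using (if_then_else_)
open import Data.Nat.Base as ℕ using (ℕ; suc; NonZero)
open import Data.Nat.Coprimality using (Coprime)
open import Data.Nat.Properties using (m^n≢0)
open import Data.Integer.Base as ℤ using (ℤ; +_; 0ℤ; 1ℤ; -1ℤ)
open import Data.Integer.Divisibility.Signed using (_∣_; _∣?_)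
open import Data.Rational.Base using (ℚ; ↧ₙ_; _/_; _*_; _-_)
open import Data.Rational.Properties using (+-0-commutativeMonoid)
open import Data.Fin.Base using (Fin; toℕ)
open import Data.Fin.Properties using (any?)
open import Data.Product.Base using (_×_; ∃-syntax)
open import Relation.Binary.PropositionalEquality.Core using (_≡_)
open import Relation.Nullary.Decidable using (Dec; does)
open import Algebra.Properties.CommutativeMonoid.Sum +-0-commutativeMonoid using (sum)

Σ< : ℕ → (ℕ → ℚ) → ℚ
Σ< n f = sum {n} (λ i → f (toℕ i))

syntax Σ< n (λ k → t) = Σ[ k < n ] t

-- Shifted index: the summand 1/(j+1) for j < n is 1/k for 0 < k ≤ n.
H : ℕ → ℚ
H n = Σ[ j < n ] (1ℤ / suc j)

infixl 7 _/[_^_]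

_/[_^_] : ℕ → (m k : ℕ) .{{_ : NonZero m}} → ℚ
a /[ m ^ k ] = (+ a / (m ℕ.^ k)) {{m^n≢0 m k}}

fermatQuotient : (p : ℕ) .{{_ : NonZero p}} → ℤ → ℚ
fermatQuotient p a = (a ℤ.^ (p ℕ.∸ 1) ℤ.- 1ℤ) / p

-- Searching the representatives 0, …, p-1 suffices, since x² mod p depends
-- only on x mod p.
IsSquareMod : ℕ → ℤ → Set
IsSquareMod p a = ∃[ x ] + p ∣ (+ toℕ {p} x) ℤ.* (+ toℕ x) ℤ.- a

isSquareMod? : ∀ p a → Dec (IsSquareMod p a)
isSquareMod? p a = any? λ x → + p ∣? (+ toℕ {p} x) ℤ.* (+ toℕ x) ℤ.- a

-- The Legendre symbol (a/p); meaningful for p an odd prime.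
legendre : ℤ → ℕ → ℤ
legendre a p =
  if does (+ p ∣? a) then 0ℤ
  else if does (isSquareMod? p a) then 1ℤ
  else -1ℤ

-- Membership in the ring ℤ₍ₚ₎ of rationals with denominator prime to p, for p
-- prime.  `↧ₙ x` is the denominator of x in lowest terms.
_∈ℤ₍_₎ : ℚ → ℕ → Set
x ∈ℤ₍ p ₎ = Coprime (↧ₙ x) p

infix 4 _∈ℤ₍_₎ _≋_[mod_]∈ℤ₍_₎

-- Congruence modulo m in the ring ℤ₍ₚ₎: both sides lie in the ring, and so
-- does the cofactor of m in their difference.
_≋_[mod_]∈ℤ₍_₎ : ℚ → ℚ → ℕ → ℕ → Set
x ≋ y [mod m ]∈ℤ₍ p ₎ =
  x ∈ℤ₍ p ₎ × y ∈ℤ₍ p ₎ × ∃[ z ] (z ∈ℤ₍ p ₎ × x - y ≡ (+ m / 1) * z)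

{-# OPTIONS --safe #-}
module Submission where

-- Put S(x) = Σ_{k<p} C(x,k) C(-1-x,k) H_k.  The four sums are S(-1/d) for
-- d = 2, 3, 4, 6, and S(-1-x) = S(x).  For 0 ≤ n < p, Pascal's rule gives the
-- exact value S(n) = 2 (-1)^n H_n.  Modulo p² the function S is affine in t on
-- x = a + p t, and a - p = -1 - (p-1-a), so S is known at t = 0 and t = -1,
-- hence everywhere.  With p = d a + i and i = ±1 mod d this yields
--   S(-1/d) = 2 (-1)^a h_d,   h_d = H_a + (p/d) Σ_{0<j≤a} 1/j²,   a = ⌊p/d⌋.
-- Both 2^(p-1) and 3^(p-1) are products of exact factors 1 + p u with u an
-- inverse of a residue; taking logarithms modulo p³ gives h_2 and h_3, and
-- splitting H_⌊p/2⌋ and H_⌊p/3⌋ into even and odd denominators gives h_4 and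
-- h_6.  The signs (-1)^a are Legendre symbols by Euler's criterion.

-- Two precisions coexist. A Fermat quotient is a quotient by p, so a relation such as 1 + p q =
-- 2^(p-1) must hold exactly among the p-local integers, while the sums are known only modulo p².
-- Hence one carrier with two equalities: the ring `B`, and its quotient by p², in which `π`, the
-- image of p, squares to zero. There each first-order expansion in p is a polynomial identity for
-- the ring solver, and exact identities of `B` descend without any change of terms. The sums `H₂`
-- of inverse squares enter only multiplied by `π`, so they matter only modulo p. They are what
-- separates a congruence modulo p² from one modulo p, and two facts control them: `π * H₂ M`
-- vanishes for M = (p-1)/2, where p > 3 is used, and the reflection of a to p-1-a changes the sign
-- of `π * H₂ a`. The residue i of p modulo d is 1 or d-1. The second case needs no separate sum:
-- the term ratio is a product of two linear factors, and exchanging them replaces i by d-i, which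
-- is the symmetry S(-1-x) = S(x).

open import Algebra.Bundles using (CommutativeRing)
open import Algebra.Core using (Op₂)
import Algebra.Properties.AbelianGroup
import Algebra.Properties.Ring
import Algebra.Solver.Ring
open import Algebra.Solver.Ring.AlmostCommutativeRing using (fromCommutativeRing; _-Raw-AlmostCommutative⟶_)
open import Data.Fin.Base as Fin using (Fin; toℕ; fromℕ<)
import Data.Fin.Properties as Fin
open import Data.Integer.Base as ℤ using (ℤ; +_; -[1+_]; 0ℤ; 1ℤ; -1ℤ; ∣_∣)
import Data.Integer.Divisibility.Signed as ℤ
import Data.Integer.Properties as ℤ
import Data.Integer.Tactic.RingSolver as ℤSolver
open import Data.Maybe.Base using (Maybe; just; nothing)
open import Data.Nat.Base as ℕ using (ℕ; zero; suc; _<_; z≤n; s≤s; _!; NonZero)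
open import Data.Nat.Combinatorics using (_C_; nCk+nC[k+1]≡[n+1]C[k+1]; k>n⇒nCk≡0; nCn≡1; nC1≡n)
open import Data.Nat.Coprimality using (Coprime)
open import Data.Nat.Divisibility using (_∣_; _∣?_; divides; ∣-refl; ∣-trans; ∣1⇒≡1; >⇒∤)
open import Data.Nat.DivMod using (_divMod_; result)
open import Data.Nat.Primality using (Prime; prime?; euclidsLemma; prime⇒irreducible; prime⇒nonTrivial)
import Data.Nat.Properties as ℕ
open import Data.Nat.Tactic.RingSolver using (solve-∀)
open import Data.Product.Base using (_×_; _,_; Σ-syntax; ∃-syntax; proj₁; proj₂)
open import Data.Rational.Base as ℚ using (ℚ; ↧_; ↧ₙ_; 0ℚ; 1ℚ; toℚᵘ)
import Data.Rational.Properties as ℚ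
open import Data.Rational.Unnormalised.Base as ℚᵘ using (mkℚᵘ; *≡*)
import Data.Rational.Unnormalised.Properties as ℚᵘ
open import Data.Sum.Base using (_⊎_; inj₁; inj₂)
open import Data.Vec.Base using (Vec; []; _∷_; replicate)
open import Level using (0ℓ; _⊔_)
import Relation.Binary.Construct.On as On
open import Relation.Binary.PropositionalEquality.Core as ≡ using (_≡_)
import Relation.Binary.PropositionalEquality.Properties as ≡
open import Relation.Nullary.Decidable using (yes; no; dec-true; dec-false; from-yes)
open import Relation.Nullary.Negation.Core using (¬_; contradiction)

-- Numerals and iterated operations depend on the bare operations only, so that
-- they agree definitionally in a ring and in its quotients.
numeral : ∀ {a} {A : Set a} → Op₂ A → A → A → ℕ → A
numeral _+_ 0# 1# zero    = 0#
numeral _+_ 0# 1# (suc n) = 1# + numeral _+_ 0# 1# n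

fold : ∀ {a} {A : Set a} → Op₂ A → A → ℕ → (ℕ → A) → A
fold _∙_ ε zero    f = ε
fold _∙_ ε (suc n) f = fold _∙_ ε n f ∙ f n

∏ℕ : ℕ → (ℕ → ℕ) → ℕ
∏ℕ = fold ℕ._*_ 1

-- Commutative rings: numerals, a solver with integer coefficients, finite sums and products.

module RingLemmas {c ℓ} (R : CommutativeRing c ℓ) where

  open CommutativeRing R hiding (_-_) public
  open Algebra.Properties.Ring ring public
    using (-‿distribˡ-*; -‿distribʳ-*; -0#≈0#; -‿involutive; -1*x≈-x)
  open Algebra.Properties.AbelianGroup +-abelianGroup public using (⁻¹-∙-comm)
  open import Relation.Binary.Reasoning.Setoid setoid public

  infixl 6 _-_
  _-_ : Carrier → Carrier → Carrier
  x - y = x + - y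

  ι : ℕ → Carrier
  ι = numeral _+_ 0# 1#

  ∑ ∏ : ℕ → (ℕ → Carrier) → Carrier
  ∑ = fold _+_ 0#
  ∏ = fold _*_ 1#

  infixr 8 _^_
  _^_ : Carrier → ℕ → Carrier
  x ^ n = ∏ n (λ _ → x)

  ι-+ : ∀ m n → ι (m ℕ.+ n) ≈ ι m + ι n
  ι-+ zero    n = sym (+-identityˡ (ι n))
  ι-+ (suc m) n = trans (+-congˡ (ι-+ m n)) (sym (+-assoc 1# (ι m) (ι n)))

  ι-* : ∀ m n → ι (m ℕ.* n) ≈ ι m * ι n
  ι-* zero    n = sym (zeroˡ (ι n))
  ι-* (suc m) n = begin
    ι (n ℕ.+ m ℕ.* n)      ≈⟨ ι-+ n (m ℕ.* n) ⟩
    ι n + ι (m ℕ.* n)      ≈⟨ +-cong (sym (*-identityˡ (ι n))) (ι-* m n) ⟩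
    1# * ι n + ι m * ι n   ≈⟨ sym (distribʳ (ι n) 1# (ι m)) ⟩
    (1# + ι m) * ι n       ∎

  private
    φ : ℤ → Carrier
    φ (+ n)    = ι n
    φ -[1+ n ] = - ι (suc n)

    φ-⊖ : ∀ m n → φ (m ℤ.⊖ n) ≈ ι m - ι n
    φ-⊖ m       zero    = sym (trans (+-congˡ -0#≈0#) (+-identityʳ (ι m)))
    φ-⊖ zero    (suc n) = sym (+-identityˡ _)
    φ-⊖ (suc m) (suc n) = begin
      φ (suc m ℤ.⊖ suc n)                   ≡⟨ ≡.cong φ (ℤ.[1+m]⊖[1+n]≡m⊖n m n) ⟩
      φ (m ℤ.⊖ n)                           ≈⟨ φ-⊖ m n ⟩
      ι m - ι n                             ≈⟨ +-congʳ (sym (+-identityˡ (ι m))) ⟩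
      (0# + ι m) - ι n                      ≈⟨ +-congʳ (+-congʳ (sym (-‿inverseʳ 1#))) ⟩
      (1# - 1# + ι m) - ι n                 ≈⟨ +-congʳ (trans (+-assoc _ _ _) (+-congˡ (+-comm _ _))) ⟩
      (1# + (ι m - 1#)) - ι n               ≈⟨ trans (+-congʳ (sym (+-assoc _ _ _))) (+-assoc _ _ _) ⟩
      (1# + ι m) + (- 1# - ι n)             ≈⟨ +-congˡ (⁻¹-∙-comm 1# (ι n)) ⟩
      (1# + ι m) - (1# + ι n)               ∎

    φ-neg : ∀ i → φ (ℤ.- i) ≈ - φ i
    φ-neg (+ zero)  = sym -0#≈0#
    φ-neg (+ suc n) = refl
    φ-neg -[1+ n ]  = sym (-‿involutive _)

    φ-+ : ∀ i j → φ (i ℤ.+ j) ≈ φ i + φ j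
    φ-+ (+ m)    (+ n)    = ι-+ m n
    φ-+ (+ m)    -[1+ n ] = φ-⊖ m (suc n)
    φ-+ -[1+ m ] (+ n)    = trans (φ-⊖ n (suc m)) (+-comm _ _)
    φ-+ -[1+ m ] -[1+ n ] = begin
      - ι (suc (suc (m ℕ.+ n)))   ≡⟨ ≡.cong (λ k → - ι (suc k)) (≡.sym (ℕ.+-suc m n)) ⟩
      - ι (suc m ℕ.+ suc n)       ≈⟨ -‿cong (ι-+ (suc m) (suc n)) ⟩
      - (ι (suc m) + ι (suc n))   ≈⟨ sym (⁻¹-∙-comm _ _) ⟩
      - ι (suc m) - ι (suc n)     ∎

    φ-+* : ∀ m j → φ (+ m ℤ.* j) ≈ ι m * φ j
    φ-+* m (+ n)    = trans (reflexive (≡.cong φ (≡.sym (ℤ.pos-* m n)))) (ι-* m n)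
    φ-+* m -[1+ n ] = begin
      φ (+ m ℤ.* -[1+ n ])       ≡⟨ ≡.cong φ (≡.sym (ℤ.neg-distribʳ-* (+ m) (+ suc n))) ⟩
      φ (ℤ.- (+ m ℤ.* + suc n))  ≈⟨ φ-neg (+ m ℤ.* + suc n) ⟩
      - φ (+ m ℤ.* + suc n)      ≈⟨ -‿cong (φ-+* m (+ suc n)) ⟩
      - (ι m * ι (suc n))        ≈⟨ -‿distribʳ-* _ _ ⟩
      ι m * - ι (suc n)          ∎

    φ-* : ∀ i j → φ (i ℤ.* j) ≈ φ i * φ j
    φ-* (+ m)    j = φ-+* m j
    φ-* -[1+ m ] j = begin
      φ (-[1+ m ] ℤ.* j)         ≡⟨ ≡.cong φ (≡.sym (ℤ.neg-distribˡ-* (+ suc m) j)) ⟩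
      φ (ℤ.- (+ suc m ℤ.* j))    ≈⟨ φ-neg (+ suc m ℤ.* j) ⟩
      - φ (+ suc m ℤ.* j)        ≈⟨ -‿cong (φ-+* (suc m) j) ⟩
      - (ι (suc m) * φ j)        ≈⟨ -‿distribˡ-* _ _ ⟩
      - ι (suc m) * φ j          ∎

    -- The coefficient 1 is read as 1# and not as 1# + 0#, so that solver
    -- equations match the goals on the nose.
    ⟦_⟧ : ℤ → Carrier
    ⟦ + 1 ⟧ = 1#
    ⟦ i   ⟧ = φ i

    ⟦⟧≈φ : ∀ i → ⟦ i ⟧ ≈ φ i
    ⟦⟧≈φ (+ 0)             = refl
    ⟦⟧≈φ (+ 1)             = sym (+-identityʳ 1#)
    ⟦⟧≈φ (+ suc (suc n))   = refl
    ⟦⟧≈φ -[1+ n ]          = refl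

    coefficients : CommutativeRing.rawRing ℤ.+-*-commutativeRing -Raw-AlmostCommutative⟶ fromCommutativeRing R
    coefficients = record
      { ⟦_⟧    = ⟦_⟧
      ; +-homo = λ i j → trans (⟦⟧≈φ (i ℤ.+ j)) (trans (φ-+ i j) (sym (+-cong (⟦⟧≈φ i) (⟦⟧≈φ j))))
      ; *-homo = λ i j → trans (⟦⟧≈φ (i ℤ.* j)) (trans (φ-* i j) (sym (*-cong (⟦⟧≈φ i) (⟦⟧≈φ j))))
      ; -‿homo = λ i → trans (⟦⟧≈φ (ℤ.- i)) (trans (φ-neg i) (sym (-‿cong (⟦⟧≈φ i))))
      ; 0-homo = refl
      ; 1-homo = refl
      }

    -- Equality in the ring need not be decidable; the solver only has to compare integer
    -- coefficients.
    _coeff≟_ : ∀ i j → Maybe (⟦ i ⟧ ≈ ⟦ j ⟧)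
    i coeff≟ j with i ℤ.≟ j
    ... | yes ≡.refl = just refl
    ... | no  _      = nothing

  module Solver = Algebra.Solver.Ring
    (CommutativeRing.rawRing ℤ.+-*-commutativeRing) (fromCommutativeRing R) coefficients _coeff≟_
  open Solver public using (solve; _:=_; _:+_; _:*_; :-_; _:-_; con)

  ℕcon : ∀ {n} → ℕ → Solver.Polynomial n
  ℕcon k = con (+ k)

  -- Nested uses of `using-eq` express x - y as a combination of the a - b.
  using-eq : ∀ {a b x y} c → a ≈ b → x + c * b ≈ y + c * a → x ≈ y
  using-eq {a} {b} {x} {y} c a≈b eq = begin
    x                       ≈⟨ cancel x (c * b) ⟨
    x + c * b - c * b       ≈⟨ +-cong eq (-‿cong (*-congˡ (sym a≈b))) ⟩
    y + c * a - c * a       ≈⟨ cancel y (c * a) ⟩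
    y                       ∎
    where
    cancel : ∀ u v → u + v - v ≈ u
    cancel = solve 2 (λ u v → u :+ v :- v := u) refl

  ∑-cong : ∀ n {f g : ℕ → Carrier} → (∀ k → k < n → f k ≈ g k) → ∑ n f ≈ ∑ n g
  ∑-cong zero    _   = refl
  ∑-cong (suc n) f≈g = +-cong (∑-cong n (λ k k<n → f≈g k (ℕ.m<n⇒m<1+n k<n))) (f≈g n ℕ.≤-refl)

  ∏-cong : ∀ n {f g : ℕ → Carrier} → (∀ k → k < n → f k ≈ g k) → ∏ n f ≈ ∏ n g
  ∏-cong zero    _   = refl
  ∏-cong (suc n) f≈g = *-cong (∏-cong n (λ k k<n → f≈g k (ℕ.m<n⇒m<1+n k<n))) (f≈g n ℕ.≤-refl)

  ∑-+ : ∀ n f g → ∑ n (λ k → f k + g k) ≈ ∑ n f + ∑ n g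
  ∑-+ zero    f g = sym (+-identityˡ 0#)
  ∑-+ (suc n) f g = trans (+-congʳ (∑-+ n f g))
    (solve 4 (λ a b c d → (a :+ b) :+ (c :+ d) := (a :+ c) :+ (b :+ d)) refl (∑ n f) (∑ n g) (f n) (g n))

  ∏-* : ∀ n f g → ∏ n (λ k → f k * g k) ≈ ∏ n f * ∏ n g
  ∏-* zero    f g = sym (*-identityˡ 1#)
  ∏-* (suc n) f g = trans (*-congʳ (∏-* n f g))
    (solve 4 (λ a b c d → (a :* b) :* (c :* d) := (a :* c) :* (b :* d)) refl (∏ n f) (∏ n g) (f n) (g n))

  *-distrib-∑ : ∀ n c f → ∑ n (λ k → c * f k) ≈ c * ∑ n f
  *-distrib-∑ zero    c f = sym (zeroʳ c)
  *-distrib-∑ (suc n) c f = trans (+-congʳ (*-distrib-∑ n c f)) (sym (distribˡ c _ _))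

  ∑-head : ∀ n f → ∑ (suc n) f ≈ f 0 + ∑ n (λ k → f (suc k))
  ∑-head zero    f = +-comm 0# (f 0)
  ∑-head (suc n) f = trans (+-congʳ (∑-head n f)) (+-assoc _ _ _)

  ∑-zero : ∀ n {f : ℕ → Carrier} → (∀ k → k < n → f k ≈ 0#) → ∑ n f ≈ 0#
  ∑-zero zero    _   = refl
  ∑-zero (suc n) f≈0 = trans
    (+-cong (∑-zero n (λ k k<n → f≈0 k (ℕ.m<n⇒m<1+n k<n))) (f≈0 n ℕ.≤-refl)) (+-identityʳ 0#)

  ι-∏ : ∀ n f → ι (∏ℕ n f) ≈ ∏ n (λ k → ι (f k))
  ι-∏ zero    f = +-identityʳ 1#
  ι-∏ (suc n) f = trans (ι-* (∏ℕ n f) (f n)) (*-congʳ (ι-∏ n f))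

  ^-+ : ∀ x m n → x ^ (m ℕ.+ n) ≈ x ^ m * x ^ n
  ^-+ x zero    n = sym (*-identityˡ _)
  ^-+ x (suc m) n = trans (*-congʳ (^-+ x m n))
    (solve 3 (λ a b x → (a :* b) :* x := (a :* x) :* b) refl (x ^ m) (x ^ n) x)

  ι-^ : ∀ a n → ι (a ℕ.^ n) ≈ ι a ^ n
  ι-^ a zero    = +-identityʳ 1#
  ι-^ a (suc n) = trans (ι-* a (a ℕ.^ n)) (trans (*-comm _ _) (*-congʳ (ι-^ a n)))

  inverse-unique : ∀ {x y z} → x * y ≈ 1# → x * z ≈ 1# → y ≈ z
  inverse-unique {x} {y} {z} xy≈1 xz≈1 = using-eq z xy≈1 (using-eq (- y) xz≈1
    (solve 3 (λ x y z → y :+ z :* ℕcon 1 :+ :- y :* ℕcon 1 := z :+ z :* (x :* y) :+ :- y :* (x :* z))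
      refl x y z))

  *-cancelʳ-unit : ∀ {x y z w} → z * w ≈ 1# → x * z ≈ y * z → x ≈ y
  *-cancelʳ-unit {x} {y} {z} {w} zw≈1 eq = using-eq (y - x) zw≈1 (using-eq w eq
    (solve 4 (λ x y z w → x :+ (y :- x) :* ℕcon 1 :+ w :* (y :* z) := y :+ (y :- x) :* (z :* w) :+ w :* (x :* z))
      refl x y z w))

  sgn : ℕ → Carrier
  sgn n = (- 1#) ^ n

  sgn-even : ∀ n → sgn (n ℕ.+ n) ≈ 1#
  sgn-even zero    = refl
  sgn-even (suc n) = trans (*-congʳ (trans (reflexive (≡.cong sgn (ℕ.+-suc n n))) (*-congʳ (sgn-even n))))
    (solve 0 (ℕcon 1 :* :- ℕcon 1 :* :- ℕcon 1 := ℕcon 1) refl)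

  InvertsBelow : ℕ → (ℕ → Carrier) → Set ℓ
  InvertsBelow p inv = ∀ j → suc j < p → ι (suc j) * inv j ≈ 1#

  NoZeroDivisors : Set (c ⊔ ℓ)
  NoZeroDivisors = ∀ x y → x * y ≈ 0# → x ≈ 0# ⊎ y ≈ 0#

  SquareZero : Carrier → Set ℓ
  SquareZero x = x * x ≈ 0#

  -- In the harmonic sums index `j` carries denominator `j + 1`, so the indices `2 i + 1` are the
  -- even denominators. When `e` is 1 the additional last term has odd denominator.
  ∑-parity : ∀ e n f → e ℕ.≤ 1 →
    ∑ (e ℕ.+ (n ℕ.+ n)) f ≈ ∑ n (λ i → f (2 ℕ.* i ℕ.+ 1)) + ∑ (e ℕ.+ n) (λ i → f (2 ℕ.* i ℕ.+ 0))
  ∑-parity _ zero f z≤n = sym (+-identityˡ 0#)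
  ∑-parity _ (suc n) f z≤n = begin
    ∑ (n ℕ.+ suc n) f + f (n ℕ.+ suc n)
      ≡⟨ ≡.cong (λ i → ∑ i f + f i) (ℕ.+-suc n n) ⟩
    ∑ (n ℕ.+ n) f + f (n ℕ.+ n) + f (suc (n ℕ.+ n))
      ≡⟨ ≡.cong₂ (λ i j → ∑ (n ℕ.+ n) f + f i + f j) (even n) (odd n) ⟩
    ∑ (n ℕ.+ n) f + f (2 ℕ.* n ℕ.+ 0) + f (2 ℕ.* n ℕ.+ 1)
      ≈⟨ +-congʳ (+-congʳ (∑-parity 0 n f z≤n)) ⟩
    ∑ n (λ i → f (2 ℕ.* i ℕ.+ 1)) + ∑ n (λ i → f (2 ℕ.* i ℕ.+ 0)) + f (2 ℕ.* n ℕ.+ 0) + f (2 ℕ.* n ℕ.+ 1)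
      ≈⟨ solve 4 (λ a b c d → a :+ b :+ c :+ d := (a :+ d) :+ (b :+ c)) refl _ _ _ _ ⟩
    ∑ (suc n) (λ i → f (2 ℕ.* i ℕ.+ 1)) + ∑ (suc n) (λ i → f (2 ℕ.* i ℕ.+ 0)) ∎
    where
    even : ∀ n → n ℕ.+ n ≡ 2 ℕ.* n ℕ.+ 0
    even = solve-∀
    odd : ∀ n → suc (n ℕ.+ n) ≡ 2 ℕ.* n ℕ.+ 1
    odd = solve-∀
  ∑-parity _ n f (s≤s z≤n) = begin
    ∑ (n ℕ.+ n) f + f (n ℕ.+ n)
      ≈⟨ +-cong (∑-parity 0 n f z≤n) (reflexive (≡.cong f (even n))) ⟩
    ∑ n (λ i → f (2 ℕ.* i ℕ.+ 1)) + ∑ n (λ i → f (2 ℕ.* i ℕ.+ 0)) + f (2 ℕ.* n ℕ.+ 0)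
      ≈⟨ +-assoc _ _ _ ⟩
    ∑ n (λ i → f (2 ℕ.* i ℕ.+ 1)) + ∑ (suc n) (λ i → f (2 ℕ.* i ℕ.+ 0)) ∎
    where
    even : ∀ n → n ℕ.+ n ≡ 2 ℕ.* n ℕ.+ 0
    even = solve-∀

  -- The operator (1 + shift)^n applied to `c` and read off at 0. Pascal's rule is built into the
  -- recursion, so binomial identities become inductions on `n` that change the sequence.
  binomialSum : ℕ → (ℕ → Carrier) → Carrier
  binomialSum zero    c = c 0
  binomialSum (suc n) c = binomialSum n (λ k → c k + c (suc k))

  binomialSum-cong : ∀ n {c d : ℕ → Carrier} → (∀ k → k ℕ.≤ n → c k ≈ d k) → binomialSum n c ≈ binomialSum n d
  binomialSum-cong zero    c≈d = c≈d 0 z≤n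
  binomialSum-cong (suc n) c≈d = binomialSum-cong n (λ k k≤n → +-cong (c≈d k (ℕ.m≤n⇒m≤1+n k≤n)) (c≈d (suc k) (s≤s k≤n)))

  binomialSum-+ : ∀ n c d → binomialSum n (λ k → c k + d k) ≈ binomialSum n c + binomialSum n d
  binomialSum-+ zero    c d = refl
  binomialSum-+ (suc n) c d = trans
    (binomialSum-cong n (λ k _ → solve 4 (λ a b c d → (a :+ b) :+ (c :+ d) := (a :+ c) :+ (b :+ d))
      refl (c k) (d k) (c (suc k)) (d (suc k))))
    (binomialSum-+ n _ _)

  binomialSum-* : ∀ n x c → binomialSum n (λ k → x * c k) ≈ x * binomialSum n c
  binomialSum-* zero    x c = refl
  binomialSum-* (suc n) x c = trans (binomialSum-cong n (λ k _ → sym (distribˡ x _ _))) (binomialSum-* n x _)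

  -- The terms beyond `n` vanish, which allows the common summation bound p for all `n < p`.
  binomialSum-expand : ∀ n N c → n < N → binomialSum n c ≈ ∑ N (λ k → ι (n C k) * c k)
  binomialSum-expand zero (suc N) c _ = sym (begin
    ∑ (suc N) (λ k → ι (0 C k) * c k)                    ≈⟨ ∑-head N _ ⟩
    ι 1 * c 0 + ∑ N (λ k → ι (0 C suc k) * c (suc k))    ≈⟨ +-congˡ (∑-zero N (λ k _ → zeroˡ _)) ⟩
    ι 1 * c 0 + 0#                                       ≈⟨ solve 1 (λ x → (ℕcon 1 :+ ℕcon 0) :* x :+ ℕcon 0 := x) refl (c 0) ⟩
    c 0                                                  ∎)
  binomialSum-expand (suc n) (suc N) c (s≤s n<N) = begin
    binomialSum n (λ k → c k + c (suc k))
      ≈⟨ binomialSum-expand n (suc N) _ (ℕ.m<n⇒m<1+n n<N) ⟩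
    ∑ (suc N) (λ k → ι (n C k) * (c k + c (suc k)))
      ≈⟨ trans (∑-cong (suc N) (λ k _ → distribˡ _ _ _)) (∑-+ (suc N) _ _) ⟩
    ∑ (suc N) (λ k → ι (n C k) * c k) + (∑ N (λ k → ι (n C k) * c (suc k)) + ι (n C N) * c (suc N))
      ≈⟨ +-cong (∑-head N _) (+-congˡ (trans (*-congʳ (reflexive (≡.cong ι (k>n⇒nCk≡0 n<N)))) (zeroˡ _))) ⟩
    (ι (n C 0) * c 0 + ∑ N (λ k → ι (n C suc k) * c (suc k))) + (∑ N (λ k → ι (n C k) * c (suc k)) + 0#)
      ≈⟨ solve 3 (λ x y z → (x :+ y) :+ (z :+ ℕcon 0) := x :+ (z :+ y)) refl _ _ _ ⟩
    ι (n C 0) * c 0 + (∑ N (λ k → ι (n C k) * c (suc k)) + ∑ N (λ k → ι (n C suc k) * c (suc k)))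
      ≈⟨ +-congˡ (sym (∑-+ N _ _)) ⟩
    ι (suc n C 0) * c 0 + ∑ N (λ k → ι (n C k) * c (suc k) + ι (n C suc k) * c (suc k))
      ≈⟨ +-congˡ (∑-cong N (λ k _ → trans (sym (distribʳ _ _ _)) (*-congʳ (pascal k)))) ⟩
    ι (suc n C 0) * c 0 + ∑ N (λ k → ι (suc n C suc k) * c (suc k))
      ≈⟨ sym (∑-head N _) ⟩
    ∑ (suc N) (λ k → ι (suc n C k) * c k) ∎
    where
    pascal : ∀ k → ι (n C k) + ι (n C suc k) ≈ ι (suc n C suc k)
    pascal k = trans (sym (ι-+ (n C k) (n C suc k))) (reflexive (≡.cong ι (nCk+nC[k+1]≡[n+1]C[k+1] n k)))

-- Quotient of a commutative ring by a principal ideal, on the same carrier.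

module Quotient {c ℓ} (R : CommutativeRing c ℓ) (m : CommutativeRing.Carrier R) where

  open RingLemmas R

  infix 4 _≈ₘ_
  _≈ₘ_ : Carrier → Carrier → Set (c ⊔ ℓ)
  x ≈ₘ y = ∃[ z ] x - y ≈ m * z

  ≈⇒≈ₘ : ∀ {x y} → x ≈ y → x ≈ₘ y
  ≈⇒≈ₘ {x} {y} x≈y = 0# , using-eq 1# x≈y
    (solve 3 (λ x y m → x :- y :+ ℕcon 1 :* y := m :* ℕcon 0 :+ ℕcon 1 :* x) refl x y m)

  quotient : CommutativeRing c (c ⊔ ℓ)
  quotient = record
    { Carrier = Carrier
    ; _≈_     = _≈ₘ_
    ; _+_     = _+_
    ; _*_     = _*_
    ; -_      = -_
    ; 0#      = 0#
    ; 1#      = 1#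
    ; isCommutativeRing = record
      { isRing = record
        { +-isAbelianGroup = record
          { isGroup = record
            { isMonoid = record
              { isSemigroup = record
                { isMagma = record
                  { isEquivalence = record
                    { refl  = ≈⇒≈ₘ refl
                    ; sym   = λ {x} {y} (z , eq) → - z , using-eq (- 1#) eq
                        (solve 4 (λ x y z m → y :- x :+ :- ℕcon 1 :* (m :* z) := m :* :- z :+ :- ℕcon 1 :* (x :- y))
                          refl x y z m)
                    ; trans = λ {x} {y} {w} (z , eq) (z′ , eq′) → z + z′ , using-eq 1# eq (using-eq 1# eq′
                        (solve 6 (λ x y w z z′ m →
                          x :- w :+ ℕcon 1 :* (m :* z) :+ ℕcon 1 :* (m :* z′)
                          := m :* (z :+ z′) :+ ℕcon 1 :* (x :- y) :+ ℕcon 1 :* (y :- w))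
                          refl x y w z z′ m))
                    }
                  ; ∙-cong = λ {x} {y} {u} {v} (z , eq) (z′ , eq′) → z + z′ , using-eq 1# eq (using-eq 1# eq′
                      (solve 7 (λ x y u v z z′ m →
                        (x :+ u) :- (y :+ v) :+ ℕcon 1 :* (m :* z) :+ ℕcon 1 :* (m :* z′)
                        := m :* (z :+ z′) :+ ℕcon 1 :* (x :- y) :+ ℕcon 1 :* (u :- v))
                        refl x y u v z z′ m))
                  }
                ; assoc = λ x y z → ≈⇒≈ₘ (+-assoc x y z)
                }
              ; identity = (λ x → ≈⇒≈ₘ (+-identityˡ x)) , (λ x → ≈⇒≈ₘ (+-identityʳ x))
              }
            ; inverse = (λ x → ≈⇒≈ₘ (-‿inverseˡ x)) , (λ x → ≈⇒≈ₘ (-‿inverseʳ x))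
            ; ⁻¹-cong = λ {x} {y} (z , eq) → - z , using-eq (- 1#) eq
                (solve 4 (λ x y z m → :- x :- :- y :+ :- ℕcon 1 :* (m :* z) := m :* :- z :+ :- ℕcon 1 :* (x :- y))
                  refl x y z m)
            }
          ; comm = λ x y → ≈⇒≈ₘ (+-comm x y)
          }
        ; *-cong = λ {x} {y} {u} {v} (z , eq) (z′ , eq′) → u * z + y * z′ , using-eq u eq (using-eq y eq′
            (solve 7 (λ x y u v z z′ m →
              (x :* u) :- (y :* v) :+ u :* (m :* z) :+ y :* (m :* z′)
              := m :* (u :* z :+ y :* z′) :+ u :* (x :- y) :+ y :* (u :- v))
              refl x y u v z z′ m))
        ; *-assoc    = λ x y z → ≈⇒≈ₘ (*-assoc x y z)
        ; *-identity = (λ x → ≈⇒≈ₘ (*-identityˡ x)) , (λ x → ≈⇒≈ₘ (*-identityʳ x))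
        ; distrib    = (λ x y z → ≈⇒≈ₘ (distribˡ x y z)) , (λ x y z → ≈⇒≈ₘ (distribʳ x y z))
        }
      ; *-comm = λ x y → ≈⇒≈ₘ (*-comm x y)
      }
    }

  modulus≈0 : m ≈ₘ 0#
  modulus≈0 = 1# , solve 1 (λ m → m :- ℕcon 0 := m :* ℕcon 1) refl m

-- Absorption identities for binomial coefficients.

absorption : ∀ n k → suc k ℕ.* (suc n C suc k) ≡ suc n ℕ.* (n C k)
absorption zero    zero    = ≡.refl
absorption zero    (suc k) = ℕ.*-zeroʳ (suc (suc k))
absorption (suc n) zero    = ≡.trans (ℕ.*-identityˡ (suc (suc n) C 1))
  (≡.trans (nC1≡n (suc (suc n))) (≡.sym (ℕ.*-identityʳ (suc (suc n)))))
absorption (suc n) (suc k) = begin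
  suc (suc k) ℕ.* (suc (suc n) C suc (suc k))
    ≡⟨ ≡.cong (suc (suc k) ℕ.*_) (≡.sym (nCk+nC[k+1]≡[n+1]C[k+1] (suc n) (suc k))) ⟩
  suc (suc k) ℕ.* (x ℕ.+ (suc n C suc (suc k)))
    ≡⟨ ℕ.*-distribˡ-+ (suc (suc k)) x (suc n C suc (suc k)) ⟩
  (x ℕ.+ suc k ℕ.* x) ℕ.+ suc (suc k) ℕ.* (suc n C suc (suc k))
    ≡⟨ ≡.cong₂ (λ u v → (x ℕ.+ u) ℕ.+ v) (absorption n k) (absorption n (suc k)) ⟩
  (x ℕ.+ suc n ℕ.* (n C k)) ℕ.+ suc n ℕ.* (n C suc k)
    ≡⟨ ℕ.+-assoc x _ _ ⟩
  x ℕ.+ (suc n ℕ.* (n C k) ℕ.+ suc n ℕ.* (n C suc k))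
    ≡⟨ ≡.cong (x ℕ.+_) (≡.sym (ℕ.*-distribˡ-+ (suc n) (n C k) (n C suc k))) ⟩
  x ℕ.+ suc n ℕ.* ((n C k) ℕ.+ (n C suc k))
    ≡⟨ ≡.cong (λ u → x ℕ.+ suc n ℕ.* u) (nCk+nC[k+1]≡[n+1]C[k+1] n k) ⟩
  suc (suc n) ℕ.* x ∎
  where
  open ≡.≡-Reasoning
  x = suc n C suc k

-- The ratio (n-k)/(k+1) of neighbouring coefficients, with the subtraction moved across. Adding
-- C(n,k) to both sides turns it into absorption.
C-raise : ∀ n k → suc k ℕ.* (n C suc k) ℕ.+ k ℕ.* (n C k) ≡ n ℕ.* (n C k)
C-raise n k = ℕ.+-cancelˡ-≡ (n C k) _ _ (begin
  (n C k) ℕ.+ (suc k ℕ.* (n C suc k) ℕ.+ k ℕ.* (n C k))   ≡⟨ lemma (n C k) (n C suc k) k ⟩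
  suc k ℕ.* ((n C k) ℕ.+ (n C suc k))                    ≡⟨ ≡.cong (suc k ℕ.*_) (nCk+nC[k+1]≡[n+1]C[k+1] n k) ⟩
  suc k ℕ.* (suc n C suc k)                              ≡⟨ absorption n k ⟩
  suc n ℕ.* (n C k)                                      ∎)
  where
  open ≡.≡-Reasoning
  lemma : ∀ x y k → x ℕ.+ (suc k ℕ.* y ℕ.+ k ℕ.* x) ≡ suc k ℕ.* (x ℕ.+ y)
  lemma = solve-∀

-- Both sides are (n+j+1)!/(n! j!).
C-diagonal : ∀ n j → suc j ℕ.* ((n ℕ.+ suc j) C suc j) ≡ suc n ℕ.* ((suc n ℕ.+ j) C j)
C-diagonal n j rewrite ℕ.+-suc n j = ℕ.+-cancelʳ-≡ (j ℕ.* (suc (n ℕ.+ j) C j)) _ _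
  (≡.trans (C-raise (suc (n ℕ.+ j)) j) (ℕ.*-distribʳ-+ (suc (n ℕ.+ j) C j) (suc n) j))

-- The function S: its values at integers, its reflection, its first-order expansion.

module HarmonicSums {c ℓ} (R : CommutativeRing c ℓ) (p : ℕ) (inv : ℕ → CommutativeRing.Carrier R)
  (inv-correct : RingLemmas.InvertsBelow R p inv) where

  open RingLemmas R

  H H₂ : ℕ → Carrier
  H  n = ∑ n inv
  H₂ n = ∑ n (λ j → inv j * inv j)

  -- The binomial coefficient C(-1-n, j).
  negBinomial : ℕ → ℕ → Carrier
  negBinomial n j = sgn j * ι ((n ℕ.+ j) C j)

  negBinomial-pascal : ∀ n j → negBinomial (suc n) j + negBinomial (suc n) (suc j) ≈ negBinomial n (suc j)
  negBinomial-pascal n j = begin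
    sgn j * ι ((suc n ℕ.+ j) C j) + sgn j * (- 1#) * ι ((suc n ℕ.+ suc j) C suc j)
      ≈⟨ +-congˡ (*-congˡ (trans (reflexive (≡.cong ι step)) (ι-+ ((suc n ℕ.+ j) C j) ((n ℕ.+ suc j) C suc j)))) ⟩
    sgn j * x + sgn j * (- 1#) * (x + ι ((n ℕ.+ suc j) C suc j))
      ≈⟨ solve 3 (λ s x y → s :* x :+ s :* :- ℕcon 1 :* (x :+ y) := s :* :- ℕcon 1 :* y) refl (sgn j) x _ ⟩
    sgn j * (- 1#) * ι ((n ℕ.+ suc j) C suc j) ∎
    where
    x = ι ((suc n ℕ.+ j) C j)
    step : (suc n ℕ.+ suc j) C suc j ≡ ((suc n ℕ.+ j) C j) ℕ.+ ((n ℕ.+ suc j) C suc j)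
    step = ≡.trans (≡.sym (nCk+nC[k+1]≡[n+1]C[k+1] (n ℕ.+ suc j) j))
      (≡.cong (λ i → (i C j) ℕ.+ ((n ℕ.+ suc j) C suc j)) (ℕ.+-suc n j))

  -- Absorption C(x,j+1) = (x/(j+1)) C(x-1,j) at x = -(n+1). It trades the inverse of j+1, which
  -- comes from an increment of `H`, for the inverse of n+1, which is constant in the sum.
  negBinomial-inv : ∀ n j → suc n < p → suc j < p →
    negBinomial (suc n) j * inv j ≈ - (inv n * negBinomial n (suc j))
  negBinomial-inv n j n<p j<p = using-eq (- (s * x * u)) (inv-correct n n<p)
      (using-eq (s * v * y) (inv-correct j j<p) (using-eq (- (s * u * v)) absorbed
        (solve 7 (λ s x y u v N J →
          s :* x :* u :+ :- (s :* x :* u) :* ℕcon 1 :+ s :* v :* y :* ℕcon 1 :+ :- (s :* u :* v) :* (N :* x)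
          := :- (v :* (s :* :- ℕcon 1 :* y)) :+ :- (s :* x :* u) :* (N :* v) :+ s :* v :* y :* (J :* u)
             :+ :- (s :* u :* v) :* (J :* y))
          refl s x y u v (ι (suc n)) (ι (suc j)))))
    where
    s = sgn j
    x = ι ((suc n ℕ.+ j) C j)
    y = ι ((n ℕ.+ suc j) C suc j)
    u = inv j
    v = inv n
    absorbed : ι (suc j) * y ≈ ι (suc n) * x
    absorbed = begin
      ι (suc j) * y                                ≈⟨ ι-* (suc j) ((n ℕ.+ suc j) C suc j) ⟨
      ι (suc j ℕ.* ((n ℕ.+ suc j) C suc j))        ≡⟨ ≡.cong ι (C-diagonal n j) ⟩
      ι (suc n ℕ.* ((suc n ℕ.+ j) C j))            ≈⟨ ι-* (suc n) ((suc n ℕ.+ j) C j) ⟩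
      ι (suc n) * x                                ∎

  -- The shift s makes the induction on n go through: by Pascal's rule, passing
  -- from n to n - 1 raises s by one.
  binomialSum-negBinomial : ∀ n s → binomialSum n (λ k → negBinomial n (k ℕ.+ s)) ≈ sgn (n ℕ.+ s)
  binomialSum-negBinomial zero    s = trans (*-congˡ (trans (reflexive (≡.cong ι (nCn≡1 s))) (+-identityʳ 1#)))
    (*-identityʳ (sgn s))
  binomialSum-negBinomial (suc n) s = begin
    binomialSum n (λ k → negBinomial (suc n) (k ℕ.+ s) + negBinomial (suc n) (suc (k ℕ.+ s)))
      ≈⟨ binomialSum-cong n (λ k _ → trans (negBinomial-pascal n (k ℕ.+ s))
           (reflexive (≡.cong (negBinomial n) (≡.sym (ℕ.+-suc k s))))) ⟩
    binomialSum n (λ k → negBinomial n (k ℕ.+ suc s))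
      ≈⟨ binomialSum-negBinomial n (suc s) ⟩
    sgn (n ℕ.+ suc s)
      ≡⟨ ≡.cong sgn (ℕ.+-suc n s) ⟩
    sgn (suc n ℕ.+ s) ∎

  -- Pascal's rule merges neighbouring terms up to the increment of `H`. By `negBinomial-inv` that
  -- increment leaves `inv n` times a sum without `H`, known from `binomialSum-negBinomial`; these
  -- contributions add up to `H n`.
  binomialSum-negBinomial-H : ∀ n s → n ℕ.+ s < p →
    binomialSum n (λ k → negBinomial n (k ℕ.+ s) * H (k ℕ.+ s)) ≈ sgn (n ℕ.+ s) * (H (n ℕ.+ s) + H n)
  binomialSum-negBinomial-H zero    s _ = trans
    (*-congʳ (binomialSum-negBinomial 0 s)) (*-congˡ (sym (+-identityʳ (H s))))
  binomialSum-negBinomial-H (suc n) s n+s<p = begin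
    binomialSum n (λ k → t k s + negBinomial (suc n) (suc (k ℕ.+ s)) * H (suc (k ℕ.+ s)))
      ≈⟨ binomialSum-cong n (λ k k≤n → trans (step (k ℕ.+ s) (ℕ.≤-<-trans (s≤s (ℕ.+-monoˡ-≤ s k≤n)) n+s<p))
           (reflexive (≡.cong (λ j → negBinomial n j * H j + inv n * negBinomial n j) (≡.sym (ℕ.+-suc k s))))) ⟩
    binomialSum n (λ k → negBinomial n (k ℕ.+ suc s) * H (k ℕ.+ suc s) + inv n * negBinomial n (k ℕ.+ suc s))
      ≈⟨ binomialSum-+ n _ _ ⟩
    binomialSum n (λ k → negBinomial n (k ℕ.+ suc s) * H (k ℕ.+ suc s))
      + binomialSum n (λ k → inv n * negBinomial n (k ℕ.+ suc s))
      ≈⟨ +-cong (binomialSum-negBinomial-H n (suc s) (≡.subst (_< p) (≡.sym (ℕ.+-suc n s)) n+s<p))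
           (trans (binomialSum-* n (inv n) _) (*-congˡ (binomialSum-negBinomial n (suc s)))) ⟩
    sgn (n ℕ.+ suc s) * (H (n ℕ.+ suc s) + H n) + inv n * sgn (n ℕ.+ suc s)
      ≈⟨ solve 4 (λ s h g v → s :* (h :+ g) :+ v :* s := s :* (h :+ (g :+ v))) refl _ _ _ _ ⟩
    sgn (n ℕ.+ suc s) * (H (n ℕ.+ suc s) + H (suc n))
      ≡⟨ ≡.cong (λ j → sgn j * (H j + H (suc n))) (ℕ.+-suc n s) ⟩
    sgn (suc n ℕ.+ s) * (H (suc n ℕ.+ s) + H (suc n)) ∎
    where
    t = λ k s → negBinomial (suc n) (k ℕ.+ s) * H (k ℕ.+ s)
    step : ∀ j → suc j < p →
      negBinomial (suc n) j * H j + negBinomial (suc n) (suc j) * H (suc j)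
        ≈ negBinomial n (suc j) * H (suc j) + inv n * negBinomial n (suc j)
    step j j<p = using-eq (H j + inv j) (negBinomial-pascal n j)
      (using-eq (- 1#) (negBinomial-inv n j (ℕ.≤-<-trans (s≤s (ℕ.m≤m+n n s)) n+s<p) j<p)
      (solve 6 (λ a b c h u v →
        a :* h :+ b :* (h :+ u) :+ (h :+ u) :* c :+ :- ℕcon 1 :* :- (v :* c)
        := c :* (h :+ u) :+ v :* c :+ (h :+ u) :* (a :+ b) :+ :- ℕcon 1 :* (a :* u))
        refl (negBinomial (suc n) j) (negBinomial (suc n) (suc j)) (negBinomial n (suc j)) (H j) (inv j) (inv n)))

  -- F x k = C(x, k) C(-1-x, k).
  F : Carrier → ℕ → Carrier
  F x zero    = 1#
  F x (suc k) = F x k * - ((x - ι k) * (x + ι (suc k))) * (inv k * inv k)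

  S : Carrier → Carrier
  S x = ∑ p (λ k → F x k * H k)

  -- Term ratios agree: C(n,k) contributes (n-k)/(k+1) and C(n+k,k) contributes (n+k+1)/(k+1).
  F-ι : ∀ n k → k < p → F (ι n) k ≈ ι (n C k) * negBinomial n k
  F-ι n zero    _   = solve 0 (ℕcon 1 := (ℕcon 1 :+ ℕcon 0) :* (ℕcon 1 :* (ℕcon 1 :+ ℕcon 0))) refl
  F-ι n (suc k) k<p = begin
    F (ι n) k * - ((ι n - ι k) * (ι n + ι (suc k))) * (v * v)
      ≈⟨ *-congʳ (*-congʳ (F-ι n k (ℕ.<-trans (ℕ.n<1+n k) k<p))) ⟩
    A * (s * B) * - ((ι n - ι k) * (ι n + ι (suc k))) * (v * v)
      ≈⟨ eq ⟩
    A′ * (s * (- 1#) * B′) ∎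
    where
    v = inv k
    s = sgn k
    A = ι (n C k)
    A′ = ι (n C suc k)
    B = ι ((n ℕ.+ k) C k)
    B′ = ι ((n ℕ.+ suc k) C suc k)
    raiseA : ι (suc k) * A′ + ι k * A ≈ ι n * A
    raiseA = begin
      ι (suc k) * A′ + ι k * A                        ≈⟨ +-cong (ι-* (suc k) (n C suc k)) (ι-* k (n C k)) ⟨
      ι (suc k ℕ.* (n C suc k)) + ι (k ℕ.* (n C k))   ≈⟨ ι-+ (suc k ℕ.* (n C suc k)) (k ℕ.* (n C k)) ⟨
      ι (suc k ℕ.* (n C suc k) ℕ.+ k ℕ.* (n C k))     ≡⟨ ≡.cong ι (C-raise n k) ⟩
      ι (n ℕ.* (n C k))                               ≈⟨ ι-* n (n C k) ⟩
      ι n * A                                         ∎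
    raiseB : ι (suc k) * B′ ≈ (ι n + ι (suc k)) * B
    raiseB = begin
      ι (suc k) * B′                                ≈⟨ ι-* (suc k) ((n ℕ.+ suc k) C suc k) ⟨
      ι (suc k ℕ.* ((n ℕ.+ suc k) C suc k))         ≡⟨ ≡.cong (λ i → ι (suc k ℕ.* (i C suc k))) (ℕ.+-suc n k) ⟩
      ι (suc k ℕ.* (suc (n ℕ.+ k) C suc k))         ≡⟨ ≡.cong ι (absorption (n ℕ.+ k) k) ⟩
      ι (suc (n ℕ.+ k) ℕ.* ((n ℕ.+ k) C k))         ≈⟨ ι-* (suc (n ℕ.+ k)) ((n ℕ.+ k) C k) ⟩
      ι (suc (n ℕ.+ k)) * B                         ≡⟨ ≡.cong (λ i → ι i * B) (≡.sym (ℕ.+-suc n k)) ⟩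
      ι (n ℕ.+ suc k) * B                           ≈⟨ *-congʳ (ι-+ n (suc k)) ⟩
      (ι n + ι (suc k)) * B                         ∎
    K = ι (suc k)
    eq : A * (s * B) * - ((ι n - ι k) * (ι n + ι (suc k))) * (v * v) ≈ A′ * (s * (- 1#) * B′)
    eq = begin
      A * (s * B) * - ((ι n - ι k) * (ι n + K)) * (v * v)
        ≈⟨ solve 7 (λ A s B N k K v → A :* (s :* B) :* :- ((N :- k) :* (N :+ K)) :* (v :* v)
             := :- s :* (N :* A :- k :* A) :* ((N :+ K) :* B) :* (v :* v)) refl A s B (ι n) (ι k) K v ⟩
      - s * (ι n * A - ι k * A) * ((ι n + K) * B) * (v * v)
        ≈⟨ *-congʳ (*-cong (*-congˡ (+-congʳ (sym raiseA))) (sym raiseB)) ⟩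
      - s * (K * A′ + ι k * A - ι k * A) * (K * B′) * (v * v)
        ≈⟨ solve 7 (λ A A′ s B′ k K v → :- s :* (K :* A′ :+ k :* A :- k :* A) :* (K :* B′) :* (v :* v)
             := A′ :* (s :* :- ℕcon 1 :* B′) :* ((K :* v) :* (K :* v))) refl A A′ s B′ (ι k) K v ⟩
      A′ * (s * (- 1#) * B′) * ((K * v) * (K * v))
        ≈⟨ trans (*-congˡ (trans (*-cong (inv-correct k k<p) (inv-correct k k<p)) (*-identityˡ 1#))) (*-identityʳ _) ⟩
      A′ * (s * (- 1#) * B′) ∎

  S-ι : ∀ n → n < p → S (ι n) ≈ sgn n * (H n + H n)
  S-ι n n<p = begin
    ∑ p (λ k → F (ι n) k * H k)
      ≈⟨ ∑-cong p (λ k k<p → trans (*-congʳ (F-ι n k k<p)) (*-assoc _ _ _)) ⟩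
    ∑ p (λ k → ι (n C k) * (negBinomial n k * H k))
      ≈⟨ binomialSum-expand n p _ n<p ⟨
    binomialSum n (λ k → negBinomial n k * H k)
      ≈⟨ binomialSum-cong n (λ k _ → reflexive (≡.cong (λ j → negBinomial n j * H j) (≡.sym (ℕ.+-identityʳ k)))) ⟩
    binomialSum n (λ k → negBinomial n (k ℕ.+ 0) * H (k ℕ.+ 0))
      ≈⟨ binomialSum-negBinomial-H n 0 (≡.subst (_< p) (≡.sym (ℕ.+-identityʳ n)) n<p) ⟩
    sgn (n ℕ.+ 0) * (H (n ℕ.+ 0) + H n)
      ≡⟨ ≡.cong (λ j → sgn j * (H j + H n)) (ℕ.+-identityʳ n) ⟩
    sgn n * (H n + H n) ∎

  F-cong : ∀ {x y} k → x ≈ y → F x k ≈ F y k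
  F-cong zero    x≈y = refl
  F-cong (suc k) x≈y = *-congʳ (*-cong (F-cong k x≈y) (-‿cong (*-cong (+-congʳ x≈y) (+-congʳ x≈y))))

  -- Each factor (x-k)(x+k+1) is invariant under the exchange of x and -1-x.
  F-reflect : ∀ x k → F (- 1# - x) k ≈ F x k
  F-reflect x zero    = refl
  F-reflect x (suc k) = *-congʳ (*-cong (F-reflect x k) (-‿cong
    (solve 2 (λ x k → (:- ℕcon 1 :- x :- k) :* (:- ℕcon 1 :- x :+ (ℕcon 1 :+ k)) := (x :- k) :* (x :+ (ℕcon 1 :+ k)))
      refl x (ι k))))

  S-cong : ∀ {x y} → x ≈ y → S x ≈ S y
  S-cong x≈y = ∑-cong p (λ k _ → *-congʳ (F-cong k x≈y))

  S-reflect : ∀ x → S (- 1# - x) ≈ S x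
  S-reflect x = ∑-cong p (λ k _ → *-congʳ (F-reflect x k))

  -- The derivative of F in x: modulo a square-zero ε, F is affine along x + ε t.
  F′ : Carrier → ℕ → Carrier
  F′ x zero    = 0#
  F′ x (suc k) = (F′ x k * - ((x - ι k) * (x + ι (suc k))) - F x k * (x + x + 1#)) * (inv k * inv k)

  module _ (ε : Carrier) (ε²≈0 : ε * ε ≈ 0#) where

    F-affine : ∀ x t k → F (x + ε * t) k ≈ F x k + ε * t * F′ x k
    F-affine x t zero    = solve 1 (λ x → ℕcon 1 := ℕcon 1 :+ x :* ℕcon 0) refl (ε * t)
    F-affine x t (suc k) = *-cancel-congʳ (using-eq m (F-affine x t k) (using-eq d ε²≈0
      (solve 7 (λ f x f′ f₀ k e t →
        f :* :- ((x :+ e :* t :- k) :* (x :+ e :* t :+ (ℕcon 1 :+ k)))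
          :+ :- ((x :+ e :* t :- k) :* (x :+ e :* t :+ (ℕcon 1 :+ k))) :* (f₀ :+ e :* t :* f′)
          :+ (:- (t :* t :* (f₀ :+ e :* t :* f′ :+ f′ :* (x :+ x :+ ℕcon 1)))) :* ℕcon 0
        := f₀ :* :- ((x :- k) :* (x :+ (ℕcon 1 :+ k)))
          :+ e :* t :* (f′ :* :- ((x :- k) :* (x :+ (ℕcon 1 :+ k))) :- f₀ :* (x :+ x :+ ℕcon 1))
          :+ :- ((x :+ e :* t :- k) :* (x :+ e :* t :+ (ℕcon 1 :+ k))) :* f
          :+ (:- (t :* t :* (f₀ :+ e :* t :* f′ :+ f′ :* (x :+ x :+ ℕcon 1)))) :* (e :* e))
        refl (F (x + ε * t) k) x (F′ x k) (F x k) (ι k) ε t)))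
      where
      m = - ((x + ε * t - ι k) * (x + ε * t + ι (suc k)))
      -- The cofactor of ε² in the product of the two first-order expansions.
      d = - (t * t * (F x k + ε * t * F′ x k + F′ x k * (x + x + 1#)))
      *-cancel-congʳ : ∀ {a b g h} → a ≈ b + g * h → a * (inv k * inv k) ≈ b * (inv k * inv k) + g * (h * (inv k * inv k))
      *-cancel-congʳ {a} {b} {g} {h} eq = trans (*-congʳ eq)
        (solve 4 (λ b g h v → (b :+ g :* h) :* v := b :* v :+ g :* (h :* v)) refl b g h (inv k * inv k))

    -- The sum `D` of derivatives is never evaluated: the expansion at t = -1 expresses it through a
    -- second value of `S`.
    S-affine : ∀ x t → S (x + ε * t) ≈ S x + t * (S x - S (x - ε))
    S-affine x t = begin
      S (x + ε * t)
        ≈⟨ first t ⟩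
      S x + ε * t * D
        ≈⟨ solve 4 (λ s e t d → s :+ e :* t :* d := s :+ t :* (s :- (s :+ e :* :- ℕcon 1 :* d))) refl (S x) ε t D ⟩
      S x + t * (S x - (S x + ε * - 1# * D))
        ≈⟨ +-congˡ (*-congˡ (+-congˡ (-‿cong (trans (sym (first (- 1#))) (S-cong x-ε))))) ⟩
      S x + t * (S x - S (x - ε)) ∎
      where
      x-ε : x + ε * - 1# ≈ x - ε
      x-ε = solve 2 (λ x e → x :+ e :* :- ℕcon 1 := x :- e) refl x ε
      D = ∑ p (λ k → F′ x k * H k)
      first : ∀ t → S (x + ε * t) ≈ S x + ε * t * ∑ p (λ k → F′ x k * H k)
      first t = begin
        ∑ p (λ k → F (x + ε * t) k * H k)
          ≈⟨ ∑-cong p (λ k _ → trans (*-congʳ (F-affine x t k))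
               (trans (distribʳ _ _ _) (+-congˡ (*-assoc _ _ _)))) ⟩
        ∑ p (λ k → F x k * H k + ε * t * (F′ x k * H k))
          ≈⟨ trans (∑-+ p _ _) (+-congˡ (*-distrib-∑ p _ _)) ⟩
        S x + ε * t * ∑ p (λ k → F′ x k * H k) ∎

-- Harmonic numbers modulo p²: residue classes, reflection, halving.

module HarmonicCongruences {c ℓ} (R : CommutativeRing c ℓ) (p M : ℕ) (p≡1+2M : p ≡ suc (M ℕ.+ M)) (3<p : 3 < p)
  (inv : ℕ → CommutativeRing.Carrier R) (inv-correct : RingLemmas.InvertsBelow R p inv)
  (π²≈0 : RingLemmas.SquareZero R (RingLemmas.ι R p)) where

  open RingLemmas R
  open HarmonicSums R p inv inv-correct

  -- Because `inv j` inverts `j + 1`, the inverses of 2 and 3 sit at indices 1 and 2.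
  π half third : Carrier
  π     = ι p
  half  = inv 1
  third = inv 2

  half-correct : ι 2 * half ≈ 1#
  half-correct = inv-correct 1 (ℕ.<-trans (ℕ.n<1+n 2) 3<p)

  third-correct : ι 3 * third ≈ 1#
  third-correct = inv-correct 2 3<p

  -- The geometric series of 1/(t π - u), which stops after the linear term since π² = 0.
  inverse-reflect : ∀ {u w α β} t → u + w ≈ t * π → u * α ≈ 1# → w * β ≈ 1# → β ≈ - α - t * π * (α * α)
  inverse-reflect {u} {w} {α} t u+w≈tπ uα≈1 wβ≈1 = inverse-unique wβ≈1
    (using-eq (- α - t * π * (α * α)) u+w≈tπ (using-eq (1# + t * π * α) uα≈1 (using-eq (- (t * t * (α * α))) π²≈0
      (solve 5 (λ u w a t q →
        w :* (:- a :- t :* q :* (a :* a)) :+ (:- a :- t :* q :* (a :* a)) :* (t :* q)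
          :+ (ℕcon 1 :+ t :* q :* a) :* ℕcon 1 :+ (:- (t :* t :* (a :* a))) :* ℕcon 0
        := ℕcon 1 :+ (:- a :- t :* q :* (a :* a)) :* (u :+ w)
          :+ (ℕcon 1 :+ t :* q :* a) :* (u :* a) :+ (:- (t :* t :* (a :* a))) :* (q :* q))
        refl u w α t π))))

  -- As d i + e′ + 1 = t p - d (N - i), the inverses over a residue class modulo d
  -- are expressed through the inverses of an initial segment.
  module ResidueClass (d t N e′ : ℕ) (δ : Carrier) (dδ≈1 : ι d * δ ≈ 1#)
    (dN+e≡tp : d ℕ.* N ℕ.+ suc e′ ≡ t ℕ.* p) (N<p : N < p) where

    private
      v : ℕ → Carrier
      v i = inv (d ℕ.* i ℕ.+ e′)

      term : ∀ i b → b ℕ.+ suc i ≡ N → suc (d ℕ.* i ℕ.+ e′) < p →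
        v i ≈ - (δ * inv b) - ι t * π * ((δ * inv b) * (δ * inv b))
      term i b b+i≡N v<p = inverse-reflect (ι t) sum uα≈1 (inv-correct (d ℕ.* i ℕ.+ e′) v<p)
        where
        b<p : suc b < p
        b<p = ℕ.≤-<-trans (ℕ.≤-trans (ℕ.≤-trans (s≤s (ℕ.m≤m+n b i)) (ℕ.≤-reflexive (≡.sym (ℕ.+-suc b i))))
          (ℕ.≤-reflexive b+i≡N)) N<p
        regroup : ∀ d b i e → d ℕ.* suc b ℕ.+ suc (d ℕ.* i ℕ.+ e) ≡ d ℕ.* (b ℕ.+ suc i) ℕ.+ suc e
        regroup = solve-∀
        sum : ι d * ι (suc b) + ι (suc (d ℕ.* i ℕ.+ e′)) ≈ ι t * π
        sum = begin
          ι d * ι (suc b) + ι (suc (d ℕ.* i ℕ.+ e′))       ≈⟨ +-congʳ (ι-* d (suc b)) ⟨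
          ι (d ℕ.* suc b) + ι (suc (d ℕ.* i ℕ.+ e′))       ≈⟨ ι-+ (d ℕ.* suc b) (suc (d ℕ.* i ℕ.+ e′)) ⟨
          ι (d ℕ.* suc b ℕ.+ suc (d ℕ.* i ℕ.+ e′))         ≡⟨ ≡.cong ι (regroup d b i e′) ⟩
          ι (d ℕ.* (b ℕ.+ suc i) ℕ.+ suc e′)               ≡⟨ ≡.cong (λ n → ι (d ℕ.* n ℕ.+ suc e′)) b+i≡N ⟩
          ι (d ℕ.* N ℕ.+ suc e′)                           ≡⟨ ≡.cong ι dN+e≡tp ⟩
          ι (t ℕ.* p)                                      ≈⟨ ι-* t p ⟩
          ι t * π                                          ∎
        uα≈1 : ι d * ι (suc b) * (δ * inv b) ≈ 1#
        uα≈1 = begin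
          ι d * ι (suc b) * (δ * inv b)      ≈⟨ solve 4 (λ a b c d → a :* b :* (c :* d) := a :* c :* (b :* d)) refl _ _ _ _ ⟩
          ι d * δ * (ι (suc b) * inv b)      ≈⟨ *-cong dδ≈1 (inv-correct b b<p) ⟩
          1# * 1#                            ≈⟨ *-identityˡ 1# ⟩
          1#                                 ∎

    -- Term `i` is matched with the denominator N - i, so the first `n` terms of the class cover the
    -- segment from b+1 to N. The induction on `n` therefore lowers `b`.
    ∑-class : ∀ n b → b ℕ.+ n ≡ N → (∀ i → i < n → suc (d ℕ.* i ℕ.+ e′) < p) →
      ∑ n v ≈ - (δ * (H N - H b)) - ι t * π * (δ * δ * (H₂ N - H₂ b))
    ∑-class zero    b ≡.refl _ rewrite ℕ.+-identityʳ b =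
      solve 5 (λ d h g t q → ℕcon 0 := :- (d :* (h :- h)) :- t :* q :* (d :* d :* (g :- g))) refl δ (H b) (H₂ b) (ι t) π
    ∑-class (suc n) b b+n≡N v<p = begin
      ∑ n v + v n
        ≈⟨ +-cong (∑-class n (suc b) (≡.trans (≡.sym (ℕ.+-suc b n)) b+n≡N) (λ i i<n → v<p i (ℕ.m<n⇒m<1+n i<n)))
             (term n b b+n≡N (v<p n ℕ.≤-refl)) ⟩
      - (δ * (H N - H (suc b))) - ι t * π * (δ * δ * (H₂ N - H₂ (suc b)))
        + (- (δ * inv b) - ι t * π * ((δ * inv b) * (δ * inv b)))
        ≈⟨ solve 8 (λ d hN hb gN gb t q i →
             :- (d :* (hN :- (hb :+ i))) :- t :* q :* (d :* d :* (gN :- (gb :+ i :* i)))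
               :+ (:- (d :* i) :- t :* q :* ((d :* i) :* (d :* i)))
             := :- (d :* (hN :- hb)) :- t :* q :* (d :* d :* (gN :- gb)))
             refl δ (H N) (H b) (H₂ N) (H₂ b) (ι t) π (inv b) ⟩
      - (δ * (H N - H b)) - ι t * π * (δ * δ * (H₂ N - H₂ b)) ∎

    -- The factor `π` kills the first-order correction of each inverse, and squaring removes the
    -- sign.
    ∑-class² : ∀ n b → b ℕ.+ n ≡ N → (∀ i → i < n → suc (d ℕ.* i ℕ.+ e′) < p) →
      π * ∑ n (λ i → v i * v i) ≈ π * (δ * δ * (H₂ N - H₂ b))
    ∑-class² zero    b ≡.refl _ rewrite ℕ.+-identityʳ b =
      solve 3 (λ d g q → q :* ℕcon 0 := q :* (d :* d :* (g :- g))) refl δ (H₂ b) π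
    ∑-class² (suc n) b b+n≡N v<p = begin
      π * (∑ n (λ i → v i * v i) + v n * v n)
        ≈⟨ trans (distribˡ _ _ _) (+-cong
             (∑-class² n (suc b) (≡.trans (≡.sym (ℕ.+-suc b n)) b+n≡N) (λ i i<n → v<p i (ℕ.m<n⇒m<1+n i<n)))
             (*-congˡ (*-cong vn vn))) ⟩
      π * (δ * δ * (H₂ N - H₂ (suc b))) + π * ((- x - ι t * π * (x * x)) * (- x - ι t * π * (x * x)))
        ≈⟨ using-eq ((x * x * x) * (ι t + ι t + ι t * ι t * π * x)) π²≈0
           (solve 6 (λ d gN gb t q i →
             q :* (d :* d :* (gN :- (gb :+ i :* i)))
               :+ q :* ((:- (d :* i) :- t :* q :* ((d :* i) :* (d :* i))) :* (:- (d :* i) :- t :* q :* ((d :* i) :* (d :* i))))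
               :+ ((d :* i :* (d :* i) :* (d :* i)) :* (t :+ t :+ t :* t :* q :* (d :* i))) :* ℕcon 0
             := q :* (d :* d :* (gN :- gb))
               :+ ((d :* i :* (d :* i) :* (d :* i)) :* (t :+ t :+ t :* t :* q :* (d :* i))) :* (q :* q))
             refl δ (H₂ N) (H₂ b) (ι t) π (inv b)) ⟩
      π * (δ * δ * (H₂ N - H₂ b)) ∎
      where
      x = δ * inv b
      vn = term n b b+n≡N (v<p n ℕ.≤-refl)

  2M<p : M ℕ.+ M < p
  2M<p = ℕ.≤-reflexive (≡.sym p≡1+2M)

  M<p : M < p
  M<p = ℕ.≤-<-trans (ℕ.m≤m+n M M) 2M<p

  inv-even : ∀ i → suc i ℕ.+ suc i < p → inv (2 ℕ.* i ℕ.+ 1) ≈ half * inv i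
  inv-even i 2i<p = inverse-unique {ι (suc (2 ℕ.* i ℕ.+ 1))}
    (inv-correct (2 ℕ.* i ℕ.+ 1) (≡.subst (_< p) (double i) 2i<p)) (begin
    ι (suc (2 ℕ.* i ℕ.+ 1)) * (half * inv i)  ≡⟨ ≡.cong (λ n → ι n * (half * inv i)) (double′ i) ⟩
    ι (2 ℕ.* suc i) * (half * inv i)          ≈⟨ *-congʳ (ι-* 2 (suc i)) ⟩
    ι 2 * ι (suc i) * (half * inv i)          ≈⟨ solve 4 (λ a b c d → a :* b :* (c :* d) := a :* c :* (b :* d)) refl _ _ _ _ ⟩
    ι 2 * half * (ι (suc i) * inv i)          ≈⟨ *-cong half-correct (inv-correct i (ℕ.≤-<-trans (ℕ.m≤m+n (suc i) (suc i)) 2i<p)) ⟩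
    1# * 1#                                   ≈⟨ *-identityˡ 1# ⟩
    1#                                        ∎)
    where
    double : ∀ i → suc i ℕ.+ suc i ≡ suc (2 ℕ.* i ℕ.+ 1)
    double = solve-∀
    double′ : ∀ i → suc (2 ℕ.* i ℕ.+ 1) ≡ 2 ℕ.* suc i
    double′ = solve-∀

  inv-even-below : ∀ n i → n ℕ.+ n < p → i < n → inv (2 ℕ.* i ℕ.+ 1) ≈ half * inv i
  inv-even-below n i 2n<p i<n = inv-even i (ℕ.≤-<-trans (ℕ.+-mono-≤ i<n i<n) 2n<p)

  ∑-even : ∀ n → n ℕ.+ n < p → ∑ n (λ i → inv (2 ℕ.* i ℕ.+ 1)) ≈ half * H n
  ∑-even n 2n<p = trans (∑-cong n (λ i i<n → inv-even-below n i 2n<p i<n)) (*-distrib-∑ n half inv)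

  ∑-even² : ∀ n → n ℕ.+ n < p → ∑ n (λ i → inv (2 ℕ.* i ℕ.+ 1) * inv (2 ℕ.* i ℕ.+ 1)) ≈ half * half * H₂ n
  ∑-even² n 2n<p = trans
    (∑-cong n (λ i i<n → trans (*-cong (inv-even-below n i 2n<p i<n) (inv-even-below n i 2n<p i<n))
      (solve 2 (λ h v → (h :* v) :* (h :* v) := h :* h :* (v :* v)) refl half (inv i))))
    (*-distrib-∑ n (half * half) _)

  private
    1*+0 : ∀ i → 1 ℕ.* i ℕ.+ 0 ≡ i
    1*+0 = solve-∀

    p-1 : ∀ M → 1 ℕ.* (M ℕ.+ M) ℕ.+ 1 ≡ suc (M ℕ.+ M)
    p-1 = solve-∀

    -- With d = t = 1 the class is all of 1, ..., p-1, and the matching sends j to p - j.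
    module Reflect = ResidueClass 1 1 (M ℕ.+ M) 0 1# (trans (*-identityʳ (ι 1)) (+-identityʳ 1#))
      (≡.trans (p-1 M) (≡.sym (≡.trans (ℕ.*-identityˡ p) p≡1+2M))) 2M<p

    bound : ∀ a b → b ℕ.+ a ≡ M ℕ.+ M → ∀ i → i < a → suc (1 ℕ.* i ℕ.+ 0) < p
    bound a b b+a≡2M i i<a = ≡.subst (λ n → suc n < p) (≡.sym (1*+0 i))
      (ℕ.≤-<-trans (ℕ.≤-trans i<a (ℕ.≤-trans (ℕ.m≤n+m a b) (ℕ.≤-reflexive b+a≡2M))) 2M<p)

    reflect : ∀ a b → b ℕ.+ a ≡ M ℕ.+ M → H a ≈ - (1# * (H (M ℕ.+ M) - H b)) - ι 1 * π * (1# * 1# * (H₂ (M ℕ.+ M) - H₂ b))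
    reflect a b b+a≡2M = trans (∑-cong a (λ i _ → reflexive (≡.cong inv (≡.sym (1*+0 i)))))
      (Reflect.∑-class a b b+a≡2M (bound a b b+a≡2M))

    reflect² : ∀ a b → b ℕ.+ a ≡ M ℕ.+ M → π * H₂ a ≈ π * (1# * 1# * (H₂ (M ℕ.+ M) - H₂ b))
    reflect² a b b+a≡2M = trans (*-congˡ (∑-cong a (λ i _ → reflexive (≡.cong (λ n → inv n * inv n) (≡.sym (1*+0 i))))))
      (Reflect.∑-class² a b b+a≡2M (bound a b b+a≡2M))

  odd-bound : ∀ n b → b ℕ.+ n ≡ M → ∀ i → i < n → suc (2 ℕ.* i ℕ.+ 0) < p
  odd-bound n b b+n≡M i i<n = ≡.subst₂ _<_ (lemma i) (≡.sym p≡1+2M) (s≤s (ℕ.+-mono-≤ i<M (ℕ.<⇒≤ i<M)))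
    where
    lemma : ∀ i → suc (i ℕ.+ i) ≡ suc (2 ℕ.* i ℕ.+ 0)
    lemma = solve-∀
    i<M : i < M
    i<M = ℕ.≤-trans i<n (ℕ.≤-trans (ℕ.m≤n+m n b) (ℕ.≤-reflexive b+n≡M))

  private
    2M+1 : ∀ M → 2 ℕ.* M ℕ.+ 1 ≡ suc (M ℕ.+ M)
    2M+1 = solve-∀

  -- The odd numbers below p, through 2 i + 1 = p - 2 (M - i).
  module Odd = ResidueClass 2 1 M 0 half half-correct
    (≡.trans (2M+1 M) (≡.sym (≡.trans (ℕ.*-identityˡ p) p≡1+2M))) M<p

  private
    πH₂2M≈2πH₂M : π * H₂ (M ℕ.+ M) ≈ π * H₂ M + π * H₂ M
    πH₂2M≈2πH₂M = using-eq (- 1#) (reflect² M M ≡.refl)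
      (solve 3 (λ q g y → q :* y :+ :- ℕcon 1 :* (q :* (ℕcon 1 :* ℕcon 1 :* (y :- g)))
        := q :* g :+ q :* g :+ :- ℕcon 1 :* (q :* g)) refl π (H₂ M) (H₂ (M ℕ.+ M)))

  -- `π * H₂ (M + M)` is computed twice. Reflection gives twice `π * H₂ M`. Splitting by parity
  -- gives two quarters of it, one from the even and one from the odd denominators. The difference
  -- is 3/2 of `π * H₂ M`, and 2 and 3 are units.
  πH₂M≈0 : π * H₂ M ≈ 0#
  πH₂M≈0 = using-eq (- X) third-correct (using-eq (third * X * (ι 2 * half + 1#)) half-correct
    (using-eq (third * ι 2) 2X≈2h²X
      (solve 3 (λ x h t →
        x :+ :- x :* ℕcon 1 :+ t :* x :* (ℕcon 2 :* h :+ ℕcon 1) :* ℕcon 1 :+ t :* ℕcon 2 :* (h :* h :* x :+ h :* h :* x)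
        := ℕcon 0 :+ :- x :* (ℕcon 3 :* t) :+ t :* x :* (ℕcon 2 :* h :+ ℕcon 1) :* (ℕcon 2 :* h)
           :+ t :* ℕcon 2 :* (x :+ x))
        refl X half third)))
    where
    X = π * H₂ M
    2X≈2h²X : X + X ≈ half * half * X + half * half * X
    2X≈2h²X = begin
      π * H₂ M + π * H₂ M
        ≈⟨ πH₂2M≈2πH₂M ⟨
      π * H₂ (M ℕ.+ M)
        ≈⟨ *-congˡ (trans (∑-parity 0 M _ z≤n) (+-congʳ (∑-even² M 2M<p))) ⟩
      π * (half * half * H₂ M + ∑ M (λ i → inv (2 ℕ.* i ℕ.+ 0) * inv (2 ℕ.* i ℕ.+ 0)))
        ≈⟨ trans (distribˡ _ _ _) (+-congˡ (Odd.∑-class² M 0 ≡.refl (odd-bound M 0 ≡.refl))) ⟩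
      π * (half * half * H₂ M) + π * (half * half * (H₂ M - 0#))
        ≈⟨ solve 3 (λ q h g → q :* (h :* h :* g) :+ q :* (h :* h :* (g :- ℕcon 0))
             := h :* h :* (q :* g) :+ h :* h :* (q :* g)) refl π half (H₂ M) ⟩
      half * half * X + half * half * X ∎

  πH₂2M≈0 : π * H₂ (M ℕ.+ M) ≈ 0#
  πH₂2M≈0 = trans πH₂2M≈2πH₂M (trans (+-cong πH₂M≈0 πH₂M≈0) (+-identityʳ 0#))

  -- Wolstenholme's congruence. Reflecting the whole range gives H = -H - π H₂, whose last term
  -- already vanishes.
  H2M≈0 : H (M ℕ.+ M) ≈ 0#
  H2M≈0 = using-eq (- x) half-correct (using-eq half (reflect (M ℕ.+ M) 0 ≡.refl) (using-eq (- half) πH₂2M≈0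
    (solve 4 (λ x y q h →
      x :+ :- x :* ℕcon 1 :+ h :* (:- (ℕcon 1 :* (x :- ℕcon 0)) :- (ℕcon 1 :+ ℕcon 0) :* q :* (ℕcon 1 :* ℕcon 1 :* (y :- ℕcon 0)))
        :+ :- h :* ℕcon 0
      := ℕcon 0 :+ :- x :* (ℕcon 2 :* h) :+ h :* x :+ :- h :* (q :* y))
      refl x (H₂ (M ℕ.+ M)) π half)))
    where
    x = H (M ℕ.+ M)

  H₂-reflect : ∀ a b → b ℕ.+ a ≡ M ℕ.+ M → π * H₂ b ≈ - (π * H₂ a)
  H₂-reflect a b b+a≡2M = using-eq 1# (reflect² a b b+a≡2M) (using-eq 1# πH₂2M≈0
    (solve 4 (λ q x y z →
      q :* y :+ ℕcon 1 :* (q :* (ℕcon 1 :* ℕcon 1 :* (z :- y))) :+ ℕcon 1 :* ℕcon 0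
      := :- (q :* x) :+ ℕcon 1 :* (q :* x) :+ ℕcon 1 :* (q :* z)) refl π (H₂ a) (H₂ b) (H₂ (M ℕ.+ M))))

  -- The denominators p - j with 0 < j ≤ a complete `H b` to H at p-1, which is zero; expanding
  -- their inverses to first order gives the right-hand side.
  H-reflect : ∀ a b → b ℕ.+ a ≡ M ℕ.+ M → H b ≈ H a + π * H₂ a
  H-reflect a b b+a≡2M = using-eq (- 1#) (reflect a b b+a≡2M) (using-eq 1# H2M≈0 (using-eq 1# πH₂2M≈0
    (using-eq (- 1#) (H₂-reflect a b b+a≡2M)
    (solve 7 (λ q h h′ hN g g′ gN →
      h′ :+ :- ℕcon 1 :* (:- (ℕcon 1 :* (hN :- h′)) :- (ℕcon 1 :+ ℕcon 0) :* q :* (ℕcon 1 :* ℕcon 1 :* (gN :- g′)))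
        :+ ℕcon 1 :* ℕcon 0 :+ ℕcon 1 :* ℕcon 0 :+ :- ℕcon 1 :* :- (q :* g)
      := h :+ q :* g :+ :- ℕcon 1 :* h :+ ℕcon 1 :* hN :+ ℕcon 1 :* (q :* gN) :+ :- ℕcon 1 :* (q :* g′))
      refl π (H a) (H b) (H (M ℕ.+ M)) (H₂ a) (H₂ b) (H₂ (M ℕ.+ M))))))

  sgn-sum-even : ∀ a b → b ℕ.+ a ≡ M ℕ.+ M → sgn b ≈ sgn a
  sgn-sum-even a b b+a≡2M = using-eq (sgn a) (trans (trans (sym (^-+ (- 1#) b a)) (reflexive (≡.cong sgn b+a≡2M))) (sgn-even M))
    (using-eq (- sgn b) (trans (sym (^-+ (- 1#) a a)) (sgn-even a))
    (solve 2 (λ a b → b :+ a :* ℕcon 1 :+ :- b :* ℕcon 1 := a :+ a :* (b :* a) :+ :- b :* (a :* a)) refl (sgn a) (sgn b)))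

  -- With p = d a + i we have -i/d = a - p/d, and S is affine along a + p t.
  S-at-fraction : ∀ d a i δ x → ι d * δ ≈ 1# → p ≡ d ℕ.* a ℕ.+ i → a < p → ι d * x ≈ - ι i →
    S x ≈ sgn a * (ι 2 * (H a + π * δ * H₂ a))
  S-at-fraction d a i δ x dδ≈1 p≡da+i a<p dx≈-i = begin
    S x
      ≈⟨ S-cong x≈ ⟩
    S (ι a + π * - δ)
      ≈⟨ S-affine π π²≈0 (ι a) (- δ) ⟩
    S (ι a) + - δ * (S (ι a) - S (ι a - π))
      ≈⟨ +-cong (S-ι a a<p) (*-congˡ (+-cong (S-ι a a<p) (-‿cong S[a-π]))) ⟩
    sgn a * (H a + H a) + - δ * (sgn a * (H a + H a) - sgn a * (H b + H b))
      ≈⟨ using-eq (ι 2 * δ * sgn a) (H-reflect a b b+a≡2M)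
         (solve 6 (λ s h h′ d q g →
           s :* (h :+ h) :+ :- d :* (s :* (h :+ h) :- s :* (h′ :+ h′)) :+ ℕcon 2 :* d :* s :* (h :+ q :* g)
           := s :* (ℕcon 2 :* (h :+ q :* d :* g)) :+ ℕcon 2 :* d :* s :* h′)
           refl (sgn a) (H a) (H b) δ π (H₂ a)) ⟩
    sgn a * (ι 2 * (H a + π * δ * H₂ a)) ∎
    where
    b = M ℕ.+ M ℕ.∸ a
    b+a≡2M : b ℕ.+ a ≡ M ℕ.+ M
    b+a≡2M = ℕ.m∸n+n≡m (ℕ.≤-pred (≡.subst (a <_) p≡1+2M a<p))
    b<p : b < p
    b<p = ℕ.≤-<-trans (ℕ.≤-trans (ℕ.m≤m+n b a) (ℕ.≤-reflexive b+a≡2M)) 2M<p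
    π≈ : π ≈ 1# + (ι b + ι a)
    π≈ = trans (reflexive (≡.cong ι (≡.trans p≡1+2M (≡.cong suc (≡.sym b+a≡2M))))) (+-congˡ (ι-+ b a))
    S[a-π] : S (ι a - π) ≈ sgn a * (H b + H b)
    S[a-π] = begin
      S (ι a - π)          ≈⟨ S-cong (using-eq (- 1#) π≈ (solve 3 (λ a b q →
                                a :- q :+ :- ℕcon 1 :* (ℕcon 1 :+ (b :+ a)) := :- ℕcon 1 :- b :+ :- ℕcon 1 :* q)
                                refl (ι a) (ι b) π)) ⟩
      S (- 1# - ι b)       ≈⟨ S-reflect (ι b) ⟩
      S (ι b)              ≈⟨ S-ι b b<p ⟩
      sgn b * (H b + H b)  ≈⟨ *-congʳ (sgn-sum-even a b b+a≡2M) ⟩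
      sgn a * (H b + H b)  ∎
    π≈da+i : π ≈ ι d * ι a + ι i
    π≈da+i = trans (reflexive (≡.cong ι p≡da+i)) (trans (ι-+ (d ℕ.* a) i) (+-congʳ (ι-* d a)))
    x≈ : x ≈ ι a + π * - δ
    x≈ = using-eq (ι a - x) dδ≈1 (using-eq δ dx≈-i (using-eq δ π≈da+i
      (solve 6 (λ x d e a i q →
        x :+ (a :- x) :* ℕcon 1 :+ e :* :- i :+ e :* (d :* a :+ i)
        := a :+ q :* :- e :+ (a :- x) :* (d :* e) :+ e :* (d :* x) :+ e :* q)
        refl x (ι d) δ (ι a) (ι i) π)))

  -- Up to `m` there are `a` even denominators, giving half of `H a`, and `e + a` odd ones, which
  -- `Odd` carries to the segment from b+1 to M. It is used with m = M, b = a and with m = ⌊p/3⌋, b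
  -- = m.
  module Halving (m a e b : ℕ) (m≡e+2a : m ≡ e ℕ.+ (a ℕ.+ a)) (e≤1 : e ℕ.≤ 1) (b+e+a≡M : b ℕ.+ (e ℕ.+ a) ≡ M) where

    private
      2a<p : a ℕ.+ a < p
      2a<p = ℕ.≤-<-trans (ℕ.+-mono-≤ a≤M a≤M) 2M<p
        where
        a≤M : a ℕ.≤ M
        a≤M = ℕ.≤-trans (ℕ.m≤n+m a e) (ℕ.≤-trans (ℕ.m≤n+m (e ℕ.+ a) b) (ℕ.≤-reflexive b+e+a≡M))

    H-halving : H m ≈ half * H a + (- (half * (H M - H b)) - ι 1 * π * (half * half * (H₂ M - H₂ b)))
    H-halving = begin
      H m
        ≡⟨ ≡.cong H m≡e+2a ⟩
      H (e ℕ.+ (a ℕ.+ a))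
        ≈⟨ ∑-parity e a inv e≤1 ⟩
      ∑ a (λ i → inv (2 ℕ.* i ℕ.+ 1)) + ∑ (e ℕ.+ a) (λ i → inv (2 ℕ.* i ℕ.+ 0))
        ≈⟨ +-cong (∑-even a 2a<p) (Odd.∑-class (e ℕ.+ a) b b+e+a≡M (odd-bound (e ℕ.+ a) b b+e+a≡M)) ⟩
      half * H a + (- (half * (H M - H b)) - ι 1 * π * (half * half * (H₂ M - H₂ b))) ∎

    H₂-halving : π * H₂ m ≈ half * half * (π * H₂ a) + half * half * (π * H₂ M - π * H₂ b)
    H₂-halving = begin
      π * H₂ m
        ≡⟨ ≡.cong (λ m → π * H₂ m) m≡e+2a ⟩
      π * H₂ (e ℕ.+ (a ℕ.+ a))
        ≈⟨ trans (*-congˡ (∑-parity e a _ e≤1)) (distribˡ _ _ _) ⟩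
      π * ∑ a (λ i → inv (2 ℕ.* i ℕ.+ 1) * inv (2 ℕ.* i ℕ.+ 1))
        + π * ∑ (e ℕ.+ a) (λ i → inv (2 ℕ.* i ℕ.+ 0) * inv (2 ℕ.* i ℕ.+ 0))
        ≈⟨ +-cong (*-congˡ (∑-even² a 2a<p)) (Odd.∑-class² (e ℕ.+ a) b b+e+a≡M (odd-bound (e ℕ.+ a) b b+e+a≡M)) ⟩
      π * (half * half * H₂ a) + π * (half * half * (H₂ M - H₂ b))
        ≈⟨ solve 5 (λ q h x y z → q :* (h :* h :* x) :+ q :* (h :* h :* (y :- z))
             := h :* h :* (q :* x) :+ h :* h :* (q :* y :- q :* z)) refl π half (H₂ a) (H₂ M) (H₂ b) ⟩
      half * half * (π * H₂ a) + half * half * (π * H₂ M - π * H₂ b) ∎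

  private
    quarter-count : ∀ a e → a ℕ.+ (e ℕ.+ a) ≡ e ℕ.+ (a ℕ.+ a)
    quarter-count = solve-∀

  -- Here b = a, so both halves of H_M contribute `H a`: H_M = H_a - H_M/2 + (π/4) H₂(a), up to the
  -- vanishing `π * H₂ M`.
  harmonic-quarter : ∀ a e → M ≡ e ℕ.+ (a ℕ.+ a) → e ℕ.≤ 1 →
    ι 2 * (H a + π * (half * half) * H₂ a) ≈ ι 3 * H M
  harmonic-quarter a e M≡e+2a e≤1 = using-eq (- ι 2) H-halving (using-eq (ι 2 * half * half) πH₂M≈0
    (using-eq (H M - ι 2 * H a) half-correct
    (solve 6 (λ q h x y g G →
      ℕcon 2 :* (x :+ q :* (h :* h) :* g)
        :+ :- ℕcon 2 :* (h :* x :+ (:- (h :* (y :- x)) :- (ℕcon 1 :+ ℕcon 0) :* q :* (h :* h :* (G :- g))))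
        :+ ℕcon 2 :* h :* h :* ℕcon 0 :+ (y :- ℕcon 2 :* x) :* ℕcon 1
      := ℕcon 3 :* y :+ :- ℕcon 2 :* y :+ ℕcon 2 :* h :* h :* (q :* G) :+ (y :- ℕcon 2 :* x) :* (ℕcon 2 :* h))
      refl π half (H a) (H M) (H₂ a) (H₂ M))))
    where
    open Halving M a e a M≡e+2a e≤1 (≡.trans (quarter-count a e) (≡.sym M≡e+2a))

  -- Here b = m. The two halving formulas become H_a = H_m + H_M - (π/2) H₂(m) and π H₂(a) = 5 π
  -- H₂(m), and -1/2 + 5/6 = 1/3.
  harmonic-sixth : ∀ a e m → m ≡ e ℕ.+ (a ℕ.+ a) → e ℕ.≤ 1 → m ℕ.+ (e ℕ.+ a) ≡ M →
    H a + π * (half * third) * H₂ a ≈ H m + π * third * H₂ m + H M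
  harmonic-sixth a e m m≡e+2a e≤1 m+e+a≡M = using-eq (- ι 2) H-halving (using-eq (- ι 2 * third) H₂-halving
    (using-eq (ι 2 * half * half - ι 2 * third * half * half) πH₂M≈0
    (using-eq (H M - H a - H m - half * third * (π * H₂ a) + π * H₂ m * (third * half - half - third)) half-correct
    (using-eq (π * H₂ m * half) third-correct
    (solve 9 (λ q h t x y z g G k →
      let c = y :- x :- z :- h :* t :* (q :* g) :+ q :* k :* (t :* h :- h :- t) in
      x :+ q :* (h :* t) :* g
        :+ :- ℕcon 2 :* (h :* x :+ (:- (h :* (y :- z)) :- (ℕcon 1 :+ ℕcon 0) :* q :* (h :* h :* (G :- k))))
        :+ :- ℕcon 2 :* t :* (h :* h :* (q :* g) :+ h :* h :* (q :* G :- q :* k))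
        :+ (ℕcon 2 :* h :* h :- ℕcon 2 :* t :* h :* h) :* ℕcon 0 :+ c :* ℕcon 1 :+ q :* k :* h :* ℕcon 1
      := z :+ q :* t :* k :+ y :+ :- ℕcon 2 :* z :+ :- ℕcon 2 :* t :* (q :* k)
        :+ (ℕcon 2 :* h :* h :- ℕcon 2 :* t :* h :* h) :* (q :* G) :+ c :* (ℕcon 2 :* h) :+ q :* k :* h :* (ℕcon 3 :* t))
      refl π half third (H a) (H M) (H m) (H₂ a) (H₂ M) (H₂ m))))))
    where
    open Halving m a e m m≡e+2a e≤1 m+e+a≡M

-- Exact product formulas for 2^(p-1) and 3^(p-1) from factorials split into residue classes.

∏ℕ-cong : ∀ n {f g : ℕ → ℕ} → (∀ i → f i ≡ g i) → ∏ℕ n f ≡ ∏ℕ n g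
∏ℕ-cong zero    f≡g = ≡.refl
∏ℕ-cong (suc n) f≡g = ≡.cong₂ ℕ._*_ (∏ℕ-cong n f≡g) (f≡g n)

∏ℕ-scale : ∀ n c f → ∏ℕ n (λ i → c ℕ.* f i) ≡ c ℕ.^ n ℕ.* ∏ℕ n f
∏ℕ-scale zero    c f = ≡.refl
∏ℕ-scale (suc n) c f = ≡.trans (≡.cong (ℕ._* (c ℕ.* f n)) (∏ℕ-scale n c f))
  (lemma (c ℕ.^ n) (∏ℕ n f) c (f n))
  where
  lemma : ∀ x y c z → x ℕ.* y ℕ.* (c ℕ.* z) ≡ c ℕ.* x ℕ.* (y ℕ.* z)
  lemma = solve-∀

!-rising : ∀ n k → n ! ℕ.* ∏ℕ k (λ i → suc (n ℕ.+ i)) ≡ (n ℕ.+ k) !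
!-rising n zero    = ≡.trans (ℕ.*-identityʳ (n !)) (≡.cong _! (≡.sym (ℕ.+-identityʳ n)))
!-rising n (suc k) = begin
  n ! ℕ.* (∏ℕ k (λ i → suc (n ℕ.+ i)) ℕ.* suc (n ℕ.+ k))  ≡⟨ ℕ.*-assoc (n !) _ _ ⟨
  n ! ℕ.* ∏ℕ k (λ i → suc (n ℕ.+ i)) ℕ.* suc (n ℕ.+ k)    ≡⟨ ≡.cong (ℕ._* suc (n ℕ.+ k)) (!-rising n k) ⟩
  (n ℕ.+ k) ! ℕ.* suc (n ℕ.+ k)                           ≡⟨ ℕ.*-comm ((n ℕ.+ k) !) _ ⟩
  suc (n ℕ.+ k) !                                         ≡⟨ ≡.cong _! (ℕ.+-suc n k) ⟨
  (n ℕ.+ suc k) !                                         ∎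
  where open ≡.≡-Reasoning

!-parity : ∀ n → 2 ℕ.^ n ℕ.* n ! ℕ.* ∏ℕ n (λ i → suc (2 ℕ.* i ℕ.+ 0)) ≡ (n ℕ.+ n) !
!-parity zero    = ≡.refl
!-parity (suc n) = begin
  2 ℕ.* x ℕ.* (suc n ℕ.* y) ℕ.* (z ℕ.* suc (2 ℕ.* n ℕ.+ 0))   ≡⟨ lemma x y z n ⟩
  suc (suc (n ℕ.+ n)) ℕ.* (suc (n ℕ.+ n) ℕ.* (x ℕ.* y ℕ.* z)) ≡⟨ ≡.cong (λ w → suc (suc (n ℕ.+ n)) ℕ.* (suc (n ℕ.+ n) ℕ.* w)) (!-parity n) ⟩
  suc (suc (n ℕ.+ n)) !                                       ≡⟨ ≡.cong (λ k → suc k !) (≡.sym (ℕ.+-suc n n)) ⟩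
  (suc n ℕ.+ suc n) !                                         ∎
  where
  open ≡.≡-Reasoning
  x = 2 ℕ.^ n
  y = n !
  z = ∏ℕ n (λ i → suc (2 ℕ.* i ℕ.+ 0))
  lemma : ∀ x y z n → 2 ℕ.* x ℕ.* (suc n ℕ.* y) ℕ.* (z ℕ.* suc (2 ℕ.* n ℕ.+ 0))
    ≡ suc (suc (n ℕ.+ n)) ℕ.* (suc (n ℕ.+ n) ℕ.* (x ℕ.* y ℕ.* z))
  lemma = solve-∀

!-mod3 : ∀ n → 3 ℕ.^ n ℕ.* n ! ℕ.* (∏ℕ n (λ i → suc (3 ℕ.* i ℕ.+ 0)) ℕ.* ∏ℕ n (λ i → suc (3 ℕ.* i ℕ.+ 1)))
  ≡ (n ℕ.+ (n ℕ.+ n)) !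
!-mod3 zero    = ≡.refl
!-mod3 (suc n) = begin
  3 ℕ.* x ℕ.* (suc n ℕ.* y) ℕ.* (z ℕ.* suc (3 ℕ.* n ℕ.+ 0) ℕ.* (w ℕ.* suc (3 ℕ.* n ℕ.+ 1)))
    ≡⟨ lemma x y z w n ⟩
  suc (suc (suc N)) ℕ.* (suc (suc N) ℕ.* (suc N ℕ.* (x ℕ.* y ℕ.* (z ℕ.* w))))
    ≡⟨ ≡.cong (λ v → suc (suc (suc N)) ℕ.* (suc (suc N) ℕ.* (suc N ℕ.* v))) (!-mod3 n) ⟩
  suc (suc (suc N)) !
    ≡⟨ ≡.cong _! (count n) ⟩
  (suc n ℕ.+ (suc n ℕ.+ suc n)) ! ∎
  where
  open ≡.≡-Reasoning
  N = n ℕ.+ (n ℕ.+ n)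
  x = 3 ℕ.^ n
  y = n !
  z = ∏ℕ n (λ i → suc (3 ℕ.* i ℕ.+ 0))
  w = ∏ℕ n (λ i → suc (3 ℕ.* i ℕ.+ 1))
  lemma : ∀ x y z w n → let N = n ℕ.+ (n ℕ.+ n) in
    3 ℕ.* x ℕ.* (suc n ℕ.* y) ℕ.* (z ℕ.* suc (3 ℕ.* n ℕ.+ 0) ℕ.* (w ℕ.* suc (3 ℕ.* n ℕ.+ 1)))
    ≡ suc (suc (suc N)) ℕ.* (suc (suc N) ℕ.* (suc N ℕ.* (x ℕ.* y ℕ.* (z ℕ.* w))))
  lemma = solve-∀
  count : ∀ n → suc (suc (suc (n ℕ.+ (n ℕ.+ n)))) ≡ suc n ℕ.+ (suc n ℕ.+ suc n)
  count = solve-∀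

-- The factorial of p-1 for p = 3 n + 1 + e. For e = 1 the class of 1 modulo 3 has one more member,
-- 3 n + 1.
!-classes3 : ∀ n e f → e ℕ.+ f ≡ 1 →
  3 ℕ.^ n ℕ.* n ! ℕ.* (∏ℕ n (λ i → suc (3 ℕ.* i ℕ.+ e)) ℕ.* ∏ℕ (e ℕ.+ n) (λ i → suc (3 ℕ.* i ℕ.+ f)))
    ≡ (n ℕ.+ (e ℕ.+ n) ℕ.+ n) !
!-classes3 n 0 1 ≡.refl = ≡.trans (!-mod3 n) (≡.cong _! (≡.sym (ℕ.+-assoc n n n)))
!-classes3 n 1 0 ≡.refl = begin
  x ℕ.* y ℕ.* (w ℕ.* (z ℕ.* suc (3 ℕ.* n ℕ.+ 0)))        ≡⟨ lemma x y z w n ⟩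
  suc (n ℕ.+ (n ℕ.+ n)) ℕ.* (x ℕ.* y ℕ.* (z ℕ.* w))      ≡⟨ ≡.cong (suc (n ℕ.+ (n ℕ.+ n)) ℕ.*_) (!-mod3 n) ⟩
  suc (n ℕ.+ (n ℕ.+ n)) !                                ≡⟨ ≡.cong _! (count n) ⟩
  (n ℕ.+ (1 ℕ.+ n) ℕ.+ n) !                              ∎
  where
  open ≡.≡-Reasoning
  x = 3 ℕ.^ n
  y = n !
  z = ∏ℕ n (λ i → suc (3 ℕ.* i ℕ.+ 0))
  w = ∏ℕ n (λ i → suc (3 ℕ.* i ℕ.+ 1))
  lemma : ∀ x y z w n → x ℕ.* y ℕ.* (w ℕ.* (z ℕ.* suc (3 ℕ.* n ℕ.+ 0))) ≡ suc (n ℕ.+ (n ℕ.+ n)) ℕ.* (x ℕ.* y ℕ.* (z ℕ.* w))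
  lemma = solve-∀
  count : ∀ n → suc (n ℕ.+ (n ℕ.+ n)) ≡ n ℕ.+ (1 ℕ.+ n) ℕ.+ n
  count = solve-∀

-- With p = 2 M + 1, adding p makes each odd number even, and the halves run through M+1, ..., 2 M.
-- Their product (2M)!/M! is again 2^M times the product of the odd numbers. Divided by that
-- product, the identity says that 2^(p-1) is the product of the factors 1 + p/(2i+1).
shifted-odd-product : ∀ M →
  ∏ℕ M (λ i → suc (2 ℕ.* i ℕ.+ 0) ℕ.+ 1 ℕ.* suc (M ℕ.+ M)) ≡ 2 ℕ.^ (M ℕ.+ M) ℕ.* ∏ℕ M (λ i → suc (2 ℕ.* i ℕ.+ 0))
shifted-odd-product M = begin
  ∏ℕ M (λ i → suc (2 ℕ.* i ℕ.+ 0) ℕ.+ 1 ℕ.* suc (M ℕ.+ M))   ≡⟨ ∏ℕ-cong M (shift M) ⟩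
  ∏ℕ M (λ i → 2 ℕ.* suc (M ℕ.+ i))                           ≡⟨ ∏ℕ-scale M 2 _ ⟩
  2 ℕ.^ M ℕ.* ∏ℕ M (λ i → suc (M ℕ.+ i))                     ≡⟨ ≡.cong (2 ℕ.^ M ℕ.*_) (ℕ.*-cancelˡ-≡ _ _ (M !) {{M ℕ.!≢0}} eq) ⟩
  2 ℕ.^ M ℕ.* (2 ℕ.^ M ℕ.* P)                                ≡⟨ ℕ.*-assoc (2 ℕ.^ M) _ _ ⟨
  2 ℕ.^ M ℕ.* 2 ℕ.^ M ℕ.* P                                  ≡⟨ ≡.cong (ℕ._* P) (≡.sym (ℕ.^-distribˡ-+-* 2 M M)) ⟩
  2 ℕ.^ (M ℕ.+ M) ℕ.* P                                      ∎
  where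
  open ≡.≡-Reasoning
  P = ∏ℕ M (λ i → suc (2 ℕ.* i ℕ.+ 0))
  shift : ∀ M i → suc (2 ℕ.* i ℕ.+ 0) ℕ.+ 1 ℕ.* suc (M ℕ.+ M) ≡ 2 ℕ.* suc (M ℕ.+ i)
  shift = solve-∀
  swap : ∀ x y z → x ℕ.* (y ℕ.* z) ≡ y ℕ.* x ℕ.* z
  swap = solve-∀
  eq : M ! ℕ.* ∏ℕ M (λ i → suc (M ℕ.+ i)) ≡ M ! ℕ.* (2 ℕ.^ M ℕ.* P)
  eq = ≡.trans (!-rising M M) (≡.trans (≡.sym (!-parity M)) (≡.sym (swap (M !) (2 ℕ.^ M) P)))

-- The class of p itself is shifted by 2 p and the other nonzero class by p, so that every factor
-- becomes divisible by 3. The thirds run through m+1, ..., p-1, whose product is (p-1)!/m!.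
shifted-mod3-product : ∀ m e f → e ℕ.+ f ≡ 1 → let p = 3 ℕ.* m ℕ.+ suc e in
  ∏ℕ m (λ i → suc (3 ℕ.* i ℕ.+ e) ℕ.+ 2 ℕ.* p) ℕ.* ∏ℕ (e ℕ.+ m) (λ i → suc (3 ℕ.* i ℕ.+ f) ℕ.+ 1 ℕ.* p)
    ≡ 3 ℕ.^ (m ℕ.+ (e ℕ.+ m) ℕ.+ m) ℕ.* (∏ℕ m (λ i → suc (3 ℕ.* i ℕ.+ e)) ℕ.* ∏ℕ (e ℕ.+ m) (λ i → suc (3 ℕ.* i ℕ.+ f)))
shifted-mod3-product m e f e+f≡1 = begin
  ∏ℕ m (λ i → suc (3 ℕ.* i ℕ.+ e) ℕ.+ 2 ℕ.* p) ℕ.* ∏ℕ n (λ i → suc (3 ℕ.* i ℕ.+ f) ℕ.+ 1 ℕ.* p)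
    ≡⟨ ≡.cong₂ ℕ._*_ (≡.trans (∏ℕ-cong m (shiftₑ m e)) (∏ℕ-scale m 3 _)) (≡.trans (∏ℕ-cong n shift-f) (∏ℕ-scale n 3 _)) ⟩
  3 ℕ.^ m ℕ.* A ℕ.* (3 ℕ.^ n ℕ.* B)
    ≡⟨ interchange (3 ℕ.^ m) A (3 ℕ.^ n) B ⟩
  3 ℕ.^ m ℕ.* 3 ℕ.^ n ℕ.* (B ℕ.* A)
    ≡⟨ ≡.cong (3 ℕ.^ m ℕ.* 3 ℕ.^ n ℕ.*_) (ℕ.*-cancelˡ-≡ _ _ (m !) {{m ℕ.!≢0}} eq) ⟩
  3 ℕ.^ m ℕ.* 3 ℕ.^ n ℕ.* (3 ℕ.^ m ℕ.* P)
    ≡⟨ ℕ.*-assoc (3 ℕ.^ m ℕ.* 3 ℕ.^ n) _ _ ⟨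
  3 ℕ.^ m ℕ.* 3 ℕ.^ n ℕ.* 3 ℕ.^ m ℕ.* P
    ≡⟨ ≡.cong (ℕ._* P) (≡.trans (≡.cong (ℕ._* 3 ℕ.^ m) (≡.sym (ℕ.^-distribˡ-+-* 3 m n))) (≡.sym (ℕ.^-distribˡ-+-* 3 (m ℕ.+ n) m))) ⟩
  3 ℕ.^ (m ℕ.+ n ℕ.+ m) ℕ.* P ∎
  where
  open ≡.≡-Reasoning
  n = e ℕ.+ m
  p = 3 ℕ.* m ℕ.+ suc e
  A = ∏ℕ m (λ i → suc (m ℕ.+ n ℕ.+ i))
  B = ∏ℕ n (λ i → suc (m ℕ.+ i))
  P = ∏ℕ m (λ i → suc (3 ℕ.* i ℕ.+ e)) ℕ.* ∏ℕ n (λ i → suc (3 ℕ.* i ℕ.+ f))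
  shiftₑ : ∀ m e i → suc (3 ℕ.* i ℕ.+ e) ℕ.+ 2 ℕ.* (3 ℕ.* m ℕ.+ suc e) ≡ 3 ℕ.* suc (m ℕ.+ (e ℕ.+ m) ℕ.+ i)
  shiftₑ = solve-∀
  shift-f : ∀ i → suc (3 ℕ.* i ℕ.+ f) ℕ.+ 1 ℕ.* p ≡ 3 ℕ.* suc (m ℕ.+ i)
  shift-f i = ≡.trans (lemma m e f i) (≡.trans (≡.cong (λ s → s ℕ.+ (2 ℕ.+ 3 ℕ.* (m ℕ.+ i))) e+f≡1) (lemma′ m i))
    where
    lemma : ∀ m e f i → suc (3 ℕ.* i ℕ.+ f) ℕ.+ 1 ℕ.* (3 ℕ.* m ℕ.+ suc e) ≡ (e ℕ.+ f) ℕ.+ (2 ℕ.+ 3 ℕ.* (m ℕ.+ i))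
    lemma = solve-∀
    lemma′ : ∀ m i → 1 ℕ.+ (2 ℕ.+ 3 ℕ.* (m ℕ.+ i)) ≡ 3 ℕ.* suc (m ℕ.+ i)
    lemma′ = solve-∀
  interchange : ∀ x a y b → x ℕ.* a ℕ.* (y ℕ.* b) ≡ x ℕ.* y ℕ.* (b ℕ.* a)
  interchange = solve-∀
  swap : ∀ x y z → x ℕ.* (y ℕ.* z) ≡ y ℕ.* x ℕ.* z
  swap = solve-∀
  eq : m ! ℕ.* (B ℕ.* A) ≡ m ! ℕ.* (3 ℕ.^ m ℕ.* P)
  eq = begin
    m ! ℕ.* (B ℕ.* A)              ≡⟨ ℕ.*-assoc (m !) B A ⟨
    m ! ℕ.* B ℕ.* A                ≡⟨ ≡.cong (ℕ._* A) (!-rising m n) ⟩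
    (m ℕ.+ n) ! ℕ.* A              ≡⟨ !-rising (m ℕ.+ n) m ⟩
    (m ℕ.+ n ℕ.+ m) !              ≡⟨ !-classes3 m e f e+f≡1 ⟨
    3 ℕ.^ m ℕ.* m ! ℕ.* P          ≡⟨ swap (m !) (3 ℕ.^ m) P ⟨
    m ! ℕ.* (3 ℕ.^ m ℕ.* P)        ∎

-- Fermat quotients of 2 and 3 through a truncated logarithm.

module FermatQuotients {c ℓ} (B : CommutativeRing c ℓ) (p M : ℕ) (p≡1+2M : p ≡ suc (M ℕ.+ M)) (3<p : 3 < p)
  (inv : ℕ → CommutativeRing.Carrier B) (inv-correct : RingLemmas.InvertsBelow B p inv) where

  open RingLemmas B
  open Quotient B (ι p * ι p)
  private
    module R = RingLemmas quotient

  inv-correctₘ : RingLemmas.InvertsBelow quotient p inv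
  inv-correctₘ j j<p = ≈⇒≈ₘ (inv-correct j j<p)

  open HarmonicSums quotient p inv inv-correctₘ public using (H; H₂; F; S)
  open HarmonicCongruences quotient p M p≡1+2M 3<p inv inv-correctₘ modulus≈0 public

  -- 1 + π (x ⋆ y) = (1 + π x) (1 + π y), and L x is log (1 + π x) / π up to
  -- multiples of π², so L turns ⋆ into +.
  infixl 6 _⋆_
  _⋆_ : Carrier → Carrier → Carrier
  x ⋆ y = x + y + π * x * y

  L : Carrier → Carrier
  L x = x - half * π * (x * x)

  ⋆-product : ∀ n → (ℕ → Carrier) → Carrier
  ⋆-product = fold _⋆_ 0#

  1+π⋆ : ∀ x y → 1# + π * (x ⋆ y) ≈ (1# + π * x) * (1# + π * y)
  1+π⋆ x y = solve 3 (λ q x y → ℕcon 1 :+ q :* (x :+ y :+ q :* x :* y) := (ℕcon 1 :+ q :* x) :* (ℕcon 1 :+ q :* y)) refl π x y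

  L-⋆ : ∀ x y → L (x ⋆ y) ≈ₘ L x + L y
  L-⋆ x y = R.using-eq (- (π * x * y)) half-correct (R.using-eq (- half * (ι 2 * (x + y) * x * y + π * (x * y * x * y))) modulus≈0
    (R.solve 4 (λ q h x y →
      (x R.:+ y R.:+ q R.:* x R.:* y) R.:- h R.:* q R.:* ((x R.:+ y R.:+ q R.:* x R.:* y) R.:* (x R.:+ y R.:+ q R.:* x R.:* y))
        R.:+ R.:- (q R.:* x R.:* y) R.:* R.ℕcon 1
        R.:+ R.:- h R.:* (R.ℕcon 2 R.:* (x R.:+ y) R.:* x R.:* y R.:+ q R.:* (x R.:* y R.:* x R.:* y)) R.:* R.ℕcon 0
      R.:= (x R.:- h R.:* q R.:* (x R.:* x)) R.:+ (y R.:- h R.:* q R.:* (y R.:* y))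
        R.:+ R.:- (q R.:* x R.:* y) R.:* (R.ℕcon 2 R.:* h)
        R.:+ R.:- h R.:* (R.ℕcon 2 R.:* (x R.:+ y) R.:* x R.:* y R.:+ q R.:* (x R.:* y R.:* x R.:* y)) R.:* (q R.:* q))
      R.refl π half x y))

  L-⋆-product : ∀ n κ (u : ℕ → Carrier) → L (⋆-product n (λ i → ι κ * u i))
    ≈ₘ ι κ * ∑ n u - half * (ι κ * ι κ) * (π * ∑ n (λ i → u i * u i))
  L-⋆-product zero    κ u = R.solve 3 (λ h q k →
    R.ℕcon 0 R.:- h R.:* q R.:* (R.ℕcon 0 R.:* R.ℕcon 0) R.:= k R.:* R.ℕcon 0 R.:- h R.:* (k R.:* k) R.:* (q R.:* R.ℕcon 0))
    R.refl half π (ι κ)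
  L-⋆-product (suc n) κ u = R.trans (L-⋆ (⋆-product n (λ i → ι κ * u i)) (ι κ * u n)) (R.trans (R.+-congʳ (L-⋆-product n κ u))
    (R.solve 6 (λ h q k s s₂ v →
      k R.:* s R.:- h R.:* (k R.:* k) R.:* (q R.:* s₂) R.:+ (k R.:* v R.:- h R.:* q R.:* (k R.:* v R.:* (k R.:* v)))
      R.:= k R.:* (s R.:+ v) R.:- h R.:* (k R.:* k) R.:* (q R.:* (s₂ R.:+ v R.:* v)))
      R.refl half π (ι κ) (∑ n u) (∑ n (λ i → u i * u i)) (u n)))

  -- Factor by factor, a (1 + κ p/a) = a + κ p. The equality is that of `B`, not merely modulo p².
  ⋆-product-ratio : ∀ n κ (a : ℕ → ℕ) (u : ℕ → Carrier) → (∀ i → i < n → ι (a i) * u i ≈ 1#) →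
    (1# + π * ⋆-product n (λ i → ι κ * u i)) * ι (∏ℕ n a) ≈ ι (∏ℕ n (λ i → a i ℕ.+ κ ℕ.* p))
  ⋆-product-ratio zero    κ a u _    = solve 1 (λ q → (ℕcon 1 :+ q :* ℕcon 0) :* (ℕcon 1 :+ ℕcon 0) := ℕcon 1 :+ ℕcon 0) refl π
  ⋆-product-ratio (suc n) κ a u au≈1 = begin
    (1# + π * (V ⋆ (ι κ * u n))) * ι (∏ℕ n a ℕ.* a n)
      ≈⟨ *-cong (1+π⋆ V (ι κ * u n)) (ι-* (∏ℕ n a) (a n)) ⟩
    (1# + π * V) * (1# + π * (ι κ * u n)) * (ι (∏ℕ n a) * ι (a n))
      ≈⟨ using-eq ((1# + π * V) * ι (∏ℕ n a) * π * ι κ) (au≈1 n ℕ.≤-refl)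
         (solve 6 (λ q V k u P a →
           (ℕcon 1 :+ q :* V) :* (ℕcon 1 :+ q :* (k :* u)) :* (P :* a) :+ (ℕcon 1 :+ q :* V) :* P :* q :* k :* ℕcon 1
           := (ℕcon 1 :+ q :* V) :* P :* (a :+ k :* q) :+ (ℕcon 1 :+ q :* V) :* P :* q :* k :* (a :* u))
           refl π V (ι κ) (u n) (ι (∏ℕ n a)) (ι (a n))) ⟩
    (1# + π * V) * ι (∏ℕ n a) * (ι (a n) + ι κ * π)
      ≈⟨ *-cong (⋆-product-ratio n κ a u (λ i i<n → au≈1 i (ℕ.m<n⇒m<1+n i<n)))
           (trans (+-congˡ (sym (ι-* κ p))) (sym (ι-+ (a n) (κ ℕ.* p)))) ⟩
    ι (∏ℕ n (λ i → a i ℕ.+ κ ℕ.* p)) * ι (a n ℕ.+ κ ℕ.* p)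
      ≈⟨ ι-* (∏ℕ n (λ i → a i ℕ.+ κ ℕ.* p)) (a n ℕ.+ κ ℕ.* p) ⟨
    ι (∏ℕ (suc n) (λ i → a i ℕ.+ κ ℕ.* p)) ∎
    where
    V = ⋆-product n (λ i → ι κ * u i)

  ∏ℕ-unit : ∀ n (a : ℕ → ℕ) (u : ℕ → Carrier) → (∀ i → i < n → ι (a i) * u i ≈ 1#) → ι (∏ℕ n a) * ∏ n u ≈ 1#
  ∏ℕ-unit n a u au≈1 = begin
    ι (∏ℕ n a) * ∏ n u            ≈⟨ *-congʳ (ι-∏ n a) ⟩
    ∏ n (λ i → ι (a i)) * ∏ n u   ≈⟨ ∏-* n _ u ⟨
    ∏ n (λ i → ι (a i) * u i)     ≈⟨ ∏-cong n au≈1 ⟩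
    1# ^ n                        ≈⟨ 1^ n ⟩
    1#                            ∎
    where
    1^ : ∀ n → 1# ^ n ≈ 1#
    1^ zero    = refl
    1^ (suc n) = trans (*-identityʳ _) (1^ n)

  odd-units : ∀ i → i < M → ι (suc (2 ℕ.* i ℕ.+ 0)) * inv (2 ℕ.* i ℕ.+ 0) ≈ 1#
  odd-units i i<M = inv-correct (2 ℕ.* i ℕ.+ 0) (odd-bound M 0 ≡.refl i i<M)

  -- The number q for which 1 + p q is the product of the factors 1 + p/(2i+1).
  quotient₂ : Carrier
  quotient₂ = ⋆-product M (λ i → ι 1 * inv (2 ℕ.* i ℕ.+ 0))

  quotient₂-correct : 1# + π * quotient₂ ≈ ι (2 ℕ.^ (M ℕ.+ M))
  quotient₂-correct = *-cancelʳ-unit (∏ℕ-unit M a _ odd-units) (begin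
    (1# + π * quotient₂) * ι (∏ℕ M a)                    ≈⟨ ⋆-product-ratio M 1 a _ odd-units ⟩
    ι (∏ℕ M (λ i → a i ℕ.+ 1 ℕ.* p))                     ≡⟨ ≡.cong (λ p → ι (∏ℕ M (λ i → a i ℕ.+ 1 ℕ.* p))) p≡1+2M ⟩
    ι (∏ℕ M (λ i → a i ℕ.+ 1 ℕ.* suc (M ℕ.+ M)))         ≡⟨ ≡.cong ι (shifted-odd-product M) ⟩
    ι (2 ℕ.^ (M ℕ.+ M) ℕ.* ∏ℕ M a)                       ≈⟨ ι-* (2 ℕ.^ (M ℕ.+ M)) (∏ℕ M a) ⟩
    ι (2 ℕ.^ (M ℕ.+ M)) * ι (∏ℕ M a)                     ∎)
    where
    a : ℕ → ℕ
    a i = suc (2 ℕ.* i ℕ.+ 0)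

  -- `L quotient₂` is the sum of 1/(2i+1) minus π/2 times the sum of the squares of these inverses.
  -- By `Odd` the first sum is -H_M/2 and every other term is a multiple of `π * H₂ M`, which
  -- vanishes.
  harmonic-half : H M ≈ₘ - ι 2 * L quotient₂
  harmonic-half = R.trans (R.using-eq (- H M) half-correct
      (R.using-eq (- ι 2 * half * half * (1# + half)) πH₂M≈0
      (R.solve 4 (λ h q x g →
        let
          s  = R.:- (h R.:* (x R.:- R.ℕcon 0)) R.:- (R.ℕcon 1 R.:+ R.ℕcon 0) R.:* q R.:* (h R.:* h R.:* (g R.:- R.ℕcon 0))
          s₂ = q R.:* (h R.:* h R.:* (g R.:- R.ℕcon 0))
          k  = R.ℕcon 1 R.:+ R.ℕcon 0
          d  = R.:- R.ℕcon 2 R.:* h R.:* h R.:* (R.ℕcon 1 R.:+ h)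
        in
        x R.:+ R.:- x R.:* R.ℕcon 1 R.:+ d R.:* R.ℕcon 0
        R.:= R.:- R.ℕcon 2 R.:* (k R.:* s R.:- h R.:* (k R.:* k) R.:* s₂) R.:+ R.:- x R.:* (R.ℕcon 2 R.:* h) R.:+ d R.:* (q R.:* g))
        R.refl half π (H M) (H₂ M))))
    (R.sym (R.*-congˡ (R.trans (L-⋆-product M 1 _) (R.+-cong
      (R.*-congˡ (Odd.∑-class M 0 ≡.refl (odd-bound M 0 ≡.refl)))
      (R.-‿cong (R.*-congˡ (Odd.∑-class² M 0 ≡.refl (odd-bound M 0 ≡.refl))))))))

  -- The nonzero classes modulo 3 are those of e+1, which contains p, and of f+1. With m′ = p-1-m
  -- they are 3i+1+e = p - 3(m-i) and 3i+1+f = 2p - 3(m′-i). Thus the first is matched with the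
  -- segment from 1 to m and the second with that from m+1 to m′.
  module Base3 (m e f : ℕ) (e+f≡1 : e ℕ.+ f ≡ 1) (p≡3m+1+e : p ≡ 3 ℕ.* m ℕ.+ suc e) where

    private
      n m′ : ℕ
      n  = e ℕ.+ m
      m′ = m ℕ.+ n

      bound-e : ∀ i → i < m → suc (3 ℕ.* i ℕ.+ e) < p
      bound-e i i<m = ≡.subst (suc (3 ℕ.* i ℕ.+ e) <_) (≡.sym (≡.trans p≡3m+1+e (ℕ.+-suc (3 ℕ.* m) e)))
        (s≤s (ℕ.+-monoˡ-< e (ℕ.*-monoʳ-< 3 i<m)))

      bound-f : ∀ e f → e ℕ.+ f ≡ 1 → ∀ i → i < e ℕ.+ m → suc (3 ℕ.* i ℕ.+ f) < 3 ℕ.* m ℕ.+ suc e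
      bound-f 0 1 _ i i<n = ℕ.≤-trans (ℕ.≤-reflexive (lemma i)) (ℕ.≤-trans (ℕ.*-monoʳ-≤ 3 i<n) (ℕ.m≤m+n (3 ℕ.* m) 1))
        where
        lemma : ∀ i → suc (suc (3 ℕ.* i ℕ.+ 1)) ≡ 3 ℕ.* suc i
        lemma = solve-∀
      bound-f 1 0 _ i (s≤s i≤m) = ℕ.≤-trans (ℕ.≤-reflexive (lemma i)) (ℕ.+-monoˡ-≤ 2 (ℕ.*-monoʳ-≤ 3 i≤m))
        where
        lemma : ∀ i → suc (suc (3 ℕ.* i ℕ.+ 0)) ≡ 3 ℕ.* i ℕ.+ 2
        lemma = solve-∀

      bound-w : ∀ i → i < n → suc (3 ℕ.* i ℕ.+ f) < p
      bound-w i i<n = ≡.subst (suc (3 ℕ.* i ℕ.+ f) <_) (≡.sym p≡3m+1+e) (bound-f e f e+f≡1 i i<n)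

      2M≡ : ∀ m e → 3 ℕ.* m ℕ.+ suc e ≡ suc (m ℕ.+ (e ℕ.+ m) ℕ.+ m)
      2M≡ = solve-∀

      m′+m≡2M : m′ ℕ.+ m ≡ M ℕ.+ M
      m′+m≡2M = ℕ.suc-injective (≡.trans (≡.sym (2M≡ m e)) (≡.trans (≡.sym p≡3m+1+e) p≡1+2M))

      m′<p : m′ < p
      m′<p = ℕ.≤-<-trans (ℕ.m≤m+n m′ m) (≡.subst (_< p) (≡.sym m′+m≡2M) 2M<p)

      m<p : m < p
      m<p = ℕ.≤-<-trans (ℕ.m≤n+m m m′) (≡.subst (_< p) (≡.sym m′+m≡2M) 2M<p)

      class-f : 3 ℕ.* m′ ℕ.+ suc f ≡ 2 ℕ.* p
      class-f = ≡.trans (lemma m e f) (≡.trans (≡.cong (λ s → 6 ℕ.* m ℕ.+ 2 ℕ.* e ℕ.+ 1 ℕ.+ s) e+f≡1)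
        (≡.trans (lemma′ m e) (≡.cong (2 ℕ.*_) (≡.sym p≡3m+1+e))))
        where
        lemma : ∀ m e f → 3 ℕ.* (m ℕ.+ (e ℕ.+ m)) ℕ.+ suc f ≡ 6 ℕ.* m ℕ.+ 2 ℕ.* e ℕ.+ 1 ℕ.+ (e ℕ.+ f)
        lemma = solve-∀
        lemma′ : ∀ m e → 6 ℕ.* m ℕ.+ 2 ℕ.* e ℕ.+ 1 ℕ.+ 1 ≡ 2 ℕ.* (3 ℕ.* m ℕ.+ suc e)
        lemma′ = solve-∀

      module Class-e = ResidueClass 3 1 m e third third-correct (≡.sym (≡.trans (ℕ.*-identityˡ p) p≡3m+1+e)) m<p
      module Class-f = ResidueClass 3 2 m′ f third third-correct class-f m′<p

      a b : ℕ → ℕ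
      a i = suc (3 ℕ.* i ℕ.+ e)
      b i = suc (3 ℕ.* i ℕ.+ f)

      u v : ℕ → Carrier
      u i = inv (3 ℕ.* i ℕ.+ e)
      v i = inv (3 ℕ.* i ℕ.+ f)

      units-u : ∀ i → i < m → ι (a i) * u i ≈ 1#
      units-u i i<m = inv-correct (3 ℕ.* i ℕ.+ e) (bound-e i i<m)

      units-v : ∀ i → i < n → ι (b i) * v i ≈ 1#
      units-v i i<n = inv-correct (3 ℕ.* i ℕ.+ f) (bound-w i i<n)

      U V : Carrier
      U = ⋆-product m (λ i → ι 2 * u i)
      V = ⋆-product n (λ i → ι 1 * v i)

    quotient₃ : Carrier
    quotient₃ = U ⋆ V

    quotient₃-correct : 1# + π * quotient₃ ≈ ι (3 ℕ.^ (M ℕ.+ M))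
    quotient₃-correct = *-cancelʳ-unit unit (begin
      (1# + π * quotient₃) * ι (∏ℕ m a ℕ.* ∏ℕ n b)
        ≈⟨ *-cong (1+π⋆ U V) (ι-* (∏ℕ m a) (∏ℕ n b)) ⟩
      (1# + π * U) * (1# + π * V) * (ι (∏ℕ m a) * ι (∏ℕ n b))
        ≈⟨ solve 4 (λ a b c d → a :* b :* (c :* d) := (a :* c) :* (b :* d)) refl _ _ _ _ ⟩
      (1# + π * U) * ι (∏ℕ m a) * ((1# + π * V) * ι (∏ℕ n b))
        ≈⟨ *-cong (⋆-product-ratio m 2 a u units-u) (⋆-product-ratio n 1 b v units-v) ⟩
      ι (∏ℕ m (λ i → a i ℕ.+ 2 ℕ.* p)) * ι (∏ℕ n (λ i → b i ℕ.+ 1 ℕ.* p))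
        ≈⟨ ι-* (∏ℕ m (λ i → a i ℕ.+ 2 ℕ.* p)) (∏ℕ n (λ i → b i ℕ.+ 1 ℕ.* p)) ⟨
      ι (∏ℕ m (λ i → a i ℕ.+ 2 ℕ.* p) ℕ.* ∏ℕ n (λ i → b i ℕ.+ 1 ℕ.* p))
        ≡⟨ ≡.cong (λ p → ι (∏ℕ m (λ i → a i ℕ.+ 2 ℕ.* p) ℕ.* ∏ℕ n (λ i → b i ℕ.+ 1 ℕ.* p))) p≡3m+1+e ⟩
      ι (∏ℕ m (λ i → a i ℕ.+ 2 ℕ.* (3 ℕ.* m ℕ.+ suc e)) ℕ.* ∏ℕ n (λ i → b i ℕ.+ 1 ℕ.* (3 ℕ.* m ℕ.+ suc e)))
        ≡⟨ ≡.cong ι (shifted-mod3-product m e f e+f≡1) ⟩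
      ι (3 ℕ.^ (m′ ℕ.+ m) ℕ.* (∏ℕ m a ℕ.* ∏ℕ n b))
        ≡⟨ ≡.cong (λ k → ι (3 ℕ.^ k ℕ.* (∏ℕ m a ℕ.* ∏ℕ n b))) m′+m≡2M ⟩
      ι (3 ℕ.^ (M ℕ.+ M) ℕ.* (∏ℕ m a ℕ.* ∏ℕ n b))
        ≈⟨ ι-* (3 ℕ.^ (M ℕ.+ M)) (∏ℕ m a ℕ.* ∏ℕ n b) ⟩
      ι (3 ℕ.^ (M ℕ.+ M)) * ι (∏ℕ m a ℕ.* ∏ℕ n b) ∎)
      where
      unit : ι (∏ℕ m a ℕ.* ∏ℕ n b) * (∏ m u * ∏ n v) ≈ 1#
      unit = begin
        ι (∏ℕ m a ℕ.* ∏ℕ n b) * (∏ m u * ∏ n v)         ≈⟨ *-congʳ (ι-* (∏ℕ m a) (∏ℕ n b)) ⟩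
        ι (∏ℕ m a) * ι (∏ℕ n b) * (∏ m u * ∏ n v)       ≈⟨ solve 4 (λ a b c d → a :* b :* (c :* d) := (a :* c) :* (b :* d)) refl _ _ _ _ ⟩
        ι (∏ℕ m a) * ∏ m u * (ι (∏ℕ n b) * ∏ n v)       ≈⟨ *-cong (∏ℕ-unit m a u units-u) (∏ℕ-unit n b v units-v) ⟩
        1# * 1#                                         ≈⟨ *-identityˡ 1# ⟩
        1#                                              ∎

    -- The classes contribute the segments up to m and from m+1 to m′. The reflection lemmas turn
    -- the second into multiples of π H₂(m), leaving L(q₃) = -(2/3) H_m - (2/9) π H₂(m).
    harmonic-third : ι 2 * (H m + π * third * H₂ m) ≈ₘ - ι 3 * L quotient₃
    harmonic-third = R.trans
      (R.using-eq (ι 3 * - third) (H-reflect m m′ m′+m≡2M)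
      (R.using-eq (ι 3 * (half * third * third * - 1# - ι 2 * third * third)) (H₂-reflect m m′ m′+m≡2M)
      (R.using-eq (- ι 2 * x + third * g) third-correct
      (R.using-eq (- ι 3 * (third * third) * g) half-correct
      (R.solve 7 (λ h t q x x′ G G′ →
        let
          g = q R.:* G
          k₁ = R.ℕcon 1 R.:+ R.ℕcon 0
          A  = R.:- (t R.:* (x R.:- R.ℕcon 0)) R.:- k₁ R.:* q R.:* (t R.:* t R.:* (G R.:- R.ℕcon 0))
          A₂ = q R.:* (t R.:* t R.:* (G R.:- R.ℕcon 0))
          C  = R.:- (t R.:* (x′ R.:- x)) R.:- R.ℕcon 2 R.:* q R.:* (t R.:* t R.:* (G′ R.:- G))
          C₂ = q R.:* (t R.:* t R.:* (G′ R.:- G))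
          c₁ = R.ℕcon 3 R.:* R.:- t
          c₂ = R.ℕcon 3 R.:* (h R.:* t R.:* t R.:* R.:- R.ℕcon 1 R.:- R.ℕcon 2 R.:* t R.:* t)
          c₃ = R.:- R.ℕcon 2 R.:* x R.:+ t R.:* g
          c₄ = R.:- R.ℕcon 3 R.:* (t R.:* t) R.:* g
        in
        R.ℕcon 2 R.:* (x R.:+ q R.:* t R.:* G) R.:+ c₁ R.:* (x R.:+ q R.:* G) R.:+ c₂ R.:* R.:- (q R.:* G)
          R.:+ c₃ R.:* R.ℕcon 1 R.:+ c₄ R.:* R.ℕcon 1
        R.:= R.:- R.ℕcon 3 R.:* (R.ℕcon 2 R.:* A R.:- h R.:* (R.ℕcon 2 R.:* R.ℕcon 2) R.:* A₂
               R.:+ (k₁ R.:* C R.:- h R.:* (k₁ R.:* k₁) R.:* C₂))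
          R.:+ c₁ R.:* x′ R.:+ c₂ R.:* (q R.:* G′) R.:+ c₃ R.:* (R.ℕcon 3 R.:* t) R.:+ c₄ R.:* (R.ℕcon 2 R.:* h))
        R.refl half third π (H m) (H m′) (H₂ m) (H₂ m′))))))
      (R.sym (R.*-congˡ (R.trans (L-⋆ U V) (R.+-cong
        (R.trans (L-⋆-product m 2 u) (R.+-cong
          (R.*-congˡ (Class-e.∑-class m 0 ≡.refl bound-e))
          (R.-‿cong (R.*-congˡ (Class-e.∑-class² m 0 ≡.refl bound-e)))))
        (R.trans (L-⋆-product n 1 v) (R.+-cong
          (R.*-congˡ (Class-f.∑-class n m ≡.refl bound-w))
          (R.-‿cong (R.*-congˡ (Class-f.∑-class² n m ≡.refl bound-w)))))))))
      where
      x = H m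
      g = π * H₂ m

-- Term ratios of the four products of binomial coefficients.

C-! : ∀ m l {n} → m ℕ.+ l ≡ n → (n C m) ℕ.* (m ! ℕ.* l !) ≡ n !
C-! zero    l ≡.refl = ≡.trans (ℕ.*-identityˡ (1 ℕ.* l !)) (ℕ.*-identityˡ (l !))
C-! (suc m) l ≡.refl = begin
  (suc (m ℕ.+ l) C suc m) ℕ.* (suc m ℕ.* m ! ℕ.* l !)    ≡⟨ lemma (suc (m ℕ.+ l) C suc m) (suc m) (m !) (l !) ⟩
  suc m ℕ.* (suc (m ℕ.+ l) C suc m) ℕ.* (m ! ℕ.* l !)    ≡⟨ ≡.cong (ℕ._* (m ! ℕ.* l !)) (absorption (m ℕ.+ l) m) ⟩
  suc (m ℕ.+ l) ℕ.* ((m ℕ.+ l) C m) ℕ.* (m ! ℕ.* l !)    ≡⟨ ℕ.*-assoc (suc (m ℕ.+ l)) ((m ℕ.+ l) C m) (m ! ℕ.* l !) ⟩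
  suc (m ℕ.+ l) ℕ.* (((m ℕ.+ l) C m) ℕ.* (m ! ℕ.* l !))  ≡⟨ ≡.cong (suc (m ℕ.+ l) ℕ.*_) (C-! m l ≡.refl) ⟩
  suc (m ℕ.+ l) ! ∎
  where
  open ≡.≡-Reasoning
  lemma : ∀ x s y z → x ℕ.* (s ℕ.* y ℕ.* z) ≡ s ℕ.* x ℕ.* (y ℕ.* z)
  lemma = solve-∀

-- For i + j = d this is the term ratio of (e d²)^k C(x,k) C(-1-x,k) at x = -i/d. The bases 16, 27,
-- 64 and 432 are the values of e d².
HypergeometricStep : ℕ → ℕ → ℕ → ℕ → (ℕ → ℕ) → Set
HypergeometricStep e d i j N =
  ∀ k → N (suc k) ℕ.* (suc k ℕ.* suc k) ≡ e ℕ.* N k ℕ.* ((d ℕ.* k ℕ.+ i) ℕ.* (d ℕ.* k ℕ.+ j))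

-- If N k = T k / D k, a common factor c k of the ratios of successive
-- denominators and numerators drops out.
ratio-step : ∀ e d i j (N D T c : ℕ → ℕ) → (∀ k → NonZero (D k)) → (∀ k → NonZero (c k)) →
  (∀ k → N k ℕ.* D k ≡ T k) →
  (∀ k → D (suc k) ≡ D k ℕ.* c k ℕ.* (suc k ℕ.* suc k)) →
  (∀ k → T (suc k) ≡ T k ℕ.* c k ℕ.* (e ℕ.* ((d ℕ.* k ℕ.+ i) ℕ.* (d ℕ.* k ℕ.+ j)))) →
  HypergeometricStep e d i j N
ratio-step e d i j N D T c D≢0 c≢0 ND≡T D-step T-step k =
  ℕ.*-cancelʳ-≡ _ _ (D k ℕ.* c k) {{ℕ.m*n≢0 (D k) (c k) {{D≢0 k}} {{c≢0 k}}}} (begin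
    N (suc k) ℕ.* s ℕ.* (D k ℕ.* c k)             ≡⟨ lemma (N (suc k)) s (D k ℕ.* c k) ⟩
    N (suc k) ℕ.* (D k ℕ.* c k ℕ.* s)             ≡⟨ ≡.cong (N (suc k) ℕ.*_) (≡.sym (D-step k)) ⟩
    N (suc k) ℕ.* D (suc k)                       ≡⟨ ND≡T (suc k) ⟩
    T (suc k)                                     ≡⟨ T-step k ⟩
    T k ℕ.* c k ℕ.* (e ℕ.* r)                     ≡⟨ ≡.cong (λ t → t ℕ.* c k ℕ.* (e ℕ.* r)) (≡.sym (ND≡T k)) ⟩
    N k ℕ.* D k ℕ.* c k ℕ.* (e ℕ.* r)             ≡⟨ lemma′ (N k) (D k) (c k) e r ⟩
    e ℕ.* N k ℕ.* r ℕ.* (D k ℕ.* c k)             ∎)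
  where
  open ≡.≡-Reasoning
  s = suc k ℕ.* suc k
  r = (d ℕ.* k ℕ.+ i) ℕ.* (d ℕ.* k ℕ.+ j)
  lemma : ∀ x s y → x ℕ.* s ℕ.* y ≡ x ℕ.* (y ℕ.* s)
  lemma = solve-∀
  lemma′ : ∀ n d c e r → n ℕ.* d ℕ.* c ℕ.* (e ℕ.* r) ≡ e ℕ.* n ℕ.* r ℕ.* (d ℕ.* c)
  lemma′ = solve-∀

private
  [2+2k]! : ∀ k → (2 ℕ.* suc k) ! ≡ (2 ℕ.+ 2 ℕ.* k) !
  [2+2k]! k = ≡.cong _! (ℕ.*-suc 2 k)
  [3+3k]! : ∀ k → (3 ℕ.* suc k) ! ≡ (3 ℕ.+ 3 ℕ.* k) !
  [3+3k]! k = ≡.cong _! (ℕ.*-suc 3 k)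
  [4+4k]! : ∀ k → (4 ℕ.* suc k) ! ≡ (4 ℕ.+ 4 ℕ.* k) !
  [4+4k]! k = ≡.cong _! (ℕ.*-suc 4 k)
  [6+6k]! : ∀ k → (6 ℕ.* suc k) ! ≡ (6 ℕ.+ 6 ℕ.* k) !
  [6+6k]! k = ≡.cong _! (ℕ.*-suc 6 k)

  k+k : ∀ k → k ℕ.+ k ≡ 2 ℕ.* k
  k+k = solve-∀
  k+2k : ∀ k → k ℕ.+ 2 ℕ.* k ≡ 3 ℕ.* k
  k+2k = solve-∀
  2k+2k : ∀ k → 2 ℕ.* k ℕ.+ 2 ℕ.* k ≡ 4 ℕ.* k
  2k+2k = solve-∀
  3k+3k : ∀ k → 3 ℕ.* k ℕ.+ 3 ℕ.* k ≡ 6 ℕ.* k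
  3k+3k = solve-∀

  infixr 3 _⊗_
  _⊗_ : ∀ {m n} → NonZero m → NonZero n → NonZero (m ℕ.* n)
  _⊗_ {m} {n} m≢0 n≢0 = ℕ.m*n≢0 m n {{m≢0}} {{n≢0}}

A₂ A₃ A₄ A₆ : ℕ → ℕ
A₂ k = ((2 ℕ.* k) C k) ℕ.^ 2
A₃ k = ((2 ℕ.* k) C k) ℕ.* ((3 ℕ.* k) C k)
A₄ k = ((4 ℕ.* k) C (2 ℕ.* k)) ℕ.* ((2 ℕ.* k) C k)
A₆ k = ((6 ℕ.* k) C (3 ℕ.* k)) ℕ.* ((3 ℕ.* k) C k)

step₂ : HypergeometricStep 4 2 1 1 A₂
step₂ = ratio-step 4 2 1 1 A₂ (λ k → k ! ℕ.* k ! ℕ.* (k ! ℕ.* k !)) (λ k → (2 ℕ.* k) ! ℕ.* (2 ℕ.* k) !) (λ k → suc k ℕ.* suc k)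
  (λ k → (k ℕ.!≢0 ⊗ k ℕ.!≢0) ⊗ k ℕ.!≢0 ⊗ k ℕ.!≢0) (λ k → _)
  (λ k → ≡.trans (square ((2 ℕ.* k) C k) (k ! ℕ.* k !)) (≡.cong₂ ℕ._*_ (C-! k k (k+k k)) (C-! k k (k+k k))))
  (λ k → denominator k (k !))
  (λ k → ≡.trans (≡.cong₂ ℕ._*_ ([2+2k]! k) ([2+2k]! k)) (numerator k ((2 ℕ.* k) !)))
  where
  square : ∀ x y → x ℕ.* (x ℕ.* 1) ℕ.* (y ℕ.* y) ≡ (x ℕ.* y) ℕ.* (x ℕ.* y)
  square = solve-∀
  denominator : ∀ k x → let y = suc k ℕ.* x in y ℕ.* y ℕ.* (y ℕ.* y) ≡ x ℕ.* x ℕ.* (x ℕ.* x) ℕ.* (suc k ℕ.* suc k) ℕ.* (suc k ℕ.* suc k)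
  denominator = solve-∀
  numerator : ∀ k x → let y = (2 ℕ.+ 2 ℕ.* k) ℕ.* ((1 ℕ.+ 2 ℕ.* k) ℕ.* x) in
    y ℕ.* y ≡ x ℕ.* x ℕ.* (suc k ℕ.* suc k) ℕ.* (4 ℕ.* ((2 ℕ.* k ℕ.+ 1) ℕ.* (2 ℕ.* k ℕ.+ 1)))
  numerator = solve-∀

step₃ : HypergeometricStep 3 3 1 2 A₃
step₃ = ratio-step 3 3 1 2 A₃ (λ k → k ! ℕ.* k ! ℕ.* k !) (λ k → (3 ℕ.* k) !) suc
  (λ k → (k ℕ.!≢0 ⊗ k ℕ.!≢0) ⊗ k ℕ.!≢0) (λ k → _)
  (λ k → ≡.trans (regroup ((2 ℕ.* k) C k) ((3 ℕ.* k) C k) (k !))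
    (≡.trans (≡.cong (λ x → ((3 ℕ.* k) C k) ℕ.* (k ! ℕ.* x)) (C-! k k (k+k k))) (C-! k (2 ℕ.* k) (k+2k k))))
  (λ k → denominator k (k !))
  (λ k → ≡.trans ([3+3k]! k) (numerator k ((3 ℕ.* k) !)))
  where
  regroup : ∀ x y z → x ℕ.* y ℕ.* (z ℕ.* z ℕ.* z) ≡ y ℕ.* (z ℕ.* (x ℕ.* (z ℕ.* z)))
  regroup = solve-∀
  denominator : ∀ k x → let y = suc k ℕ.* x in y ℕ.* y ℕ.* y ≡ x ℕ.* x ℕ.* x ℕ.* suc k ℕ.* (suc k ℕ.* suc k)
  denominator = solve-∀
  numerator : ∀ k x → (3 ℕ.+ 3 ℕ.* k) ℕ.* ((2 ℕ.+ 3 ℕ.* k) ℕ.* ((1 ℕ.+ 3 ℕ.* k) ℕ.* x))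
    ≡ x ℕ.* suc k ℕ.* (3 ℕ.* ((3 ℕ.* k ℕ.+ 1) ℕ.* (3 ℕ.* k ℕ.+ 2)))
  numerator = solve-∀

step₄ : HypergeometricStep 4 4 1 3 A₄
step₄ = ratio-step 4 4 1 3 A₄ (λ k → (2 ℕ.* k) ! ℕ.* (k ! ℕ.* k !)) (λ k → (4 ℕ.* k) !) (λ k → 2 ℕ.* (suc (2 ℕ.* k) ℕ.* suc k))
  (λ k → (2 ℕ.* k) ℕ.!≢0 ⊗ k ℕ.!≢0 ⊗ k ℕ.!≢0) (λ k → _)
  (λ k → ≡.trans (regroup ((4 ℕ.* k) C (2 ℕ.* k)) ((2 ℕ.* k) C k) ((2 ℕ.* k) !) (k ! ℕ.* k !))
    (≡.trans (≡.cong (λ x → ((4 ℕ.* k) C (2 ℕ.* k)) ℕ.* ((2 ℕ.* k) ! ℕ.* x)) (C-! k k (k+k k)))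
      (C-! (2 ℕ.* k) (2 ℕ.* k) (2k+2k k))))
  (λ k → ≡.trans (≡.cong (ℕ._* (suc k ! ℕ.* suc k !)) ([2+2k]! k)) (denominator k ((2 ℕ.* k) !) (k !)))
  (λ k → ≡.trans ([4+4k]! k) (numerator k ((4 ℕ.* k) !)))
  where
  regroup : ∀ x y z w → x ℕ.* y ℕ.* (z ℕ.* w) ≡ x ℕ.* (z ℕ.* (y ℕ.* w))
  regroup = solve-∀
  denominator : ∀ k x z → (2 ℕ.+ 2 ℕ.* k) ℕ.* ((1 ℕ.+ 2 ℕ.* k) ℕ.* x) ℕ.* (suc k ℕ.* z ℕ.* (suc k ℕ.* z))
    ≡ x ℕ.* (z ℕ.* z) ℕ.* (2 ℕ.* (suc (2 ℕ.* k) ℕ.* suc k)) ℕ.* (suc k ℕ.* suc k)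
  denominator = solve-∀
  numerator : ∀ k x → (4 ℕ.+ 4 ℕ.* k) ℕ.* ((3 ℕ.+ 4 ℕ.* k) ℕ.* ((2 ℕ.+ 4 ℕ.* k) ℕ.* ((1 ℕ.+ 4 ℕ.* k) ℕ.* x)))
    ≡ x ℕ.* (2 ℕ.* (suc (2 ℕ.* k) ℕ.* suc k)) ℕ.* (4 ℕ.* ((4 ℕ.* k ℕ.+ 1) ℕ.* (4 ℕ.* k ℕ.+ 3)))
  numerator = solve-∀

-- `A₆ k` is (6k)!/((3k)! k! (2k)!). Of the six new factors above, all but 6k+1 and 6k+5 multiply to
-- 72 (3k+1)(3k+2)(2k+1)(k+1); six times the four linear factors cancels below, leaving 12.
step₆ : HypergeometricStep 12 6 1 5 A₆
step₆ = ratio-step 12 6 1 5 A₆ (λ k → (3 ℕ.* k) ! ℕ.* (k ! ℕ.* (2 ℕ.* k) !)) (λ k → (6 ℕ.* k) !)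
  (λ k → 6 ℕ.* (suc (3 ℕ.* k) ℕ.* (suc (suc (3 ℕ.* k)) ℕ.* (suc (2 ℕ.* k) ℕ.* suc k))))
  (λ k → (3 ℕ.* k) ℕ.!≢0 ⊗ k ℕ.!≢0 ⊗ (2 ℕ.* k) ℕ.!≢0) (λ k → _)
  (λ k → ≡.trans (regroup ((6 ℕ.* k) C (3 ℕ.* k)) ((3 ℕ.* k) C k) ((3 ℕ.* k) !) (k ! ℕ.* (2 ℕ.* k) !))
    (≡.trans (≡.cong (λ x → ((6 ℕ.* k) C (3 ℕ.* k)) ℕ.* ((3 ℕ.* k) ! ℕ.* x)) (C-! k (2 ℕ.* k) (k+2k k)))
      (C-! (3 ℕ.* k) (3 ℕ.* k) (3k+3k k))))
  (λ k → ≡.trans (≡.cong₂ (λ x y → x ℕ.* (suc k ! ℕ.* y)) ([3+3k]! k) ([2+2k]! k))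
    (denominator k ((3 ℕ.* k) !) (k !) ((2 ℕ.* k) !)))
  (λ k → ≡.trans ([6+6k]! k) (numerator k ((6 ℕ.* k) !)))
  where
  regroup : ∀ x y z w → x ℕ.* y ℕ.* (z ℕ.* w) ≡ x ℕ.* (z ℕ.* (y ℕ.* w))
  regroup = solve-∀
  denominator : ∀ k x y z → (3 ℕ.+ 3 ℕ.* k) ℕ.* ((2 ℕ.+ 3 ℕ.* k) ℕ.* ((1 ℕ.+ 3 ℕ.* k) ℕ.* x))
      ℕ.* (suc k ℕ.* y ℕ.* ((2 ℕ.+ 2 ℕ.* k) ℕ.* ((1 ℕ.+ 2 ℕ.* k) ℕ.* z)))
    ≡ x ℕ.* (y ℕ.* z) ℕ.* (6 ℕ.* (suc (3 ℕ.* k) ℕ.* (suc (suc (3 ℕ.* k)) ℕ.* (suc (2 ℕ.* k) ℕ.* suc k)))) ℕ.* (suc k ℕ.* suc k)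
  denominator = solve-∀
  numerator : ∀ k x →
    (6 ℕ.+ 6 ℕ.* k) ℕ.* ((5 ℕ.+ 6 ℕ.* k) ℕ.* ((4 ℕ.+ 6 ℕ.* k) ℕ.* ((3 ℕ.+ 6 ℕ.* k) ℕ.* ((2 ℕ.+ 6 ℕ.* k) ℕ.* ((1 ℕ.+ 6 ℕ.* k) ℕ.* x)))))
    ≡ x ℕ.* (6 ℕ.* (suc (3 ℕ.* k) ℕ.* (suc (suc (3 ℕ.* k)) ℕ.* (suc (2 ℕ.* k) ℕ.* suc k))))
      ℕ.* (12 ℕ.* ((6 ℕ.* k ℕ.+ 1) ℕ.* (6 ℕ.* k ℕ.+ 5)))
  numerator = solve-∀

-- Allows i to be the residue of p modulo d also when that residue is d-1.
HypergeometricStep-swap : ∀ e d i j N → HypergeometricStep e d i j N → HypergeometricStep e d j i N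
HypergeometricStep-swap e d i j N step k =
  ≡.trans (step k) (≡.cong (e ℕ.* N k ℕ.*_) (ℕ.*-comm (d ℕ.* k ℕ.+ i) (d ℕ.* k ℕ.+ j)))

-- The four sums as values of S at -i/d, expressed by Fermat quotients.

module HypergeometricSums {c ℓ} (B : CommutativeRing c ℓ) (p M : ℕ) (p≡1+2M : p ≡ suc (M ℕ.+ M)) (3<p : 3 < p)
  (inv : ℕ → CommutativeRing.Carrier B) (inv-correct : RingLemmas.InvertsBelow B p inv) where

  open RingLemmas B
  open Quotient B (ι p * ι p)
  open FermatQuotients B p M p≡1+2M 3<p inv inv-correct
  private
    module R = RingLemmas quotient

  Invertible : ℕ → Set _
  Invertible n = ∃[ w ] ι n * w ≈ 1#

  infixr 5 _⊛_
  _⊛_ : ∀ {m n} → Invertible m → Invertible n → Invertible (m ℕ.* n)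
  _⊛_ {m} {n} (u , mu≈1) (v , nv≈1) = u * v , (begin
    ι (m ℕ.* n) * (u * v)      ≈⟨ *-congʳ (ι-* m n) ⟩
    ι m * ι n * (u * v)        ≈⟨ solve 4 (λ a b c d → a :* b :* (c :* d) := (a :* c) :* (b :* d)) refl _ _ _ _ ⟩
    ι m * u * (ι n * v)        ≈⟨ *-cong mu≈1 nv≈1 ⟩
    1# * 1#                    ≈⟨ *-identityˡ 1# ⟩
    1#                         ∎)

  invertible-^ : ∀ {m} n → Invertible m → Invertible (m ℕ.^ n)
  invertible-^ {m} zero    m⁻¹ = 1# , trans (*-identityʳ (ι 1)) (+-identityʳ 1#)
  invertible-^ {m} (suc n) m⁻¹ = _⊛_ {m} {m ℕ.^ n} m⁻¹ (invertible-^ n m⁻¹)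

  invertible₂ : Invertible 2
  invertible₂ = inv 1 , inv-correct 1 (ℕ.<-trans (ℕ.n<1+n 2) 3<p)

  invertible₃ : Invertible 3
  invertible₃ = inv 2 , inv-correct 2 3<p

  invertible₄ : Invertible 4
  invertible₄ = _⊛_ {2} {2} invertible₂ invertible₂

  invertible₆ : Invertible 6
  invertible₆ = _⊛_ {2} {3} invertible₂ invertible₃

  -- Here `f k` is N(k)/(e d²)^k; in the ratio the powers of the base cancel up to one factor e d²,
  -- whose e cancels as well.
  step-in-ring : ∀ e d i j (N : ℕ → ℕ) (f : ℕ → Carrier) → Invertible (e ℕ.* (d ℕ.* d)) →
    HypergeometricStep e d i j N → (∀ k → f k * ι ((e ℕ.* (d ℕ.* d)) ℕ.^ k) ≈ ι (N k)) →
    ∀ k → f (suc k) * (ι (suc k) * ι (suc k) * (ι d * ι d)) ≈ f k * (ι (d ℕ.* k ℕ.+ i) * ι (d ℕ.* k ℕ.+ j))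
  step-in-ring e d i j N f A⁻¹ step f-N k = *-cancelʳ-unit (proj₂ (invertible-^ {A} (suc k) A⁻¹)) (begin
    f (suc k) * (K * K * (D * D)) * ι (A ℕ.^ suc k)
      ≈⟨ solve 4 (λ f K D A → f :* (K :* K :* (D :* D)) :* A := f :* A :* (K :* K) :* (D :* D)) refl (f (suc k)) K D _ ⟩
    f (suc k) * ι (A ℕ.^ suc k) * (K * K) * (D * D)
      ≈⟨ *-congʳ (*-cong (f-N (suc k)) (sym (ι-* (suc k) (suc k)))) ⟩
    ι (N (suc k)) * ι (suc k ℕ.* suc k) * (D * D)
      ≈⟨ *-congʳ (trans (sym (ι-* (N (suc k)) (suc k ℕ.* suc k))) (reflexive (≡.cong ι (step k)))) ⟩
    ι (e ℕ.* N k ℕ.* (r ℕ.* s)) * (D * D)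
      ≈⟨ *-congʳ (trans (ι-* (e ℕ.* N k) (r ℕ.* s)) (*-cong (ι-* e (N k)) (ι-* r s))) ⟩
    ι e * ι (N k) * (ι r * ι s) * (D * D)
      ≈⟨ *-congʳ (*-congʳ (*-congˡ (sym (f-N k)))) ⟩
    ι e * (f k * ι (A ℕ.^ k)) * (ι r * ι s) * (D * D)
      ≈⟨ solve 6 (λ e f P r s D → e :* (f :* P) :* (r :* s) :* (D :* D) := f :* (r :* s) :* (e :* (D :* D) :* P))
           refl (ι e) (f k) (ι (A ℕ.^ k)) (ι r) (ι s) D ⟩
    f k * (ι r * ι s) * (ι e * (D * D) * ι (A ℕ.^ k))
      ≈⟨ *-congˡ (*-congʳ (trans (*-congˡ (sym (ι-* d d))) (sym (ι-* e (d ℕ.* d))))) ⟩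
    f k * (ι r * ι s) * (ι A * ι (A ℕ.^ k))
      ≈⟨ *-congˡ (sym (ι-* A (A ℕ.^ k))) ⟩
    f k * (ι r * ι s) * ι (A ℕ.^ suc k) ∎)
    where
    A = e ℕ.* (d ℕ.* d)
    K = ι (suc k)
    D = ι d
    r = d ℕ.* k ℕ.+ i
    s = d ℕ.* k ℕ.+ j

  -- Both sides obey the same recursion: for x = -i/d one has -(x-k)(x+k+1) d² = (dk+i)(dk+j). The
  -- coefficient (k+1)² d² of the new term is a unit because k+1 < p.
  F-unique : ∀ d i j (f : ℕ → Carrier) δ → ι d * δ ≈ 1# → i ℕ.+ j ≡ d → f 0 ≈ 1# →
    (∀ k → f (suc k) * (ι (suc k) * ι (suc k) * (ι d * ι d)) ≈ f k * (ι (d ℕ.* k ℕ.+ i) * ι (d ℕ.* k ℕ.+ j))) →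
    ∀ k → k < p → f k ≈ₘ F (- (ι i * δ)) k
  F-unique d i j f δ dδ≈1 i+j≡d f0≈1 f-step zero    _   = ≈⇒≈ₘ f0≈1
  F-unique d i j f δ dδ≈1 i+j≡d f0≈1 f-step (suc k) k<p = R.*-cancelʳ-unit (≈⇒≈ₘ unit) (R.trans (≈⇒≈ₘ (f-step k))
    (R.trans (R.*-congʳ (F-unique d i j f δ dδ≈1 i+j≡d f0≈1 f-step k (ℕ.<-trans (ℕ.n<1+n k) k<p))) (≈⇒≈ₘ (begin
      φ * (ι (d ℕ.* k ℕ.+ i) * ι (d ℕ.* k ℕ.+ j))
        ≈⟨ *-congˡ (*-cong (trans (ι-+ (d ℕ.* k) i) (+-congʳ (ι-* d k))) (trans (ι-+ (d ℕ.* k) j) (+-congʳ (ι-* d k)))) ⟩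
      φ * ((D * ι k + ι i) * (D * ι k + ι j))
        ≈⟨ using-eq (φ * (D * ι k + ι i)) i+j≈d
           (using-eq (- (φ * ι i * (D * (ι k + 1#) - ι i) - φ * D * ι i * (ι k + ι i * δ))) dδ≈1
           (using-eq (- (φ * - ((x - ι k) * (x + ι (suc k))) * (D * D) * (K * v + 1#))) Kv≈1
           (solve 7 (λ φ D k i j δ v →
             let
               x = :- (i :* δ)
               K = ℕcon 1 :+ k
               c₁ = φ :* (D :* k :+ i)
               c₂ = :- (φ :* i :* (D :* (k :+ ℕcon 1) :- i) :- φ :* D :* i :* (k :+ i :* δ))
               c₃ = :- (φ :* :- ((x :- k) :* (x :+ K)) :* (D :* D) :* (K :* v :+ ℕcon 1))
             in
             φ :* ((D :* k :+ i) :* (D :* k :+ j)) :+ c₁ :* D :+ c₂ :* ℕcon 1 :+ c₃ :* ℕcon 1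
             := φ :* :- ((x :- k) :* (x :+ K)) :* (v :* v) :* (K :* K :* (D :* D))
               :+ c₁ :* (i :+ j) :+ c₂ :* (D :* δ) :+ c₃ :* (K :* v))
             refl φ D (ι k) (ι i) (ι j) δ v))) ⟩
      φ * - ((x - ι k) * (x + ι (suc k))) * (v * v) * (K * K * (D * D)) ∎))))
    where
    x = - (ι i * δ)
    φ = F x k
    D = ι d
    K = ι (suc k)
    v = inv k
    Kv≈1 : K * v ≈ 1#
    Kv≈1 = inv-correct k k<p
    i+j≈d : ι i + ι j ≈ D
    i+j≈d = trans (sym (ι-+ i j)) (reflexive (≡.cong ι i+j≡d))
    unit : K * K * (D * D) * (v * v * (δ * δ)) ≈ 1#
    unit = begin
      K * K * (D * D) * (v * v * (δ * δ))
        ≈⟨ solve 4 (λ K D v δ → K :* K :* (D :* D) :* (v :* v :* (δ :* δ)) := K :* v :* (K :* v) :* (D :* δ :* (D :* δ))) refl K D v δ ⟩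
      K * v * (K * v) * (D * δ * (D * δ))
        ≈⟨ *-cong (*-cong Kv≈1 Kv≈1) (*-cong dδ≈1 dδ≈1) ⟩
      1# * 1# * (1# * 1#)
        ≈⟨ solve 0 (ℕcon 1 :* ℕcon 1 :* (ℕcon 1 :* ℕcon 1) := ℕcon 1) refl ⟩
      1# ∎

  sum-congruence : ∀ e d i j a (N : ℕ → ℕ) (f : ℕ → Carrier) (d⁻¹ : Invertible d) → Invertible (e ℕ.* (d ℕ.* d)) →
    HypergeometricStep e d i j N → N 0 ≡ 1 → i ℕ.+ j ≡ d → p ≡ d ℕ.* a ℕ.+ i → a < p →
    (∀ k → f k * ι ((e ℕ.* (d ℕ.* d)) ℕ.^ k) ≈ ι (N k)) →
    ∑ p (λ k → f k * H k) ≈ₘ sgn a * (ι 2 * (H a + π * proj₁ d⁻¹ * H₂ a))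
  sum-congruence e d i j a N f (δ , dδ≈1) A⁻¹ step N0≡1 i+j≡d p≡da+i a<p f-N = R.trans
    (R.∑-cong p (λ k k<p → R.*-congʳ (F-unique d i j f δ dδ≈1 i+j≡d f0≈1 (step-in-ring e d i j N f A⁻¹ step f-N) k k<p)))
    (S-at-fraction d a i δ (- (ι i * δ)) (≈⇒≈ₘ dδ≈1) p≡da+i a<p (≈⇒≈ₘ dx≈-i))
    where
    f0≈1 : f 0 ≈ 1#
    f0≈1 = begin
      f 0                 ≈⟨ solve 1 (λ f → f := f :* (ℕcon 1 :+ ℕcon 0)) refl (f 0) ⟩
      f 0 * ι 1           ≈⟨ f-N 0 ⟩
      ι (N 0)             ≡⟨ ≡.cong ι N0≡1 ⟩
      ι 1                 ≈⟨ +-identityʳ 1# ⟩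
      1#                  ∎
    dx≈-i : ι d * - (ι i * δ) ≈ - ι i
    dx≈-i = using-eq (- ι i) dδ≈1 (solve 3 (λ d i δ →
      d :* :- (i :* δ) :+ :- i :* ℕcon 1 := :- i :+ :- i :* (d :* δ)) refl (ι d) (ι i) δ)

  -- For d = 2 the correction (π/2) H₂(M) vanishes and only `H M` remains.
  congruence₂ : ∀ (f : ℕ → Carrier) → (∀ k → f k * ι (16 ℕ.^ k) ≈ ι (A₂ k)) →
    ∑ p (λ k → f k * H k) ≈ₘ sgn M * (- ι 4 * L quotient₂)
  congruence₂ f f-N = R.trans
    (sum-congruence 4 2 1 1 M A₂ f invertible₂ (_⊛_ {4} {4} invertible₄ invertible₄) step₂ ≡.refl ≡.refl
      (≡.trans p≡1+2M (lemma M)) M<p f-N)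
    (R.*-congˡ (R.using-eq (ι 2) harmonic-half (R.using-eq (ι 2 * half) πH₂M≈0
      (R.solve 5 (λ q h x g l →
        R.ℕcon 2 R.:* (x R.:+ q R.:* h R.:* g) R.:+ R.ℕcon 2 R.:* (R.:- R.ℕcon 2 R.:* l) R.:+ R.ℕcon 2 R.:* h R.:* R.ℕcon 0
        R.:= R.:- R.ℕcon 4 R.:* l R.:+ R.ℕcon 2 R.:* x R.:+ R.ℕcon 2 R.:* h R.:* (q R.:* g))
        R.refl π half (H M) (H₂ M) (L quotient₂)))))
    where
    lemma : ∀ M → suc (M ℕ.+ M) ≡ 2 ℕ.* M ℕ.+ 1
    lemma = solve-∀

  -- The parity `e` of `M` tells p = 4a+1 from p = 4a+3.
  congruence₄ : ∀ e a → e ℕ.≤ 1 → M ≡ e ℕ.+ (a ℕ.+ a) → (f : ℕ → Carrier) → (∀ k → f k * ι (64 ℕ.^ k) ≈ ι (A₄ k)) →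
    ∑ p (λ k → f k * H k) ≈ₘ sgn a * (- ι 6 * L quotient₂)
  congruence₄ e a e≤1 M≡ f f-N = R.trans (first e e≤1 M≡)
    (R.*-congˡ (R.using-eq 1# (harmonic-quarter a e M≡ e≤1) (R.using-eq (ι 3) harmonic-half
      (R.solve 6 (λ q h x y g l →
        R.ℕcon 2 R.:* (x R.:+ q R.:* (h R.:* h) R.:* g) R.:+ R.ℕcon 1 R.:* (R.ℕcon 3 R.:* y)
          R.:+ R.ℕcon 3 R.:* (R.:- R.ℕcon 2 R.:* l)
        R.:= R.:- R.ℕcon 6 R.:* l R.:+ R.ℕcon 1 R.:* (R.ℕcon 2 R.:* (x R.:+ q R.:* (h R.:* h) R.:* g)) R.:+ R.ℕcon 3 R.:* y)
        R.refl π half (H a) (H M) (H₂ a) (L quotient₂)))))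
    where
    lemma₀ : ∀ a → suc (a ℕ.+ a ℕ.+ (a ℕ.+ a)) ≡ 4 ℕ.* a ℕ.+ 1
    lemma₀ = solve-∀
    lemma₁ : ∀ a → suc (suc (a ℕ.+ a) ℕ.+ suc (a ℕ.+ a)) ≡ 4 ℕ.* a ℕ.+ 3
    lemma₁ = solve-∀
    a<p : a < p
    a<p = ℕ.≤-<-trans (≡.subst (a ℕ.≤_) (≡.sym M≡) (ℕ.≤-trans (ℕ.m≤m+n a a) (ℕ.m≤n+m (a ℕ.+ a) e))) M<p
    invertible₆₄ : Invertible 64
    invertible₆₄ = _⊛_ {4} {16} invertible₄ (_⊛_ {4} {4} invertible₄ invertible₄)
    first : ∀ e → e ℕ.≤ 1 → M ≡ e ℕ.+ (a ℕ.+ a) →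
      ∑ p (λ k → f k * H k) ≈ₘ sgn a * (ι 2 * (H a + π * (half * half) * H₂ a))
    first _ z≤n M≡ = sum-congruence 4 4 1 3 a A₄ f invertible₄ invertible₆₄ step₄ ≡.refl ≡.refl
      (≡.trans p≡1+2M (≡.trans (≡.cong (λ M → suc (M ℕ.+ M)) M≡) (lemma₀ a))) a<p f-N
    first _ (s≤s z≤n) M≡ = sum-congruence 4 4 3 1 a A₄ f invertible₄ invertible₆₄ (HypergeometricStep-swap 4 4 1 3 A₄ step₄) ≡.refl ≡.refl
      (≡.trans p≡1+2M (≡.trans (≡.cong (λ M → suc (M ℕ.+ M)) M≡) (lemma₁ a))) a<p f-N

  -- The hypothesis says M = 3a + 2e, that is p = 6a+1 or p = 6a+5. Then a = ⌊p/6⌋, m = ⌊p/3⌋, and M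
  -- = m + (e + a) is the relation that halving `m` requires.
  module Modulo3 (e e′ a : ℕ) (e+e′≡1 : e ℕ.+ e′ ≡ 1) (M≡ : M ≡ (e ℕ.+ (a ℕ.+ a)) ℕ.+ (e ℕ.+ a)) where

    m : ℕ
    m = e ℕ.+ (a ℕ.+ a)

    private
      p≡ : ∀ e e′ → e ℕ.+ e′ ≡ 1 → let m = e ℕ.+ (a ℕ.+ a) in M ≡ m ℕ.+ (e ℕ.+ a) → p ≡ 3 ℕ.* m ℕ.+ suc e
      p≡ 0 1 ≡.refl M≡ = ≡.trans p≡1+2M (≡.trans (≡.cong (λ M → suc (M ℕ.+ M)) M≡) (lemma a))
        where
        lemma : ∀ a → suc ((a ℕ.+ a) ℕ.+ a ℕ.+ ((a ℕ.+ a) ℕ.+ a)) ≡ 3 ℕ.* (a ℕ.+ a) ℕ.+ 1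
        lemma = solve-∀
      p≡ 1 0 ≡.refl M≡ = ≡.trans p≡1+2M (≡.trans (≡.cong (λ M → suc (M ℕ.+ M)) M≡) (lemma a))
        where
        lemma : ∀ a → suc (suc (a ℕ.+ a) ℕ.+ suc a ℕ.+ (suc (a ℕ.+ a) ℕ.+ suc a)) ≡ 3 ℕ.* suc (a ℕ.+ a) ℕ.+ 2
        lemma = solve-∀

      m<p : m < p
      m<p = ℕ.≤-<-trans (≡.subst (m ℕ.≤_) (≡.sym M≡) (ℕ.m≤m+n m (e ℕ.+ a))) M<p

      a<p : a < p
      a<p = ℕ.≤-<-trans (ℕ.≤-trans (ℕ.m≤m+n a a) (ℕ.m≤n+m (a ℕ.+ a) e)) m<p

      e≤1 : e ℕ.≤ 1
      e≤1 = ℕ.≤-trans (ℕ.m≤m+n e e′) (ℕ.≤-reflexive e+e′≡1)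

    p≡3m+1+e : p ≡ 3 ℕ.* m ℕ.+ suc e
    p≡3m+1+e = p≡ e e′ e+e′≡1 M≡

    open Base3 m e e′ e+e′≡1 p≡3m+1+e public

    congruence₃ : ∀ (f : ℕ → Carrier) → (∀ k → f k * ι (27 ℕ.^ k) ≈ ι (A₃ k)) →
      ∑ p (λ k → f k * H k) ≈ₘ sgn m * (- ι 3 * L quotient₃)
    congruence₃ f f-N = R.trans (first e e′ e+e′≡1 p≡3m+1+e) (R.*-congˡ harmonic-third)
      where
      invertible₂₇ : Invertible 27
      invertible₂₇ = _⊛_ {3} {9} invertible₃ (_⊛_ {3} {3} invertible₃ invertible₃)
      first : ∀ e e′ → e ℕ.+ e′ ≡ 1 → p ≡ 3 ℕ.* m ℕ.+ suc e →
        ∑ p (λ k → f k * H k) ≈ₘ sgn m * (ι 2 * (H m + π * third * H₂ m))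
      first 0 1 ≡.refl p≡ = sum-congruence 3 3 1 2 m A₃ f invertible₃ invertible₂₇ step₃ ≡.refl ≡.refl p≡ m<p f-N
      first 1 0 ≡.refl p≡ = sum-congruence 3 3 2 1 m A₃ f invertible₃ invertible₂₇ (HypergeometricStep-swap 3 3 1 2 A₃ step₃)
        ≡.refl ≡.refl p≡ m<p f-N

    -- Twice `harmonic-sixth`: the term at m gives -3 L(q₃), and 2 H_M gives -4 L(q₂).
    congruence₆ : ∀ (f : ℕ → Carrier) → (∀ k → f k * ι (432 ℕ.^ k) ≈ ι (A₆ k)) →
      ∑ p (λ k → f k * H k) ≈ₘ sgn a * (- ι 3 * L quotient₃ - ι 4 * L quotient₂)
    congruence₆ f f-N = R.trans (first e e′ e+e′≡1 p≡3m+1+e)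
      (R.*-congˡ (R.using-eq (ι 2) (harmonic-sixth a e m ≡.refl e≤1 (≡.sym M≡))
        (R.using-eq 1# harmonic-third (R.using-eq (ι 2) harmonic-half
        (R.solve 7 (λ x y z q g l l′ →
          R.ℕcon 2 R.:* x R.:+ R.ℕcon 2 R.:* (y R.:+ z) R.:+ R.ℕcon 1 R.:* (R.:- R.ℕcon 3 R.:* l′) R.:+ R.ℕcon 2 R.:* (R.:- R.ℕcon 2 R.:* l)
          R.:= R.:- R.ℕcon 3 R.:* l′ R.:- R.ℕcon 4 R.:* l R.:+ R.ℕcon 2 R.:* x R.:+ R.ℕcon 1 R.:* (R.ℕcon 2 R.:* y) R.:+ R.ℕcon 2 R.:* z)
          R.refl (H a + π * (half * third) * H₂ a) (H m + π * third * H₂ m) (H M) π half (L quotient₂) (L quotient₃))))))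
      where
      invertible₄₃₂ : Invertible 432
      invertible₄₃₂ = _⊛_ {12} {36} (_⊛_ {4} {3} invertible₄ invertible₃) (_⊛_ {6} {6} invertible₆ invertible₆)
      first : ∀ e e′ → e ℕ.+ e′ ≡ 1 → p ≡ 3 ℕ.* (e ℕ.+ (a ℕ.+ a)) ℕ.+ suc e →
        ∑ p (λ k → f k * H k) ≈ₘ sgn a * (ι 2 * (H a + π * (half * third) * H₂ a))
      first 0 1 ≡.refl p≡ = sum-congruence 12 6 1 5 a A₆ f invertible₆ invertible₄₃₂ step₆ ≡.refl ≡.refl
        (≡.trans p≡ (lemma a)) a<p f-N
        where
        lemma : ∀ a → 3 ℕ.* (a ℕ.+ a) ℕ.+ 1 ≡ 6 ℕ.* a ℕ.+ 1
        lemma = solve-∀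
      first 1 0 ≡.refl p≡ = sum-congruence 12 6 5 1 a A₆ f invertible₆ invertible₄₃₂ (HypergeometricStep-swap 12 6 1 5 A₆ step₆) ≡.refl ≡.refl
        (≡.trans p≡ (lemma a)) a<p f-N
        where
        lemma : ∀ a → 3 ℕ.* suc (a ℕ.+ a) ℕ.+ 2 ≡ 6 ℕ.* a ℕ.+ 5
        lemma = solve-∀

-- Moving the sign across and expanding the truncated logarithm.

module SignedSums {c ℓ} (B : CommutativeRing c ℓ) (p M : ℕ) (p≡1+2M : p ≡ suc (M ℕ.+ M)) (3<p : 3 < p)
  (inv : ℕ → CommutativeRing.Carrier B) (inv-correct : RingLemmas.InvertsBelow B p inv) where

  open RingLemmas B
  open Quotient B (ι p * ι p)
  open FermatQuotients B p M p≡1+2M 3<p inv inv-correct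
  private
    module R = RingLemmas quotient

  signed : ∀ a x y z → x ≈ₘ sgn a * y → y ≈ₘ z → sgn a * x ≈ₘ z
  signed a x y z x≈ y≈z = R.using-eq (sgn a) x≈ (R.using-eq y (R.trans (R.sym (R.^-+ (- 1#) a a)) (R.sgn-even a)) (R.using-eq 1# y≈z
    (R.solve 4 (λ s x y z → s R.:* x R.:+ s R.:* (s R.:* y) R.:+ y R.:* R.ℕcon 1 R.:+ R.ℕcon 1 R.:* z
      R.:= z R.:+ s R.:* x R.:+ y R.:* (s R.:* s) R.:+ R.ℕcon 1 R.:* y) R.refl (sgn a) x y z)))

  expand₂ : ∀ q → - ι 4 * L q ≈ₘ - ι 4 * q + ι 2 * π * (q * q)
  expand₂ q = R.using-eq (ι 2 * π * (q * q)) half-correct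
    (R.solve 3 (λ h π q →
      R.:- R.ℕcon 4 R.:* (q R.:- h R.:* π R.:* (q R.:* q)) R.:+ R.ℕcon 2 R.:* π R.:* (q R.:* q) R.:* R.ℕcon 1
      R.:= R.:- R.ℕcon 4 R.:* q R.:+ R.ℕcon 2 R.:* π R.:* (q R.:* q) R.:+ R.ℕcon 2 R.:* π R.:* (q R.:* q) R.:* (R.ℕcon 2 R.:* h))
      R.refl half π q)

  expand₄ : ∀ q → - ι 6 * L q ≈ₘ - ι 6 * q + ι 3 * π * (q * q)
  expand₄ q = R.using-eq (ι 3 * π * (q * q)) half-correct
    (R.solve 3 (λ h π q →
      R.:- R.ℕcon 6 R.:* (q R.:- h R.:* π R.:* (q R.:* q)) R.:+ R.ℕcon 3 R.:* π R.:* (q R.:* q) R.:* R.ℕcon 1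
      R.:= R.:- R.ℕcon 6 R.:* q R.:+ R.ℕcon 3 R.:* π R.:* (q R.:* q) R.:+ R.ℕcon 3 R.:* π R.:* (q R.:* q) R.:* (R.ℕcon 2 R.:* h))
      R.refl half π q)

  -- `t` stands for 3/2, kept abstract so that it can later be the rational number of the theorem
  -- and not three times `half`.
  expand₃ : ∀ t q → t * ι 2 ≈ₘ ι 3 → - ι 3 * L q ≈ₘ - ι 3 * q + t * π * (q * q)
  expand₃ t q 2t≈3 = R.using-eq (t * π * (q * q)) half-correct (R.using-eq (- half * π * (q * q)) 2t≈3
    (R.solve 4 (λ h π q t →
      R.:- R.ℕcon 3 R.:* (q R.:- h R.:* π R.:* (q R.:* q)) R.:+ t R.:* π R.:* (q R.:* q) R.:* R.ℕcon 1
        R.:+ R.:- h R.:* π R.:* (q R.:* q) R.:* R.ℕcon 3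
      R.:= R.:- R.ℕcon 3 R.:* q R.:+ t R.:* π R.:* (q R.:* q) R.:+ t R.:* π R.:* (q R.:* q) R.:* (R.ℕcon 2 R.:* h)
        R.:+ R.:- h R.:* π R.:* (q R.:* q) R.:* (t R.:* R.ℕcon 2))
      R.refl half π q t))

  expand₆ : ∀ t q r → t * ι 2 ≈ₘ ι 3 → - ι 3 * L q - ι 4 * L r ≈ₘ - ι 3 * q - ι 4 * r + π * (t * (q * q) + ι 2 * (r * r))
  expand₆ t q r 2t≈3 = R.using-eq 1# (expand₃ t q 2t≈3) (R.using-eq 1# (expand₂ r)
    (R.solve 6 (λ t π q r l l′ →
      R.:- R.ℕcon 3 R.:* l R.:- R.ℕcon 4 R.:* l′ R.:+ R.ℕcon 1 R.:* (R.:- R.ℕcon 3 R.:* q R.:+ t R.:* π R.:* (q R.:* q))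
        R.:+ R.ℕcon 1 R.:* (R.:- R.ℕcon 4 R.:* r R.:+ R.ℕcon 2 R.:* π R.:* (r R.:* r))
      R.:= R.:- R.ℕcon 3 R.:* q R.:- R.ℕcon 4 R.:* r R.:+ π R.:* (t R.:* (q R.:* q) R.:+ R.ℕcon 2 R.:* (r R.:* r))
        R.:+ R.ℕcon 1 R.:* (R.:- R.ℕcon 3 R.:* l) R.:+ R.ℕcon 1 R.:* (R.:- R.ℕcon 4 R.:* l′))
      R.refl t π q r (L q) (L r)))

-- Rational numbers and the ring of p-local integers.

open import Defs

module ℚ-Ring = RingLemmas ℚ.+-*-commutativeRing

toℚᵘ-/ : ∀ i n → toℚᵘ (i ℚ./ suc n) ℚᵘ.≃ mkℚᵘ i n
toℚᵘ-/ i n = ℚ.toℚᵘ-fromℚᵘ (mkℚᵘ i n)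

/1-+ : ∀ i j → (i ℤ.+ j) ℚ./ 1 ≡ i ℚ./ 1 ℚ.+ j ℚ./ 1
/1-+ i j = ℚ.toℚᵘ-injective (ℚᵘ.≃-trans (toℚᵘ-/ (i ℤ.+ j) 0) (ℚᵘ.≃-trans (*≡* (eq i j))
  (ℚᵘ.≃-sym (ℚᵘ.≃-trans (ℚ.toℚᵘ-homo-+ (i ℚ./ 1) (j ℚ./ 1)) (ℚᵘ.+-cong (toℚᵘ-/ i 0) (toℚᵘ-/ j 0))))))
  where
  eq : ∀ i j → (i ℤ.+ j) ℤ.* 1ℤ ≡ (i ℤ.* 1ℤ ℤ.+ j ℤ.* 1ℤ) ℤ.* 1ℤ
  eq = ℤSolver.solve-∀

/-*-cancel : ∀ i n .{{_ : NonZero n}} → i ℚ./ n ℚ.* (+ n ℚ./ 1) ≡ i ℚ./ 1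
/-*-cancel i (suc n) = ℚ.toℚᵘ-injective (ℚᵘ.≃-trans (ℚ.toℚᵘ-homo-* (i ℚ./ suc n) (+ suc n ℚ./ 1))
  (ℚᵘ.≃-trans (ℚᵘ.*-cong (toℚᵘ-/ i n) (toℚᵘ-/ (+ suc n) 0))
  (ℚᵘ.≃-trans (*≡* eq) (ℚᵘ.≃-sym (toℚᵘ-/ i 0)))))
  where
  eq : i ℤ.* + suc n ℤ.* 1ℤ ≡ i ℤ.* + (suc n ℕ.* 1)
  eq = ≡.trans (ℤ.*-identityʳ (i ℤ.* + suc n)) (≡.cong (λ k → i ℤ.* + k) (≡.sym (ℕ.*-identityʳ (suc n))))

/1-ι : ∀ n → + n ℚ./ 1 ≡ ℚ-Ring.ι n
/1-ι zero    = ≡.refl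
/1-ι (suc n) = ≡.trans (/1-+ 1ℤ (+ n)) (≡.cong (1ℚ ℚ.+_) (/1-ι n))

-- `sum` splits off the first term, `∑` the last.
Σ<≡∑ : ∀ n f → Σ< n f ≡ ℚ-Ring.∑ n f
Σ<≡∑ zero    f = ≡.refl
Σ<≡∑ (suc n) f = ≡.trans (≡.cong (f 0 ℚ.+_) (Σ<≡∑ n (λ k → f (suc k)))) (≡.sym (ℚ-Ring.∑-head n f))

∤⇒coprime : ∀ {n p} → Prime p → ¬ p ∣ n → Coprime n p
∤⇒coprime pr p∤n (d∣n , d∣p) with prime⇒irreducible pr d∣p
... | inj₁ d≡1 = d≡1
... | inj₂ ≡.refl = contradiction d∣n p∤n

prime∤1 : ∀ {p} → Prime p → ¬ p ∣ 1
prime∤1 {p} pr p∣1 = ℕ.nonTrivial⇒≢1 {{prime⇒nonTrivial pr}} (∣1⇒≡1 p∣1)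

prime∤* : ∀ {p} → Prime p → ∀ m n → ¬ p ∣ m → ¬ p ∣ n → ¬ p ∣ m ℕ.* n
prime∤* pr m n p∤m p∤n p∣mn with euclidsLemma m n pr p∣mn
... | inj₁ p∣m = p∤m p∣m
... | inj₂ p∣n = p∤n p∣n

prime∤^ : ∀ {p} → Prime p → ∀ m k → ¬ p ∣ m → ¬ p ∣ m ℕ.^ k
prime∤^ pr m zero    p∤m = prime∤1 pr
prime∤^ pr m (suc k) p∤m = prime∤* pr m (m ℕ.^ k) p∤m (prime∤^ pr m k p∤m)

module LocalRing (p : ℕ) (pr : Prime p) where

  -- The reduced denominator divides any unreduced one `n`; `g` is the factor lost in the reduction.
  -- Thus a sum or product is judged by the product of the denominators.
  ∈-by-multiple : ∀ x n g → ↧ x ℤ.* g ≡ + n → ¬ p ∣ n → x ∈ℤ₍ p ₎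
  ∈-by-multiple x n g eq p∤n = ∤⇒coprime pr (λ p∣↧x → p∤n (∣-trans p∣↧x (divides ∣ g ∣
    (≡.trans (≡.cong ∣_∣ (≡.sym eq)) (≡.trans (ℤ.abs-* (↧ x) g) (ℕ.*-comm (↧ₙ x) ∣ g ∣))))))

  p∤↧ : ∀ x → x ∈ℤ₍ p ₎ → ¬ p ∣ ↧ₙ x
  p∤↧ x x∈ p∣↧x = ℕ.nonTrivial⇒≢1 {{prime⇒nonTrivial pr}} (x∈ (p∣↧x , ∣-refl))

  /-∈ : ∀ i n .{{_ : NonZero n}} → ¬ p ∣ n → i ℚ./ n ∈ℤ₍ p ₎
  /-∈ i n p∤n = ∈-by-multiple (i ℚ./ n) n _ (ℚ.↧-/ i n) p∤n

  +-∈ : ∀ x y → x ∈ℤ₍ p ₎ → y ∈ℤ₍ p ₎ → x ℚ.+ y ∈ℤ₍ p ₎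
  +-∈ x y x∈ y∈ = ∈-by-multiple (x ℚ.+ y) (↧ₙ x ℕ.* ↧ₙ y) _ (≡.trans (ℚ.↧-+ x y) (≡.sym (ℤ.pos-* (↧ₙ x) (↧ₙ y))))
    (prime∤* pr (↧ₙ x) (↧ₙ y) (p∤↧ x x∈) (p∤↧ y y∈))

  *-∈ : ∀ x y → x ∈ℤ₍ p ₎ → y ∈ℤ₍ p ₎ → x ℚ.* y ∈ℤ₍ p ₎
  *-∈ x y x∈ y∈ = ∈-by-multiple (x ℚ.* y) (↧ₙ x ℕ.* ↧ₙ y) _ (≡.trans (ℚ.↧-* x y) (≡.sym (ℤ.pos-* (↧ₙ x) (↧ₙ y))))
    (prime∤* pr (↧ₙ x) (↧ₙ y) (p∤↧ x x∈) (p∤↧ y y∈))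

  neg-∈ : ∀ x → x ∈ℤ₍ p ₎ → ℚ.- x ∈ℤ₍ p ₎
  neg-∈ x x∈ = ≡.subst (λ d → Coprime d p) (≡.sym (≡.cong ∣_∣ (ℚ.↧-neg x))) x∈

  ℤ₍ₚ₎ : Set
  ℤ₍ₚ₎ = Σ[ x ∈ ℚ ] x ∈ℤ₍ p ₎

  -- Equality ignores the membership proofs, so all ring laws are inherited from ℚ.
  localRing : CommutativeRing 0ℓ 0ℓ
  localRing = record
    { Carrier = ℤ₍ₚ₎
    ; _≈_     = λ x y → proj₁ x ≡ proj₁ y
    ; _+_     = λ x y → proj₁ x ℚ.+ proj₁ y , +-∈ (proj₁ x) (proj₁ y) (proj₂ x) (proj₂ y)
    ; _*_     = λ x y → proj₁ x ℚ.* proj₁ y , *-∈ (proj₁ x) (proj₁ y) (proj₂ x) (proj₂ y)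
    ; -_      = λ x → ℚ.- proj₁ x , neg-∈ (proj₁ x) (proj₂ x)
    ; 0#      = 0ℚ , /-∈ 0ℤ 1 (prime∤1 pr)
    ; 1#      = 1ℚ , /-∈ 1ℤ 1 (prime∤1 pr)
    ; isCommutativeRing = record
      { isRing = record
        { +-isAbelianGroup = record
          { isGroup = record
            { isMonoid = record
              { isSemigroup = record
                { isMagma = record
                  { isEquivalence = On.isEquivalence proj₁ ≡.isEquivalence
                  ; ∙-cong = ≡.cong₂ ℚ._+_
                  }
                ; assoc = λ x y z → ℚ.+-assoc (proj₁ x) (proj₁ y) (proj₁ z)
                }
              ; identity = (λ x → ℚ.+-identityˡ (proj₁ x)) , (λ x → ℚ.+-identityʳ (proj₁ x))
              }
            ; inverse = (λ x → ℚ.+-inverseˡ (proj₁ x)) , (λ x → ℚ.+-inverseʳ (proj₁ x))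
            ; ⁻¹-cong = ≡.cong (λ x → ℚ.- x)
            }
          ; comm = λ x y → ℚ.+-comm (proj₁ x) (proj₁ y)
          }
        ; *-cong = ≡.cong₂ ℚ._*_
        ; *-assoc    = λ x y z → ℚ.*-assoc (proj₁ x) (proj₁ y) (proj₁ z)
        ; *-identity = (λ x → ℚ.*-identityˡ (proj₁ x)) , (λ x → ℚ.*-identityʳ (proj₁ x))
        ; distrib    = (λ x y z → ℚ.*-distribˡ-+ (proj₁ x) (proj₁ y) (proj₁ z))
                     , (λ x y z → ℚ.*-distribʳ-+ (proj₁ x) (proj₁ y) (proj₁ z))
        }
      ; *-comm = λ x y → ℚ.*-comm (proj₁ x) (proj₁ y)
      }
    }

  open RingLemmas localRing public
  open Quotient localRing (ι p * ι p) public

  value-ι : ∀ n → proj₁ (ι n) ≡ + n ℚ./ 1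
  value-ι n = ≡.trans (lemma n) (≡.sym (/1-ι n))
    where
    lemma : ∀ n → proj₁ (ι n) ≡ ℚ-Ring.ι n
    lemma zero    = ≡.refl
    lemma (suc n) = ≡.cong (1ℚ ℚ.+_) (lemma n)

  value-∑ : ∀ n f → proj₁ (∑ n f) ≡ ℚ-Ring.∑ n (λ k → proj₁ (f k))
  value-∑ zero    f = ≡.refl
  value-∑ (suc n) f = ≡.cong (ℚ._+ proj₁ (f n)) (value-∑ n f)

  -- The junk value 0 at multiples of p makes the inverses a total function.
  inv : ℕ → ℤ₍ₚ₎
  inv j with p ∣? suc j
  ... | yes _   = 0#
  ... | no p∤1+j = 1ℤ ℚ./ suc j , /-∈ 1ℤ (suc j) p∤1+j

  value-inv : ∀ j → suc j < p → proj₁ (inv j) ≡ 1ℤ ℚ./ suc j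
  value-inv j j<p with p ∣? suc j
  ... | yes p∣1+j = contradiction p∣1+j (>⇒∤ j<p)
  ... | no _      = ≡.refl

  inv-correct : InvertsBelow p inv
  inv-correct j j<p = ≡.trans (≡.cong₂ ℚ._*_ (value-ι (suc j)) (value-inv j j<p))
    (≡.trans (ℚ.*-comm (+ suc j ℚ./ 1) (1ℤ ℚ./ suc j)) (/-*-cancel 1ℤ (suc j)))

  ≈ₘ⇒≋ : ∀ {x y} → x ≈ₘ y → proj₁ x ≋ proj₁ y [mod p ℕ.^ 2 ]∈ℤ₍ p ₎
  ≈ₘ⇒≋ {x} {y} (z , x-y≡p²z) = proj₂ x , proj₂ y , proj₁ z , proj₂ z ,
    ≡.trans x-y≡p²z (≡.cong (ℚ._* proj₁ z) p²)
    where
    p² : proj₁ (ι p * ι p) ≡ + (p ℕ.^ 2) ℚ./ 1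
    p² = ≡.trans (≡.sym (ι-* p p)) (≡.trans (value-ι (p ℕ.* p))
      (≡.cong (λ n → + n ℚ./ 1) (≡.cong (p ℕ.*_) (≡.sym (ℕ.*-identityʳ p)))))

-- Monic polynomials and their roots.

module MonicPolynomials {c ℓ} (R : CommutativeRing c ℓ) where

  open RingLemmas R

  -- The coefficients below the leading term, in increasing degree.
  eval : ∀ {n} → Vec Carrier n → Carrier → Carrier
  eval []       x = 1#
  eval (c ∷ cs) x = c + x * eval cs x

  -- Synthetic division by X - a: the quotient's coefficients are the intermediate values of
  -- Horner's scheme at `a`.
  divide : ∀ {n} → Carrier → Vec Carrier (suc n) → Vec Carrier n
  divide a (c ∷ [])         = []
  divide a (c ∷ cs@(_ ∷ _)) = eval cs a ∷ divide a cs

  eval-divide : ∀ {n} a (cs : Vec Carrier (suc n)) x → eval cs x ≈ eval cs a + (x - a) * eval (divide a cs) x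
  eval-divide a (c ∷ [])         x = solve 3 (λ c a x → c :+ x :* ℕcon 1 := c :+ a :* ℕcon 1 :+ (x :- a) :* ℕcon 1) refl c a x
  eval-divide a (c ∷ cs@(_ ∷ _)) x = trans (+-congˡ (*-congˡ (eval-divide a cs x)))
    (solve 5 (λ c a x e q → c :+ x :* (e :+ (x :- a) :* q) := c :+ a :* e :+ (x :- a) :* (e :+ x :* q))
      refl c a x (eval cs a) (eval (divide a cs) x))

  -- The last root splits off a linear factor. The earlier roots stay roots of the quotient because
  -- their differences from the last one can be cancelled.
  roots-determine : ∀ n (cs : Vec Carrier n) (y : ℕ → Carrier) → (∀ i → i < n → eval cs (y i) ≈ 0#) →
    (∀ i j → i < j → j < n → ∀ z → (y i - y j) * z ≈ 0# → z ≈ 0#) → ∀ x → eval cs x ≈ ∏ n (λ i → x - y i)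
  roots-determine zero    []       y root distinct x = refl
  roots-determine (suc n) cs y root distinct x = begin
    eval cs x                                                     ≈⟨ eval-divide (y n) cs x ⟩
    eval cs (y n) + (x - y n) * eval (divide (y n) cs) x          ≈⟨ trans (+-congʳ (root n ℕ.≤-refl)) (+-identityˡ _) ⟩
    (x - y n) * eval (divide (y n) cs) x                          ≈⟨ *-comm _ _ ⟩
    eval (divide (y n) cs) x * (x - y n)                          ≈⟨ *-congʳ (roots-determine n (divide (y n) cs) y root′
                                                                       (λ i j i<j j<n → distinct i j i<j (ℕ.m<n⇒m<1+n j<n)) x) ⟩
    ∏ n (λ i → x - y i) * (x - y n)                               ∎
    where
    root′ : ∀ i → i < n → eval (divide (y n) cs) (y i) ≈ 0#
    root′ i i<n = distinct i n i<n ℕ.≤-refl _ (begin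
      (y i - y n) * eval (divide (y n) cs) (y i)                    ≈⟨ trans (+-congʳ (root n ℕ.≤-refl)) (+-identityˡ _) ⟨
      eval cs (y n) + (y i - y n) * eval (divide (y n) cs) (y i)    ≈⟨ eval-divide (y n) cs (y i) ⟨
      eval cs (y i)                                                 ≈⟨ root i (ℕ.m<n⇒m<1+n i<n) ⟩
      0#                                                            ∎)

  eval-zeros : ∀ n x → eval (replicate n 0#) x ≈ x ^ n
  eval-zeros zero    x = refl
  eval-zeros (suc n) x = trans (+-identityˡ _) (trans (*-comm _ _) (*-congʳ (eval-zeros n x)))

-- Fermat's little theorem, Euler's criterion and the quadratic character of -2.

module PrimeField {r ℓ} (R : CommutativeRing r ℓ) (p : ℕ) (pr : Prime p) (M : ℕ) (p≡1+2M : p ≡ suc (M ℕ.+ M)) (2<p : 2 < p)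
  (characteristic : ∀ n → p ∣ n → CommutativeRing._≈_ R (RingLemmas.ι R n) (CommutativeRing.0# R))
  (ι≈0⇒∣ : ∀ n → CommutativeRing._≈_ R (RingLemmas.ι R n) (CommutativeRing.0# R) → p ∣ n)
  (domain : RingLemmas.NoZeroDivisors R) where

  open RingLemmas R
  open MonicPolynomials R

  ι-cancel : ∀ n z → ¬ p ∣ n → ι n * z ≈ 0# → z ≈ 0#
  ι-cancel n z p∤n nz≈0 with domain (ι n) z nz≈0
  ... | inj₁ n≈0 = contradiction (ι≈0⇒∣ n n≈0) p∤n
  ... | inj₂ z≈0 = z≈0

  1≉0 : ¬ 1# ≈ 0#
  1≉0 1≈0 = contradiction (ι≈0⇒∣ 1 (trans (+-identityʳ 1#) 1≈0)) (prime∤1 pr)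

  ∏≈0 : ∀ n f → ∏ n f ≈ 0# → ∃[ i ] (i < n × f i ≈ 0#)
  ∏≈0 zero    f 1≈0 = contradiction 1≈0 1≉0
  ∏≈0 (suc n) f ∏≈0′ with domain (∏ n f) (f n) ∏≈0′
  ... | inj₂ fn≈0 = n , ℕ.≤-refl , fn≈0
  ... | inj₁ ∏n≈0 with ∏≈0 n f ∏n≈0
  ...   | i , i<n , fi≈0 = i , ℕ.m<n⇒m<1+n i<n , fi≈0

  -- The binomial theorem; the factor `y` absorbs one 1 + x at each step of the recursion.
  binomialSum-power : ∀ n x y → binomialSum n (λ k → x ^ k * y) ≈ (1# + x) ^ n * y
  binomialSum-power zero    x y = refl
  binomialSum-power (suc n) x y = begin
    binomialSum n (λ k → x ^ k * y + x ^ k * x * y)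
      ≈⟨ binomialSum-cong n (λ k _ → solve 3 (λ a x y → a :* y :+ a :* x :* y := a :* ((ℕcon 1 :+ x) :* y)) refl (x ^ k) x y) ⟩
    binomialSum n (λ k → x ^ k * ((1# + x) * y))
      ≈⟨ binomialSum-power n x ((1# + x) * y) ⟩
    (1# + x) ^ n * ((1# + x) * y)
      ≈⟨ sym (*-assoc _ _ _) ⟩
    (1# + x) ^ suc n * y ∎

  p∣C : ∀ k → k < M ℕ.+ M → p ∣ (p C suc k)
  p∣C k k<p-1 with euclidsLemma (suc k) (p C suc k) pr (divides ((M ℕ.+ M) C k) (k*C≡C*p p≡1+2M))
    where
    k*C≡C*p : p ≡ suc (M ℕ.+ M) → suc k ℕ.* (p C suc k) ≡ ((M ℕ.+ M) C k) ℕ.* p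
    k*C≡C*p ≡.refl = ≡.trans (absorption (M ℕ.+ M) k) (ℕ.*-comm (suc (M ℕ.+ M)) ((M ℕ.+ M) C k))
  ... | inj₁ p∣1+k = contradiction p∣1+k (>⇒∤ (≡.subst (suc k <_) (≡.sym p≡1+2M) (s≤s k<p-1)))
  ... | inj₂ p∣C   = p∣C

  frobenius : ∀ x → (1# + x) ^ p ≈ 1# + x ^ p
  frobenius x = begin
    (1# + x) ^ p
      ≈⟨ trans (sym (*-identityʳ _)) (sym (binomialSum-power p x 1#)) ⟩
    binomialSum p (λ k → x ^ k * 1#)
      ≈⟨ binomialSum-expand p (suc p) _ (ℕ.n<1+n p) ⟩
    ∑ p term + ι (p C p) * (x ^ p * 1#)
      ≈⟨ +-cong (trans (reflexive (≡.cong (λ n → ∑ n term) p≡1+2M)) (∑-head (M ℕ.+ M) term))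
           (*-congʳ (reflexive (≡.cong ι (nCn≡1 p)))) ⟩
    ι (p C 0) * (1# * 1#) + ∑ (M ℕ.+ M) (λ k → ι (p C suc k) * (x ^ suc k * 1#)) + ι 1 * (x ^ p * 1#)
      ≈⟨ +-congʳ (+-congˡ (∑-zero (M ℕ.+ M) (λ k k<2M → trans (*-congʳ (characteristic (p C suc k) (p∣C k k<2M))) (zeroˡ _)))) ⟩
    ι 1 * (1# * 1#) + 0# + ι 1 * (x ^ p * 1#)
      ≈⟨ solve 1 (λ y → (ℕcon 1 :+ ℕcon 0) :* (ℕcon 1 :* ℕcon 1) :+ ℕcon 0 :+ (ℕcon 1 :+ ℕcon 0) :* (y :* ℕcon 1) := ℕcon 1 :+ y)
           refl (x ^ p) ⟩
    1# + x ^ p ∎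
    where
    term = λ k → ι (p C k) * (x ^ k * 1#)

  fermat : ∀ n → ι n ^ p ≈ ι n
  fermat zero    = trans (reflexive (≡.cong (0# ^_) p≡1+2M)) (zeroʳ _)
  fermat (suc n) = trans (frobenius (ι n)) (+-congˡ (fermat n))

  fermat-unit : ∀ n → ¬ p ∣ n → ι n ^ (M ℕ.+ M) ≈ 1#
  fermat-unit n p∤n = using-eq 1# (ι-cancel n (ι n ^ (M ℕ.+ M) - 1#) p∤n
    (using-eq 1# (trans (reflexive (≡.cong (ι n ^_) (≡.sym p≡1+2M))) (fermat n))
      (solve 2 (λ n x → n :* (x :- ℕcon 1) :+ ℕcon 1 :* n := ℕcon 0 :+ ℕcon 1 :* (x :* n)) refl (ι n) (ι n ^ (M ℕ.+ M)))))
    (solve 1 (λ x → x :+ ℕcon 1 :* ℕcon 0 := ℕcon 1 :+ ℕcon 1 :* (x :- ℕcon 1)) refl (ι n ^ (M ℕ.+ M)))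

  below : ∀ {n} → n < M ℕ.+ M → ¬ p ∣ suc n
  below n<2M = >⇒∤ (≡.subst (_ <_) (≡.sym p≡1+2M) (s≤s n<2M))

  sq : ℕ → Carrier
  sq i = ι (suc i) * ι (suc i)

  -- The difference of squares is -(j-i)(i+j+2), and both factors lie strictly between 0 and p.
  sq-distinct : ∀ i j → i < j → j < M → ∀ z → (sq i - sq j) * z ≈ 0# → z ≈ 0#
  sq-distinct i j i<j j<M z eq = ι-cancel (suc k) z (below (ℕ.<-≤-trans k<M (ℕ.m≤m+n M M)))
      (ι-cancel (suc (suc (i ℕ.+ j))) (ι (suc k) * z) (below (≡.subst (_< M ℕ.+ M) (ℕ.+-suc i j) (ℕ.+-mono-<-≤ (ℕ.<-trans i<j j<M) j<M)))
      (using-eq (- 1#) eq (using-eq c j≈ (using-eq (ι (suc k) * z) (ι-+ i j)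
        (solve 5 (λ i j k z s →
          let c = :- (z :* ((ℕcon 1 :+ i) :+ (ℕcon 1 :+ j))) in
          (ℕcon 1 :+ (ℕcon 1 :+ s)) :* ((ℕcon 1 :+ k) :* z) :+ :- ℕcon 1 :* ℕcon 0 :+ c :* (i :+ (ℕcon 1 :+ k))
            :+ (ℕcon 1 :+ k) :* z :* (i :+ j)
          := ℕcon 0 :+ :- ℕcon 1 :* (((ℕcon 1 :+ i) :* (ℕcon 1 :+ i) :- (ℕcon 1 :+ j) :* (ℕcon 1 :+ j)) :* z)
            :+ c :* j :+ (ℕcon 1 :+ k) :* z :* s) refl (ι i) (ι j) (ι k) z (ι (i ℕ.+ j)))))))
      where
      k = j ℕ.∸ suc i
      c = - (z * (ι (suc i) + ι (suc j)))
      i+k≡j : i ℕ.+ suc k ≡ j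
      i+k≡j = ≡.trans (ℕ.+-suc i k) (ℕ.m+[n∸m]≡n i<j)
      k<M : k < M
      k<M = ℕ.≤-<-trans (ℕ.m∸n≤m j (suc i)) j<M
      j≈ : ι j ≈ ι i + ι (suc k)
      j≈ = trans (reflexive (≡.cong ι (≡.sym i+k≡j))) (ι-+ i (suc k))

  M>0 : 0 < M
  M>0 = positive M p≡1+2M
    where
    positive : ∀ M → p ≡ suc (M ℕ.+ M) → 0 < M
    positive zero    p≡1 = contradiction (≡.subst (2 <_) p≡1 2<p) (λ { (s≤s ()) })
    positive (suc M) _   = s≤s z≤n

  ^-distrib : ∀ n x y → (x * y) ^ n ≈ x ^ n * y ^ n
  ^-distrib n x y = ∏-* n (λ _ → x) (λ _ → y)

  ^-cong : ∀ n {x y} → x ≈ y → x ^ n ≈ y ^ n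
  ^-cong n x≈y = ∏-cong n (λ _ _ → x≈y)

  sq^M≈1 : ∀ i → i < M → sq i ^ M ≈ 1#
  sq^M≈1 i i<M = trans (^-distrib M (ι (suc i)) (ι (suc i))) (trans (sym (^-+ (ι (suc i)) M M))
    (fermat-unit (suc i) (below (ℕ.<-≤-trans i<M (ℕ.m≤m+n M M)))))

  -- The squares 1, 4, …, M² are M distinct roots of X^M - 1.
  ^M-1-factors : ∀ x → x ^ M - 1# ≈ ∏ M (λ i → x - sq i)
  ^M-1-factors = factors M M>0 (λ i j i<j j<M → sq-distinct i j i<j j<M) sq^M≈1
    where
    -- `M` is generalised so that it can be matched as a successor: the coefficient vector of X^M -
    -- 1 starts with its constant term -1.
    factors : ∀ M → 0 < M → (∀ i j → i < j → j < M → ∀ z → (sq i - sq j) * z ≈ 0# → z ≈ 0#) →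
      (∀ i → i < M → sq i ^ M ≈ 1#) → ∀ x → x ^ M - 1# ≈ ∏ M (λ i → x - sq i)
    factors (suc n) _ distinct root x = trans (sym (value x)) (roots-determine (suc n) cs sq
      (λ i i<M → trans (value (sq i)) (trans (+-congʳ (root i i<M)) (-‿inverseʳ 1#))) distinct x)
      where
      cs = - 1# ∷ replicate n 0#
      value : ∀ x → eval cs x ≈ x ^ suc n - 1#
      value x = trans (+-congˡ (*-congˡ (eval-zeros n x)))
        (solve 2 (λ x a → :- ℕcon 1 :+ x :* a := a :* x :- ℕcon 1) refl x (x ^ n))

  -- At such a `c` the factored X^M - 1 vanishes, hence so does one factor c - (i+1)².
  euler-square : ∀ c → c ^ M ≈ 1# → ∃[ i ] (i < M × ι (suc i) * ι (suc i) ≈ c)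
  euler-square c c^M≈1 = root (∏≈0 M (λ i → c - sq i) (begin
      ∏ M (λ i → c - sq i)    ≈⟨ ^M-1-factors c ⟨
      c ^ M - 1#             ≈⟨ +-congʳ c^M≈1 ⟩
      1# - 1#                ≈⟨ -‿inverseʳ 1# ⟩
      0#                     ∎))
    where
    root : ∃[ i ] (i < M × c - sq i ≈ 0#) → ∃[ i ] (i < M × ι (suc i) * ι (suc i) ≈ c)
    root (i , i<M , c-yi≈0) = i , i<M , using-eq (- 1#) c-yi≈0
      (solve 2 (λ c y → y :+ :- ℕcon 1 :* ℕcon 0 := c :+ :- ℕcon 1 :* (c :- y)) refl c (sq i))

  ^M-unit : ∀ c a → c ^ M ≈ sgn a → ¬ c ≈ 0#
  ^M-unit c a c^M≈ c≈0 = 1≉0 (begin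
    1#                ≈⟨ sgn-even a ⟨
    sgn (a ℕ.+ a)     ≈⟨ ^-+ (- 1#) a a ⟩
    sgn a * sgn a     ≈⟨ *-congʳ (trans (sym c^M≈) (c^≈0 M M>0)) ⟩
    0# * sgn a        ≈⟨ zeroˡ _ ⟩
    0#                ∎)
    where
    c^≈0 : ∀ n → 0 < n → c ^ n ≈ 0#
    c^≈0 (suc n) _ = trans (*-congˡ c≈0) (zeroʳ _)

  -- Otherwise c^M = n^(p-1) = 1 by Fermat, so 1 = -1 and p divides 2.
  euler-nonsquare : ∀ c n → c ^ M ≈ - 1# → ¬ ι n * ι n ≈ c
  euler-nonsquare c n c^M≈-1 n²≈c = contradiction
    (ι≈0⇒∣ 2 (using-eq 1# (trans (sym (fermat-unit n p∤n)) n^2M≈-1)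
      (solve 0 (ℕcon 2 :+ ℕcon 1 :* :- ℕcon 1 := ℕcon 0 :+ ℕcon 1 :* ℕcon 1) refl)))
    (>⇒∤ 2<p)
    where
    n^2M≈-1 : ι n ^ (M ℕ.+ M) ≈ - 1#
    n^2M≈-1 = trans (^-+ (ι n) M M) (trans (sym (^-distrib M (ι n) (ι n))) (trans (^-cong M n²≈c) c^M≈-1))
    p∤n : ¬ p ∣ n
    p∤n p∣n = ^M-unit c 1 (trans c^M≈-1 (sym (*-identityˡ (- 1#))))
      (trans (sym n²≈c) (trans (*-congʳ (characteristic n p∣n)) (zeroˡ _)))

  odds : ℕ → ℕ
  odds n = ∏ℕ n (λ i → suc (2 ℕ.* i ℕ.+ 0))

  -- 2 i + 1 = p - 2 (M - i).
  odds-reflect : ∀ n b → b ℕ.+ n ≡ M → ι (odds n) * ι (b !) ≈ (- ι 2) ^ n * ι (M !)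
  odds-reflect zero    b b≡M = *-cong (+-identityʳ 1#) (reflexive (≡.cong (λ n → ι (n !)) (≡.trans (≡.sym (ℕ.+-identityʳ b)) b≡M)))
  odds-reflect (suc n) b b+n≡M = begin
    ι (odds n ℕ.* suc (2 ℕ.* n ℕ.+ 0)) * ι (b !)
      ≈⟨ *-congʳ (ι-* (odds n) (suc (2 ℕ.* n ℕ.+ 0))) ⟩
    ι (odds n) * ι (suc (2 ℕ.* n ℕ.+ 0)) * ι (b !)
      ≈⟨ using-eq (ι (odds n) * ι (b !)) sum≈0
         (solve 4 (λ o k x b → o :* k :* x :+ o :* x :* ℕcon 0
           := :- ℕcon 2 :* (o :* ((ℕcon 1 :+ b) :* x)) :+ o :* x :* (ℕcon 2 :* (ℕcon 1 :+ b) :+ k))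
           refl (ι (odds n)) (ι (suc (2 ℕ.* n ℕ.+ 0))) (ι (b !)) (ι b)) ⟩
    - ι 2 * (ι (odds n) * (ι (suc b) * ι (b !)))
      ≈⟨ *-congˡ (*-congˡ (sym (ι-* (suc b) (b !)))) ⟩
    - ι 2 * (ι (odds n) * ι (suc b !))
      ≈⟨ *-congˡ (odds-reflect n (suc b) (≡.trans (≡.sym (ℕ.+-suc b n)) b+n≡M)) ⟩
    - ι 2 * ((- ι 2) ^ n * ι (M !))
      ≈⟨ solve 3 (λ a b c → a :* (b :* c) := b :* a :* c) refl _ _ _ ⟩
    (- ι 2) ^ suc n * ι (M !) ∎
    where
    lemma : ∀ b n → 2 ℕ.* suc b ℕ.+ suc (2 ℕ.* n ℕ.+ 0) ≡ suc ((b ℕ.+ suc n) ℕ.+ (b ℕ.+ suc n))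
    lemma = solve-∀
    sum≈0 : ι 2 * ι (suc b) + ι (suc (2 ℕ.* n ℕ.+ 0)) ≈ 0#
    sum≈0 = begin
      ι 2 * ι (suc b) + ι (suc (2 ℕ.* n ℕ.+ 0))       ≈⟨ +-congʳ (ι-* 2 (suc b)) ⟨
      ι (2 ℕ.* suc b) + ι (suc (2 ℕ.* n ℕ.+ 0))       ≈⟨ ι-+ (2 ℕ.* suc b) (suc (2 ℕ.* n ℕ.+ 0)) ⟨
      ι (2 ℕ.* suc b ℕ.+ suc (2 ℕ.* n ℕ.+ 0))         ≡⟨ ≡.cong ι (≡.trans (lemma b n) (≡.cong (λ m → suc (m ℕ.+ m)) b+n≡M)) ⟩
      ι (suc (M ℕ.+ M))                               ≡⟨ ≡.cong ι p≡1+2M ⟨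
      ι p                                             ≈⟨ characteristic p (divides 1 (≡.sym (ℕ.*-identityˡ p))) ⟩
      0#                                              ∎

  !-split : ∀ e a → e ℕ.≤ 1 → 2 ℕ.^ a ℕ.* (odds (e ℕ.+ a) ℕ.* a !) ≡ (e ℕ.+ (a ℕ.+ a)) !
  !-split _ a z≤n = ≡.trans (lemma (2 ℕ.^ a) (odds a) (a !)) (!-parity a)
    where
    lemma : ∀ x y z → x ℕ.* (y ℕ.* z) ≡ x ℕ.* z ℕ.* y
    lemma = solve-∀
  !-split _ a (s≤s z≤n) = ≡.trans (lemma (2 ℕ.^ a) (odds a) (a !) a) (≡.cong (suc (a ℕ.+ a) ℕ.*_) (!-parity a))
    where
    lemma : ∀ x y z a → x ℕ.* (y ℕ.* suc (2 ℕ.* a ℕ.+ 0) ℕ.* z) ≡ suc (a ℕ.+ a) ℕ.* (x ℕ.* z ℕ.* y)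
    lemma = solve-∀

  p∤! : ∀ n → n < p → ¬ p ∣ n !
  p∤! zero    _   = prime∤1 pr
  p∤! (suc n) n<p = prime∤* pr (suc n) (n !) (>⇒∤ n<p) (p∤! n (ℕ.<-trans (ℕ.n<1+n n) n<p))

  -- In the spirit of Gauss's lemma. M! is 2^a a! times the first e + a odd numbers, and
  -- `odds-reflect` turns these into (-2)^(e+a) M!/a!. Cancelling M! leaves 2^a (-2)^(e+a) = 1, and
  -- (-2)^M is (-1)^a times this product.
  [-2]^M : ∀ e a → e ℕ.≤ 1 → M ≡ e ℕ.+ (a ℕ.+ a) → (- ι 2) ^ M ≈ sgn a
  [-2]^M e a e≤1 M≡ = begin
    (- ι 2) ^ M
      ≡⟨ ≡.cong ((- ι 2) ^_) (≡.trans M≡ (≡.sym (lemma a e))) ⟩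
    (- ι 2) ^ (a ℕ.+ n)
      ≈⟨ ^-+ (- ι 2) a n ⟩
    (- ι 2) ^ a * (- ι 2) ^ n
      ≈⟨ *-congʳ (trans (^-cong a (sym (-1*x≈-x (ι 2)))) (^-distrib a (- 1#) (ι 2))) ⟩
    sgn a * ι 2 ^ a * (- ι 2) ^ n
      ≈⟨ trans (*-assoc _ _ _) (trans (*-congˡ 2^a[-2]^n≈1) (*-identityʳ _)) ⟩
    sgn a ∎
    where
    n = e ℕ.+ a
    lemma : ∀ a e → a ℕ.+ (e ℕ.+ a) ≡ e ℕ.+ (a ℕ.+ a)
    lemma = solve-∀
    M<p : M < p
    M<p = ℕ.≤-trans (s≤s (ℕ.m≤m+n M M)) (ℕ.≤-reflexive (≡.sym p≡1+2M))
    M!≈ : ι (M !) ≈ ι 2 ^ a * ((- ι 2) ^ n * ι (M !))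
    M!≈ = begin
      ι (M !)                                        ≡⟨ ≡.cong ι (≡.trans (≡.cong _! M≡) (≡.sym (!-split e a e≤1))) ⟩
      ι (2 ℕ.^ a ℕ.* (odds n ℕ.* a !))               ≈⟨ trans (ι-* (2 ℕ.^ a) (odds n ℕ.* a !)) (*-cong (ι-^ 2 a) (ι-* (odds n) (a !))) ⟩
      ι 2 ^ a * (ι (odds n) * ι (a !))               ≈⟨ *-congˡ (odds-reflect n a (≡.trans (lemma a e) (≡.sym M≡))) ⟩
      ι 2 ^ a * ((- ι 2) ^ n * ι (M !))              ∎
    2^a[-2]^n≈1 : ι 2 ^ a * (- ι 2) ^ n ≈ 1#
    2^a[-2]^n≈1 = using-eq 1# (ι-cancel (M !) (X - 1#) (p∤! M M<p) (using-eq (- 1#) M!≈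
        (solve 3 (λ m a b → m :* (a :* b :- ℕcon 1) :+ :- ℕcon 1 :* (a :* (b :* m)) := ℕcon 0 :+ :- ℕcon 1 :* m)
          refl (ι (M !)) (ι 2 ^ a) ((- ι 2) ^ n))))
      (solve 1 (λ x → x :+ ℕcon 1 :* ℕcon 0 := ℕcon 1 :+ ℕcon 1 :* (x :- ℕcon 1)) refl X)
      where
      X = ι 2 ^ a * (- ι 2) ^ n

-- Signs and Legendre symbols.

module SignLemmas {c ℓ} (R : CommutativeRing c ℓ) where

  open RingLemmas R

  -- The argument is M = 2 (e + a) + a. This identifies (-1)^M, the symbol of -1, with the sign
  -- (-1)^⌊p/6⌋ of the last sum.
  sgn-triple : ∀ e a → sgn ((e ℕ.+ (a ℕ.+ a)) ℕ.+ (e ℕ.+ a)) ≈ sgn a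
  sgn-triple e a = begin
    sgn ((e ℕ.+ (a ℕ.+ a)) ℕ.+ (e ℕ.+ a))        ≡⟨ ≡.cong sgn (lemma e a) ⟩
    sgn ((e ℕ.+ a) ℕ.+ (e ℕ.+ a) ℕ.+ a)          ≈⟨ ^-+ (- 1#) ((e ℕ.+ a) ℕ.+ (e ℕ.+ a)) a ⟩
    sgn ((e ℕ.+ a) ℕ.+ (e ℕ.+ a)) * sgn a        ≈⟨ *-congʳ (sgn-even (e ℕ.+ a)) ⟩
    1# * sgn a                                   ≈⟨ *-identityˡ _ ⟩
    sgn a                                        ∎
    where
    lemma : ∀ e a → (e ℕ.+ (a ℕ.+ a)) ℕ.+ (e ℕ.+ a) ≡ (e ℕ.+ a) ℕ.+ (e ℕ.+ a) ℕ.+ a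
    lemma = solve-∀

  -- Modulo 3 the left side is 1 + e = (-1)^e, and e + 2a has the parity of e.
  ι-mod3 : ι 3 ≈ 0# → ∀ e a → e ℕ.≤ 1 → ι (3 ℕ.* (e ℕ.+ (a ℕ.+ a)) ℕ.+ suc e) ≈ sgn (e ℕ.+ (a ℕ.+ a))
  ι-mod3 3≈0 e a e≤1 = begin
    ι (3 ℕ.* m ℕ.+ suc e)       ≈⟨ trans (ι-+ (3 ℕ.* m) (suc e)) (+-congʳ (ι-* 3 m)) ⟩
    ι 3 * ι m + ι (suc e)       ≈⟨ trans (+-congʳ (trans (*-congʳ 3≈0) (zeroˡ _))) (+-identityˡ _) ⟩
    ι (suc e)                   ≈⟨ residue e e≤1 ⟩
    sgn m                       ∎
    where
    m = e ℕ.+ (a ℕ.+ a)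
    residue : ∀ e → e ℕ.≤ 1 → ι (suc e) ≈ sgn (e ℕ.+ (a ℕ.+ a))
    residue _ z≤n       = trans (+-identityʳ 1#) (sym (sgn-even a))
    residue _ (s≤s z≤n) = trans (using-eq 1# 3≈0
      (solve 0 (ℕcon 2 :+ ℕcon 1 :* ℕcon 0 := ℕcon 1 :* :- ℕcon 1 :+ ℕcon 1 :* ℕcon 3) refl)) (*-congʳ (sym (sgn-even a)))

module ℤ-Ring = RingLemmas ℤ.+-*-commutativeRing

sgnℤ : ℕ → ℤ
sgnℤ = ℤ-Ring.sgn

sgnℤ-values : ∀ n → sgnℤ n ≡ 1ℤ ⊎ sgnℤ n ≡ -1ℤ
sgnℤ-values zero    = inj₁ ≡.refl
sgnℤ-values (suc n) with sgnℤ-values n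
... | inj₁ eq = inj₂ (≡.cong (ℤ._* -1ℤ) eq)
... | inj₂ eq = inj₁ (≡.cong (ℤ._* -1ℤ) eq)

legendre≡1 : ∀ c p → ¬ (+ p) ℤ.∣ c → IsSquareMod p c → legendre c p ≡ 1ℤ
legendre≡1 c p p∤c square rewrite dec-false (+ p ℤ.∣? c) p∤c | dec-true (isSquareMod? p c) square = ≡.refl

legendre≡-1 : ∀ c p → ¬ (+ p) ℤ.∣ c → ¬ IsSquareMod p c → legendre c p ≡ -1ℤ
legendre≡-1 c p p∤c nonsquare rewrite dec-false (+ p ℤ.∣? c) p∤c | dec-false (isSquareMod? p c) nonsquare = ≡.refl

module LegendreSymbol (p : ℕ) (pr : Prime p) (M : ℕ) (p≡1+2M : p ≡ suc (M ℕ.+ M)) (2<p : 2 < p) where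

  ℤ/p : CommutativeRing _ _
  ℤ/p = Quotient.quotient ℤ.+-*-commutativeRing (+ p)

  private
    module Q = CommutativeRing ℤ/p
    module L = RingLemmas ℤ/p

  value-ι : ∀ n → L.ι n ≡ + n
  value-ι zero    = ≡.refl
  value-ι (suc n) = ≡.cong (λ z → 1ℤ ℤ.+ z) (value-ι n)

  ∣⇒≈ : ∀ x y → + p ℤ.∣ x ℤ.- y → x Q.≈ y
  ∣⇒≈ x y (ℤ.divides q eq) = q , ≡.trans eq (ℤ.*-comm q (+ p))

  ≈⇒∣ : ∀ x y → x Q.≈ y → + p ℤ.∣ x ℤ.- y
  ≈⇒∣ x y (z , eq) = ℤ.divides z (≡.trans eq (ℤ.*-comm (+ p) z))

  ∣⇒≈0 : ∀ x → + p ℤ.∣ x → x Q.≈ 0ℤ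
  ∣⇒≈0 x p∣x = ∣⇒≈ x 0ℤ (≡.subst (+ p ℤ.∣_) (≡.sym (ℤ.+-identityʳ x)) p∣x)

  ≈0⇒∣ : ∀ x → x Q.≈ 0ℤ → + p ℤ.∣ x
  ≈0⇒∣ x x≈0 = ≡.subst (+ p ℤ.∣_) (ℤ.+-identityʳ x) (≈⇒∣ x 0ℤ x≈0)

  characteristic : ∀ n → p ∣ n → L.ι n Q.≈ 0ℤ
  characteristic n p∣n = ∣⇒≈0 (L.ι n) (≡.subst (+ p ℤ.∣_) (≡.sym (value-ι n)) (ℤ.∣ᵤ⇒∣ p∣n))

  ι≈0⇒∣ : ∀ n → L.ι n Q.≈ 0ℤ → p ∣ n
  ι≈0⇒∣ n ιn≈0 = ℤ.∣⇒∣ᵤ (≡.subst (+ p ℤ.∣_) (value-ι n) (≈0⇒∣ (L.ι n) ιn≈0))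

  domain : L.NoZeroDivisors
  domain x y xy≈0 = factor (euclidsLemma ∣ x ∣ ∣ y ∣ pr (≡.subst (p ∣_) (ℤ.abs-* x y) (ℤ.∣⇒∣ᵤ (≈0⇒∣ (x ℤ.* y) xy≈0))))
    where
    factor : (p ∣ ∣ x ∣) ⊎ (p ∣ ∣ y ∣) → x Q.≈ 0ℤ ⊎ y Q.≈ 0ℤ
    factor (inj₁ p∣x) = inj₁ (∣⇒≈0 x (ℤ.∣ᵤ⇒∣ p∣x))
    factor (inj₂ p∣y) = inj₂ (∣⇒≈0 y (ℤ.∣ᵤ⇒∣ p∣y))

  open PrimeField ℤ/p p pr M p≡1+2M 2<p characteristic ι≈0⇒∣ domain public

  private
    value-ι² : ∀ n → L.ι n ℤ.* L.ι n ≡ + n ℤ.* + n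
    value-ι² n = ≡.cong₂ ℤ._*_ (value-ι n) (value-ι n)

  -- Euler's criterion with the power given as a sign. The power being a unit excludes the value 0;
  -- the sign then decides whether `c` is a square.
  legendre-euler : ∀ c a → c L.^ M Q.≈ L.sgn a → legendre c p ≡ sgnℤ a
  legendre-euler c a c^M≈ = value (sgnℤ-values a)
    where
    p∤c : ¬ + p ℤ.∣ c
    p∤c p∣c = ^M-unit c a c^M≈ (∣⇒≈0 c p∣c)
    square : ∃[ i ] (i < M × L.ι (suc i) ℤ.* L.ι (suc i) Q.≈ c) → IsSquareMod p c
    square (i , i<M , i²≈c) = fromℕ< i<p ,
      ≡.subst (λ n → + p ℤ.∣ + n ℤ.* + n ℤ.- c) (≡.sym (Fin.toℕ-fromℕ< i<p))
        (≡.subst (λ z → + p ℤ.∣ z ℤ.- c) (value-ι² (suc i)) (≈⇒∣ (L.ι (suc i) ℤ.* L.ι (suc i)) c i²≈c))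
      where
      i<p : suc i < p
      i<p = ≡.subst (suc i <_) (≡.sym p≡1+2M) (s≤s (ℕ.≤-trans i<M (ℕ.m≤m+n M M)))
    nonsquare : sgnℤ a ≡ -1ℤ → ¬ IsSquareMod p c
    nonsquare sgn≡-1 (x , p∣x²-c) = euler-nonsquare c (toℕ x) (≡.subst (c L.^ M Q.≈_) sgn≡-1 c^M≈)
      (∣⇒≈ (L.ι (toℕ x) ℤ.* L.ι (toℕ x)) c (≡.subst (λ z → + p ℤ.∣ z ℤ.- c) (≡.sym (value-ι² (toℕ x))) p∣x²-c))
    value : sgnℤ a ≡ 1ℤ ⊎ sgnℤ a ≡ -1ℤ → legendre c p ≡ sgnℤ a
    value (inj₁ sgn≡1)  = ≡.trans (legendre≡1 c p p∤c (square (euler-square c (≡.subst (c L.^ M Q.≈_) sgn≡1 c^M≈)))) (≡.sym sgn≡1)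
    value (inj₂ sgn≡-1) = ≡.trans (legendre≡-1 c p p∤c (nonsquare sgn≡-1)) (≡.sym sgn≡-1)

  legendre-[-1] : legendre -[1+ 0 ] p ≡ sgnℤ M
  legendre-[-1] = legendre-euler -[1+ 0 ] M (Q.refl {L.sgn M})

  legendre-[-2] : ∀ e a → e ℕ.≤ 1 → M ≡ e ℕ.+ (a ℕ.+ a) → legendre -[1+ 1 ] p ≡ sgnℤ a
  legendre-[-2] e a e≤1 M≡ = legendre-euler -[1+ 1 ] a ([-2]^M e a e≤1 M≡)

legendre-mod3 : ∀ p e a → e ℕ.≤ 1 → p ≡ 3 ℕ.* (e ℕ.+ (a ℕ.+ a)) ℕ.+ suc e → legendre (+ p) 3 ≡ sgnℤ (e ℕ.+ (a ℕ.+ a))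
legendre-mod3 p e a e≤1 p≡ = legendre-euler (+ p) m
  (≡.subst (Q._≈ sgnℤ m) (≡.trans (value-ι n) (≡.trans (≡.cong +_ (≡.sym p≡)) (≡.sym (ℤ.*-identityˡ (+ p)))))
    (SignLemmas.ι-mod3 ℤ/p (characteristic 3 (divides 1 ≡.refl)) e a e≤1))
  where
  -- For the modulus 3 Euler's exponent is (3-1)/2 = 1, so the criterion asks only for p modulo 3.
  open LegendreSymbol 3 (from-yes (prime? 3)) 1 ≡.refl ℕ.≤-refl
  module Q = CommutativeRing ℤ/p
  m = e ℕ.+ (a ℕ.+ a)
  n = 3 ℕ.* m ℕ.+ suc e

-- From the local ring back to rational numbers: the four congruences.

open import Data.Nat.Base using (_^_)
open import Data.Rational.Base using (_/_; _+_; _*_; _-_; -_)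

sgn-/1 : ∀ n → sgnℤ n / 1 ≡ ℚ-Ring.sgn n
sgn-/1 zero    = ≡.refl
sgn-/1 (suc n) = ≡.trans (negate (sgnℤ-values n)) (≡.cong (_* - 1ℚ) (sgn-/1 n))
  where
  negate : ∀ {i} → i ≡ 1ℤ ⊎ i ≡ -1ℤ → (i ℤ.* -1ℤ) / 1 ≡ i / 1 * - 1ℚ
  negate (inj₁ ≡.refl) = ≡.refl
  negate (inj₂ ≡.refl) = ≡.refl

+-^ : ∀ a n → (+ a) ℤ.^ n ≡ + (a ^ n)
+-^ a zero    = ≡.refl
+-^ a (suc n) = ≡.trans (≡.cong (+ a ℤ.*_) (+-^ a n)) (≡.sym (ℤ.pos-* a (a ^ n)))

fermatQuotient-unique : ∀ p .{{_ : NonZero p}} a q → 1ℚ + + p / 1 * q ≡ + (a ^ (p ℕ.∸ 1)) / 1 → fermatQuotient p (+ a) ≡ q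
fermatQuotient-unique p a q eq = ℚ-Ring.*-cancelʳ-unit
  (≡.trans (ℚ.*-comm (+ p / 1) (1ℤ / p)) (/-*-cancel 1ℤ p)) (begin
  fermatQuotient p (+ a) * (+ p / 1)                   ≡⟨ /-*-cancel ((+ a) ℤ.^ (p ℕ.∸ 1) ℤ.- 1ℤ) p ⟩
  ((+ a) ℤ.^ (p ℕ.∸ 1) ℤ.- 1ℤ) / 1                     ≡⟨ /1-+ ((+ a) ℤ.^ (p ℕ.∸ 1)) -1ℤ ⟩
  (+ a) ℤ.^ (p ℕ.∸ 1) / 1 + -1ℤ / 1                    ≡⟨ ≡.cong (λ i → i / 1 + -1ℤ / 1) (+-^ a (p ℕ.∸ 1)) ⟩
  + (a ^ (p ℕ.∸ 1)) / 1 + -1ℤ / 1                      ≡⟨ ≡.cong (_+ (-1ℤ / 1)) (≡.sym eq) ⟩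
  1ℚ + + p / 1 * q - 1ℚ                                ≡⟨ ℚ-Ring.solve 2 (λ π q → ℚ-Ring.ℕcon 1 ℚ-Ring.:+ π ℚ-Ring.:* q ℚ-Ring.:- ℚ-Ring.ℕcon 1
                                                            ℚ-Ring.:= q ℚ-Ring.:* π) ≡.refl (+ p / 1) q ⟩
  q * (+ p / 1)                                        ∎)
  where open ≡.≡-Reasoning

module Congruences (p : ℕ) .{{p≢0 : NonZero p}} (pr : Prime p) (3<p : 3 < p) (M : ℕ) (p≡1+2M : p ≡ suc (M ℕ.+ M))
  (e₄ a₄ : ℕ) (e₄≤1 : e₄ ℕ.≤ 1) (M≡₄ : M ≡ e₄ ℕ.+ (a₄ ℕ.+ a₄))
  (e e′ a : ℕ) (e+e′≡1 : e ℕ.+ e′ ≡ 1) (M≡₆ : M ≡ (e ℕ.+ (a ℕ.+ a)) ℕ.+ (e ℕ.+ a)) where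

  module B = LocalRing p pr
  open B using (ℤ₍ₚ₎; ι; inv; inv-correct; localRing; _≈ₘ_; ≈⇒≈ₘ)
  module HS = HypergeometricSums localRing p M p≡1+2M 3<p inv inv-correct
  module FQ = FermatQuotients localRing p M p≡1+2M 3<p inv inv-correct
  module M3 = HS.Modulo3 e e′ a e+e′≡1 M≡₆
  module SS = SignedSums localRing p M p≡1+2M 3<p inv inv-correct

  2<p : 2 < p
  2<p = ℕ.<-trans (ℕ.n<1+n 2) 3<p

  e≤1 : e ℕ.≤ 1
  e≤1 = ℕ.≤-trans (ℕ.m≤m+n e e′) (ℕ.≤-reflexive e+e′≡1)

  module LS = LegendreSymbol p pr M p≡1+2M 2<p

  p-1≡2M : p ℕ.∸ 1 ≡ M ℕ.+ M
  p-1≡2M = ≡.cong (ℕ._∸ 1) p≡1+2M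

  quotient-value : ∀ b q → B.1# B.+ ι p B.* q B.≈ ι (b ^ (M ℕ.+ M)) → fermatQuotient p (+ b) ≡ proj₁ q
  quotient-value b q eq = fermatQuotient-unique p b (proj₁ q) (begin
    1ℚ + + p / 1 * proj₁ q            ≡⟨ ≡.cong (λ x → 1ℚ + x * proj₁ q) (B.value-ι p) ⟨
    1ℚ + proj₁ (ι p) * proj₁ q        ≡⟨ eq ⟩
    proj₁ (ι (b ^ (M ℕ.+ M)))         ≡⟨ B.value-ι (b ^ (M ℕ.+ M)) ⟩
    + (b ^ (M ℕ.+ M)) / 1             ≡⟨ ≡.cong (λ n → + (b ^ n) / 1) p-1≡2M ⟨
    + (b ^ (p ℕ.∸ 1)) / 1             ∎)
    where open ≡.≡-Reasoning

  q₂≡ : fermatQuotient p (+ 2) ≡ proj₁ FQ.quotient₂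
  q₂≡ = quotient-value 2 FQ.quotient₂ FQ.quotient₂-correct

  q₃≡ : fermatQuotient p (+ 3) ≡ proj₁ M3.quotient₃
  q₃≡ = quotient-value 3 M3.quotient₃ M3.quotient₃-correct

  value-sgn : ∀ n → sgnℤ n / 1 ≡ proj₁ (B.sgn n)
  value-sgn n = ≡.trans (sgn-/1 n) (lemma n)
    where
    lemma : ∀ n → ℚ-Ring.sgn n ≡ proj₁ (B.sgn n)
    lemma zero    = ≡.refl
    lemma (suc n) = ≡.cong (_* - 1ℚ) (lemma n)

  -- All denominators are at most `n < p`, so the default value of `inv` is never met.
  H≡ : ∀ n → n < p → H n ≡ proj₁ (B.∑ n inv)
  H≡ n n<p = begin
    H n                                        ≡⟨ Σ<≡∑ n (λ j → 1ℤ / suc j) ⟩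
    ℚ-Ring.∑ n (λ j → 1ℤ / suc j)              ≡⟨ ℚ-Ring.∑-cong n (λ j j<n → ≡.sym (B.value-inv j (ℕ.≤-<-trans j<n n<p))) ⟩
    ℚ-Ring.∑ n (λ j → proj₁ (inv j))           ≡⟨ B.value-∑ n inv ⟨
    proj₁ (B.∑ n inv)                          ∎
    where open ≡.≡-Reasoning

  module _ (m : ℕ) .{{m≢0 : NonZero m}} (p∤m : ¬ p ∣ m) (A : ℕ → ℕ) where

    term : ℕ → ℤ₍ₚ₎
    term k = A k /[ m ^ k ] , B./-∈ (+ A k) (m ^ k) {{ℕ.m^n≢0 m k}} (prime∤^ pr m k p∤m)

    term-correct : ∀ k → term k B.* ι (m ^ k) B.≈ ι (A k)
    term-correct k = begin
      A k /[ m ^ k ] * proj₁ (ι (m ^ k))     ≡⟨ ≡.cong (A k /[ m ^ k ] *_) (B.value-ι (m ^ k)) ⟩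
      A k /[ m ^ k ] * (+ (m ^ k) / 1)       ≡⟨ /-*-cancel (+ A k) (m ^ k) {{ℕ.m^n≢0 m k}} ⟩
      + A k / 1                              ≡⟨ B.value-ι (A k) ⟨
      proj₁ (ι (A k))                        ∎
      where open ≡.≡-Reasoning

    lhs≡ : ∀ l n → l ≡ sgnℤ n →
      proj₁ (B.sgn n B.* B.∑ p (λ k → term k B.* B.∑ k inv)) ≡ (l / 1) * (Σ[ k < p ] (A k /[ m ^ k ] * H k))
    lhs≡ l n l≡ = ≡.sym (≡.cong₂ _*_ (≡.trans (≡.cong (_/ 1) l≡) (value-sgn n)) (begin
      Σ< p (λ k → A k /[ m ^ k ] * H k)
        ≡⟨ Σ<≡∑ p (λ k → A k /[ m ^ k ] * H k) ⟩
      ℚ-Ring.∑ p (λ k → A k /[ m ^ k ] * H k)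
        ≡⟨ ℚ-Ring.∑-cong p (λ k k<p → ≡.cong (A k /[ m ^ k ] *_) (H≡ k k<p)) ⟩
      ℚ-Ring.∑ p (λ k → A k /[ m ^ k ] * proj₁ (B.∑ k inv))
        ≡⟨ B.value-∑ p (λ k → term k B.* B.∑ k inv) ⟨
      proj₁ (B.∑ p (λ k → term k B.* B.∑ k inv)) ∎))
      where open ≡.≡-Reasoning

  three-halves : ℤ₍ₚ₎
  three-halves = + 3 / 2 , B./-∈ (+ 3) 2 (>⇒∤ 2<p)

  three-halves-correct : three-halves B.* ι 2 ≈ₘ ι 3
  three-halves-correct = ≈⇒≈ₘ {three-halves B.* ι 2} {ι 3} ≡.refl

  p∤2 : ¬ p ∣ 2
  p∤2 = >⇒∤ 2<p

  p∤3 : ¬ p ∣ 3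
  p∤3 = >⇒∤ 3<p

  p∤16 : ¬ p ∣ 16
  p∤16 = prime∤^ pr 2 4 p∤2

  p∤27 : ¬ p ∣ 27
  p∤27 = prime∤^ pr 3 3 p∤3

  p∤64 : ¬ p ∣ 64
  p∤64 = prime∤^ pr 2 6 p∤2

  p∤432 : ¬ p ∣ 432
  p∤432 = prime∤* pr 16 27 p∤16 p∤27

  private
    q₂ q₃ : ℚ
    q₂ = fermatQuotient p (+ 2)
    q₃ = fermatQuotient p (+ 3)

    Q₂ Q₃ : ℤ₍ₚ₎
    Q₂ = FQ.quotient₂
    Q₃ = M3.quotient₃

    value-neg : ∀ n {q} Q → q ≡ proj₁ Q → proj₁ (B.- ι n B.* Q) ≡ - (+ n / 1) * q
    value-neg n Q q≡ = ≡.cong₂ (λ i q → - i * q) (B.value-ι n) (≡.sym q≡)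

    value-square : ∀ t i {q} Q → proj₁ t ≡ i → q ≡ proj₁ Q → proj₁ (t B.* (Q B.* Q)) ≡ i * (q * q)
    value-square t i Q t≡ q≡ = ≡.cong₂ (λ i q → i * (q * q)) t≡ (≡.sym q≡)

    value-π : ∀ t i → proj₁ t ≡ i → proj₁ (t B.* ι p) ≡ i * (+ p / 1)
    value-π t i t≡ = ≡.cong₂ _*_ t≡ (B.value-ι p)

    conclude : ∀ {x y} x′ y′ → proj₁ x′ ≡ x → x′ ≈ₘ y′ → proj₁ y′ ≡ y → x ≋ y [mod p ^ 2 ]∈ℤ₍ p ₎
    conclude x′ y′ x′≡x x′≈y′ y′≡y = ≡.subst₂ (λ x y → x ≋ y [mod p ^ 2 ]∈ℤ₍ p ₎) x′≡x y′≡y (B.≈ₘ⇒≋ {x′} {y′} x′≈y′)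

    total : (ℕ → ℤ₍ₚ₎) → ℤ₍ₚ₎
    total f = B.∑ p (λ k → f k B.* B.∑ k inv)

  result₂ : (legendre -[1+ 0 ] p / 1) * (Σ[ k < p ] (A₂ k /[ 16 ^ k ] * H k))
    ≋ - (+ 4 / 1) * q₂ + (+ 2 / 1) * (+ p / 1) * (q₂ * q₂) [mod p ^ 2 ]∈ℤ₍ p ₎
  result₂ = conclude (B.sgn M B.* total f) rhs
    (lhs≡ 16 p∤16 A₂ (legendre -[1+ 0 ] p) M LS.legendre-[-1])
    (SS.signed M (total f) (B.- ι 4 B.* FQ.L Q₂) rhs (HS.congruence₂ f (term-correct 16 p∤16 A₂)) (SS.expand₂ Q₂))
    (≡.cong₂ _+_ (value-neg 4 Q₂ q₂≡) (value-square (ι 2 B.* ι p) _ Q₂ (value-π (ι 2) (+ 2 / 1) (B.value-ι 2)) q₂≡))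
    where
    f = term 16 p∤16 A₂
    rhs = B.- ι 4 B.* Q₂ B.+ ι 2 B.* ι p B.* (Q₂ B.* Q₂)

  result₃ : (legendre (+ p) 3 / 1) * (Σ[ k < p ] (A₃ k /[ 27 ^ k ] * H k))
    ≋ - (+ 3 / 1) * q₃ + (+ 3 / 2) * (+ p / 1) * (q₃ * q₃) [mod p ^ 2 ]∈ℤ₍ p ₎
  result₃ = conclude (B.sgn M3.m B.* total f) rhs
    (lhs≡ 27 p∤27 A₃ (legendre (+ p) 3) M3.m (legendre-mod3 p e a e≤1 M3.p≡3m+1+e))
    (SS.signed M3.m (total f) (B.- ι 3 B.* FQ.L Q₃) rhs (M3.congruence₃ f (term-correct 27 p∤27 A₃))
      (SS.expand₃ three-halves Q₃ three-halves-correct))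
    (≡.cong₂ _+_ (value-neg 3 Q₃ q₃≡) (value-square (three-halves B.* ι p) _ Q₃ (value-π three-halves (+ 3 / 2) ≡.refl) q₃≡))
    where
    f = term 27 p∤27 A₃
    rhs = B.- ι 3 B.* Q₃ B.+ three-halves B.* ι p B.* (Q₃ B.* Q₃)

  result₄ : (legendre -[1+ 1 ] p / 1) * (Σ[ k < p ] (A₄ k /[ 64 ^ k ] * H k))
    ≋ - (+ 6 / 1) * q₂ + (+ 3 / 1) * (+ p / 1) * (q₂ * q₂) [mod p ^ 2 ]∈ℤ₍ p ₎
  result₄ = conclude (B.sgn a₄ B.* total f) rhs
    (lhs≡ 64 p∤64 A₄ (legendre -[1+ 1 ] p) a₄ (LS.legendre-[-2] e₄ a₄ e₄≤1 M≡₄))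
    (SS.signed a₄ (total f) (B.- ι 6 B.* FQ.L Q₂) rhs (HS.congruence₄ e₄ a₄ e₄≤1 M≡₄ f (term-correct 64 p∤64 A₄)) (SS.expand₄ Q₂))
    (≡.cong₂ _+_ (value-neg 6 Q₂ q₂≡) (value-square (ι 3 B.* ι p) _ Q₂ (value-π (ι 3) (+ 3 / 1) (B.value-ι 3)) q₂≡))
    where
    f = term 64 p∤64 A₄
    rhs = B.- ι 6 B.* Q₂ B.+ ι 3 B.* ι p B.* (Q₂ B.* Q₂)

  result₆ : (legendre -[1+ 0 ] p / 1) * (Σ[ k < p ] (A₆ k /[ 432 ^ k ] * H k))
    ≋ - (+ 3 / 1) * q₃ - (+ 4 / 1) * q₂ + (+ p / 1) * ((+ 3 / 2) * (q₃ * q₃) + (+ 2 / 1) * (q₂ * q₂)) [mod p ^ 2 ]∈ℤ₍ p ₎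
  result₆ = conclude (B.sgn a B.* total f) rhs
    (lhs≡ 432 p∤432 A₆ (legendre -[1+ 0 ] p) a (≡.trans LS.legendre-[-1]
      (≡.trans (≡.cong sgnℤ M≡₆) (SignLemmas.sgn-triple ℤ.+-*-commutativeRing e a))))
    (SS.signed a (total f) (B.- ι 3 B.* FQ.L Q₃ B.- ι 4 B.* FQ.L Q₂) rhs (M3.congruence₆ f (term-correct 432 p∤432 A₆))
      (SS.expand₆ three-halves Q₃ Q₂ three-halves-correct))
    (≡.cong₂ _+_ (≡.cong₂ _-_ (value-neg 3 Q₃ q₃≡) (≡.cong₂ _*_ (B.value-ι 4) (≡.sym q₂≡)))
      (≡.cong₂ _*_ (B.value-ι p) (≡.cong₂ _+_ (value-square three-halves (+ 3 / 2) Q₃ ≡.refl q₃≡)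
        (value-square (ι 2) (+ 2 / 1) Q₂ (B.value-ι 2) q₂≡))))
    where
    f = term 432 p∤432 A₆
    rhs = B.- ι 3 B.* Q₃ B.- ι 4 B.* Q₂ B.+ ι p B.* (three-halves B.* (Q₃ B.* Q₃) B.+ ι 2 B.* (Q₂ B.* Q₂))

-- Residues of (p-1)/2 modulo 2 and 3, and the theorem.

parity : ∀ n → ∃[ e ] ∃[ a ] (e ℕ.≤ 1 × n ≡ e ℕ.+ (a ℕ.+ a))
parity n with n divMod 2
... | result a Fin.zero eq       = 0 , a , z≤n , ≡.trans eq (lemma a)
  where
  lemma : ∀ a → a ℕ.* 2 ≡ a ℕ.+ a
  lemma = solve-∀
... | result a (Fin.suc Fin.zero) eq = 1 , a , s≤s z≤n , ≡.trans eq (lemma a)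
  where
  lemma : ∀ a → 1 ℕ.+ a ℕ.* 2 ≡ 1 ℕ.+ (a ℕ.+ a)
  lemma = solve-∀

prime-∤ : ∀ {p} d → Prime p → 1 < d → d < p → ¬ d ∣ p
prime-∤ d pr 1<d d<p d∣p with prime⇒irreducible pr d∣p
... | inj₁ ≡.refl = ℕ.<-irrefl ≡.refl 1<d
... | inj₂ ≡.refl = ℕ.<-irrefl ≡.refl d<p

odd-prime : ∀ {p} → Prime p → 3 < p → ∃[ M ] p ≡ suc (M ℕ.+ M)
odd-prime {p} pr 3<p with parity p
... | _ , M , s≤s z≤n , p≡ = M , p≡
... | _ , M , z≤n     , p≡ = contradiction (divides M (≡.trans p≡ (lemma M)))
  (prime-∤ 2 pr ℕ.≤-refl (ℕ.<-trans (ℕ.n<1+n 2) 3<p))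
  where
  lemma : ∀ M → M ℕ.+ M ≡ M ℕ.* 2
  lemma = solve-∀

-- M = 3a and M = 3a+2 are the cases e = 0 and e = 1; M = 3a+1 would make p = 3 (2a+1).
half-mod3 : ∀ {p M} → Prime p → 3 < p → p ≡ suc (M ℕ.+ M) →
  ∃[ e ] ∃[ e′ ] ∃[ a ] (e ℕ.+ e′ ≡ 1 × M ≡ (e ℕ.+ (a ℕ.+ a)) ℕ.+ (e ℕ.+ a))
half-mod3 {p} {M} pr 3<p p≡ with M divMod 3
... | result a Fin.zero eq             = 0 , 1 , a , ≡.refl , ≡.trans eq (lemma a)
  where
  lemma : ∀ a → a ℕ.* 3 ≡ (a ℕ.+ a) ℕ.+ a
  lemma = solve-∀
... | result a (Fin.suc Fin.zero) eq       = contradiction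
  (divides (suc (a ℕ.+ a)) (≡.trans p≡ (≡.trans (≡.cong (λ M → suc (M ℕ.+ M)) eq) (lemma a))))
  (prime-∤ 3 pr (s≤s (s≤s z≤n)) 3<p)
  where
  lemma : ∀ a → suc ((1 ℕ.+ a ℕ.* 3) ℕ.+ (1 ℕ.+ a ℕ.* 3)) ≡ suc (a ℕ.+ a) ℕ.* 3
  lemma = solve-∀
... | result a (Fin.suc (Fin.suc Fin.zero)) eq = 1 , 0 , a , ≡.refl , ≡.trans eq (lemma a)
  where
  lemma : ∀ a → 2 ℕ.+ a ℕ.* 3 ≡ (1 ℕ.+ (a ℕ.+ a)) ℕ.+ (1 ℕ.+ a)
  lemma = solve-∀

corollary1p1 :
    (p : ℕ) .{{_ : NonZero p}} → Prime p → 3 ℕ.< p →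
    let q₂ = fermatQuotient p (+ 2)
        q₃ = fermatQuotient p (+ 3)
    in
      ((legendre -[1+ 0 ] p / 1)
         * (Σ[ k < p ] ((((2 ℕ.* k) C k) ^ 2) /[ 16 ^ k ] * H k))
       ≋ - (+ 4 / 1) * q₂ + (+ 2 / 1) * (+ p / 1) * (q₂ * q₂)
       [mod p ^ 2 ]∈ℤ₍ p ₎)
    × ((legendre (+ p) 3 / 1)
         * (Σ[ k < p ] ((((2 ℕ.* k) C k) ℕ.* ((3 ℕ.* k) C k)) /[ 27 ^ k ] * H k))
       ≋ - (+ 3 / 1) * q₃ + (+ 3 / 2) * (+ p / 1) * (q₃ * q₃)
       [mod p ^ 2 ]∈ℤ₍ p ₎)
    × ((legendre -[1+ 1 ] p / 1)
         * (Σ[ k < p ] ((((4 ℕ.* k) C (2 ℕ.* k)) ℕ.* ((2 ℕ.* k) C k)) /[ 64 ^ k ] * H k))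
       ≋ - (+ 6 / 1) * q₂ + (+ 3 / 1) * (+ p / 1) * (q₂ * q₂)
       [mod p ^ 2 ]∈ℤ₍ p ₎)
    × ((legendre -[1+ 0 ] p / 1)
         * (Σ[ k < p ] ((((6 ℕ.* k) C (3 ℕ.* k)) ℕ.* ((3 ℕ.* k) C k)) /[ 432 ^ k ] * H k))
       ≋ - (+ 3 / 1) * q₃ - (+ 4 / 1) * q₂
           + (+ p / 1) * ((+ 3 / 2) * (q₃ * q₃) + (+ 2 / 1) * (q₂ * q₂))
       [mod p ^ 2 ]∈ℤ₍ p ₎)
corollary1p1 p pr 3<p =
  let M , p≡1+2M = odd-prime pr 3<p
      e₄ , a₄ , e₄≤1 , M≡₄ = parity M
      e , e′ , a , e+e′≡1 , M≡₆ = half-mod3 pr 3<p p≡1+2M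
      open Congruences p pr 3<p M p≡1+2M e₄ a₄ e₄≤1 M≡₄ e e′ a e+e′≡1 M≡₆
  in result₂ , result₃ , result₄ , result₆
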